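{- Let $n=2^tm$ with $m$ odd, and let $x^n+1=(x+1)^{2^t}r_1^{2^t}\cdots r_l^{2^t}$ in $\mathbb{F}_2[x]$ with $r_1,\ldots,r_l$ monic prime self-reciprocal polynomials of even degree. (a) If $n$ is even, then \[ \mathcal{W}_{\mathcal{C}_2}(z)=\sum_{k=0}^nA^{\mathcal{C}_2}_kz^k=\left(1+\sum_{j=1}^{2^{t-1}}2^{3j-1}z^{2j}\right)\prod_{i=1}^lW_i(z),\quad W_i(z)=1+\sum_{j=1}^{2^t}\left(2^{\frac{3j\deg(r_i)}{2}}-2^{\frac{(3j-1)\deg(r_i)}{2}}\right)z^{j\deg(r_i)}, \] and \[ A^{\mathcal{C}_2}=2^{n+1+2^{t-1}}\prod_{i=1}^l\left(1+\sum_{j=1}^{2^t}\left(2^{\frac{j\deg(r_i)}{2}}-2^{\frac{(j-1)\deg(r_i)}{2}}\right)\right)-\frac{2^{3(2^{t-1}+1)}+6}{7}\prod_{i=1}^l\left(1+\sum_{j=1}^{2^t}\left(2^{\frac{3j\deg(r_i)}{2}}-2^{\frac{(3j-1)\deg(r_i)}{2}}\right)\right). \] (b) If $t=0$, i.e. $n$ is odd, then \[ \mathcal{W}_{\mathcal{C}_1}(z)=\sum_{k=0}^nA^{\mathcal{C}_1}_kz^k=\prod_{i=1}^{l}\left[1+\left(2^{3\deg(r_i)/2}-2^{\deg(r_i)}\right)z^{\deg(r_i)}\right] \] and \[ A^{\mathcal{C}_1}=2^{\frac{3n+1}{2}}-2\prod_{i=1}^{l}\left(1+2^{3\deg(r_i)/2}-2^{\deg(r_i)}\right).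 \]
   Context: $\mathrm{Tr}_n:\mathbb{F}_{2^n}\to\mathbb{F}_2$ is the absolute trace and $\mathrm{Tr}_{n/2}$ the absolute trace of $\mathbb{F}_{2^{n/2}}$. $\mathcal{C}_1$ is the set of functions $Q(x)=\mathrm{Tr}_n\big(\sum_{i=1}^{\lfloor (n-1)/2\rfloor}a_ix^{2^i+1}\big)$, $a_i\in\mathbb{F}_2$; for even $n$, $\mathcal{C}_2$ is the set of functions $Q(x)=\mathrm{Tr}_n\big(\sum_{i=1}^{n/2-1}a_ix^{2^i+1}\big)+\mathrm{Tr}_{n/2}(a_{n/2}x^{2^{n/2}+1})$, $a_i\in\mathbb{F}_2$ (both include the zero function). Let $\mathcal{A}=\{\mathrm{Tr}_n(bx)+c: b\in\mathbb{F}_{2^n},c\in\mathbb{F}_2\}$. Fix an ordering $\alpha_1,\dots,\alpha_{2^n}$ of $\mathbb{F}_{2^n}$. For $\mathcal{C}\in\{\mathcal{C}_1,\mathcal{C}_2\}$, $\bar R_{\mathcal{C}}$ is the binary code $\{(f(\alpha_1),\dots,f(\alpha_{2^n})): f=Q+\ell,\ Q\in\mathcal{C},\ \ell\in\mathcal{A}\}$ (a subcode of the second-order Reed–Muller code), with Hamming weight. For $0\le k\le n$, $A^{\mathcal{C}}_k$ is the number of codewords of $\bar R_{\mathcal{C}}$ of weight $2^{n-1}+2^{n-1-k/2}$ (this equals the number of codewords of weight $2^{n-1}-2^{n-1-k/2}$; $A^{\mathcal C}_k=0$ for odd $k$), and $A^{\mathcal{C}}$ is the number of codewords of weight exactly $2^{n-1}$.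 For $f\in\mathbb{F}_2[x]$ with $f(0)\ne0$, $f^*(x)=x^{\deg f}f(1/x)$; $f$ is self-reciprocal if $f^*=f$. A monic $f$ is prime self-reciprocal if either $f$ is irreducible and self-reciprocal, or $f=ugg^*$ with $g$ monic irreducible, $g^*$ not a constant multiple of $g$, $u$ a nonzero constant. -}

module Defs where

open import Data.Bool using (Bool; true; false; _xor_; not; if_then_else_; _∧_; _∨_)
import Data.Bool as B
open import Data.Nat using (ℕ; zero; suc; _+_; _*_; _∸_; _^_; _≤_; _<_; ⌊_/2⌋; _≡ᵇ_; _<ᵇ_)
open import Data.Nat.Divisibility using (_∣_)
open import Data.List using (List; []; _∷_; _++_; length; map; reverse; concatMap; upTo; replicate; foldr; filterᵇ; deduplicate; zip; all)
open import Data.Nat.ListAction using (sum)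
import Data.List.Properties as LP
open import Data.Vec using (Vec; []; _∷_; toList; zipWith)
import Data.Vec as V
open import Data.Product using (_×_; _,_)
open import Data.Sum using (_⊎_)
open import Relation.Binary.PropositionalEquality using (_≡_)
open import Relation.Nullary using (¬_)

-- Polynomials over F₂ : coefficient lists, lowest degree first.

Poly : Set
Poly = List Bool

norm : Poly → Poly
norm [] = []
norm (c ∷ cs) with norm cs
... | [] = if c then true ∷ [] else []
... | d ∷ ds = c ∷ d ∷ ds

_≈ₚ_ : Poly → Poly → Set
f ≈ₚ g = norm f ≡ norm g

_+ₚ_ : Poly → Poly → Poly
[] +ₚ g = g
(c ∷ f) +ₚ [] = c ∷ f
(c ∷ f) +ₚ (d ∷ g) = (c xor d) ∷ (f +ₚ g)

scaleₚ : Bool → Poly → Poly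
scaleₚ c g = map (c ∧_) g

_*ₚ_ : Poly → Poly → Poly
[] *ₚ g = []
(c ∷ f) *ₚ g = scaleₚ c g +ₚ (false ∷ (f *ₚ g))

oneₚ : Poly
oneₚ = true ∷ []

_^ₚ_ : Poly → ℕ → Poly
f ^ₚ zero = oneₚ
f ^ₚ suc k = f *ₚ (f ^ₚ k)

prodₚ : List Poly → Poly
prodₚ = foldr _*ₚ_ oneₚ

xⁿ+1 : ℕ → Poly
xⁿ+1 n = (true ∷ []) +ₚ (replicate n false ++ (true ∷ []))

x+1 : Poly
x+1 = true ∷ true ∷ []

-- degree (degree of the zero polynomial is set to 0; only used for nonzero ones)
deg : Poly → ℕ
deg f = length (norm f) ∸ 1

-- over F₂ "monic" = nonzero
Monic : Poly → Set
Monic f = ¬ (norm f ≡ [])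

constTerm : Poly → Bool
constTerm [] = false
constTerm (c ∷ _) = c

-- f*(x) = x^{deg f} f(1/x)  (reverse the coefficient list)
recip : Poly → Poly
recip f = norm (reverse (norm f))

Irreducible : Poly → Set
Irreducible f = (1 ≤ deg f) × (∀ a b → (a *ₚ b) ≈ₚ f → (deg a ≡ 0) ⊎ (deg b ≡ 0))

SelfReciprocal : Poly → Set
SelfReciprocal f = (constTerm (norm f) ≡ true) × (norm f ≡ recip f)

-- prime self-reciprocal (over F₂ the only nonzero constant is u = 1,
-- and "constant multiple of g" means "equal to g")
PrimeSelfReciprocal : Poly → Set
PrimeSelfReciprocal f =
  Monic f ×
  ((Irreducible f × SelfReciprocal f) ⊎
   (Data.Product.Σ Poly λ g → Monic g × Irreducible g × (constTerm (norm g) ≡ true)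
      × ¬ (recip g ≡ norm g) × (f ≈ₚ (g *ₚ recip g))))

-- The field F_{2^n} = F₂[x]/(p), p = x^n + (plow as lower coefficients).
-- Elements are coefficient vectors of length n.

modulusPoly : {n : ℕ} → Vec Bool n → Poly
modulusPoly plow = toList plow ++ (true ∷ [])

module Field {n : ℕ} (plow : Vec Bool n) where

  F : Set
  F = Vec Bool n

  0F : F
  0F = V.replicate n false

  -- embedding of F₂ (needs the constant coefficient; n ≥ 1 in our use)
  embed : Bool → F
  embed c = go n
    where
    go : (k : ℕ) → Vec Bool k
    go zero = []
    go (suc k) = c ∷ V.replicate k false

  _+F_ : F → F → F
  _+F_ = zipWith _xor_

  private
    shift : {k : ℕ} → Vec Bool k → Vec Bool k × Bool
    shift [] = [] , false
    shift {suc k} (c ∷ v) with shift-aux c v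
      where
      shift-aux : {j : ℕ} → Bool → Vec Bool j → Vec Bool j × Bool
      shift-aux c [] = [] , c
      shift-aux c (d ∷ v) with shift-aux d v
      ... | (w , t) = (c ∷ w) , t
    ... | (w , t) = (false ∷ w) , t

  mulX : F → F
  mulX v with shift v
  ... | (w , top) = if top then w +F plow else w

  _*F_ : F → F → F
  a *F b = foldr (λ ai acc → (if ai then b else 0F) +F mulX acc) 0F (toList a)

  sq : F → F
  sq a = a *F a

  frob : ℕ → F → F
  frob zero a = a
  frob (suc i) a = sq (frob i a)

  sumF : List F → F
  sumF = foldr _+F_ 0F

  -- absolute trace of F_{2^k} computed inside F: Σ_{i<k} y^{2^i}
  traceTo : ℕ → F → F
  traceTo k y = sumF (map (λ i → frob i y) (upTo k))

  Trₙ : F → F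
  Trₙ = traceTo n

  -- trace of F_{2^{n/2}} (applied to elements of the subfield)
  Trₙ/₂ : F → F
  Trₙ/₂ = traceTo ⌊ n /2⌋

  gold : ℕ → F → F
  gold i x = frob i x *F x

  goldSum : {K : ℕ} → Vec Bool K → F → F
  goldSum a x = sumF (map (λ p → if Data.Product.proj₁ p then gold (Data.Product.proj₂ p) x else 0F)
                          (zip (toList a) (map suc (upTo (V.length a)))))

  -- elements of F₂ ⊂ F are 0F and embed true; bit value:
  toBit : F → Bool
  toBit v = foldr _∨_ false (toList v)

allVecs : (k : ℕ) → List (Vec Bool k)
allVecs zero = [] ∷ []
allVecs (suc k) = concatMap (λ v → (false ∷ v) ∷ (true ∷ v) ∷ []) (allVecs k)

allBools : List Bool
allBools = false ∷ true ∷ []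

elems : (n : ℕ) → List (Vec Bool n)
elems n = allVecs n

weight : List Bool → ℕ
weight w = length (filterᵇ (λ b → b) w)

module Codes {n : ℕ} (plow : Vec Bool n) where
  open Field plow

  codeword : (F → F) → List Bool
  codeword f = map (λ α → toBit (f α)) (elems n)

  Q₁ : Vec Bool ⌊ (n ∸ 1) /2⌋ → F → F
  Q₁ a x = Trₙ (goldSum a x)

  Q₂ : Vec Bool (⌊ n /2⌋ ∸ 1) → Bool → F → F
  Q₂ a a' x = Trₙ (goldSum a x) +F (if a' then Trₙ/₂ (gold ⌊ n /2⌋ x) else 0F)

  withAffine : (F → F) → F → Bool → F → F
  withAffine Q b c x = (Q x +F Trₙ (b *F x)) +F embed c

  decEqWord : (u v : List Bool) → Relation.Nullary.Dec (u ≡ v)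
  decEqWord = LP.≡-dec B._≟_

  R₁ : List (List Bool)
  R₁ = deduplicate decEqWord
         (concatMap (λ a → concatMap (λ b → map (λ c → codeword (withAffine (Q₁ a) b c)) allBools)
                           (allVecs n)) (allVecs ⌊ (n ∸ 1) /2⌋))

  R₂ : List (List Bool)
  R₂ = deduplicate decEqWord
         (concatMap (λ a → concatMap (λ a' → concatMap (λ b → map (λ c → codeword (withAffine (Q₂ a a') b c)) allBools)
                           (allVecs n)) allBools) (allVecs (⌊ n /2⌋ ∸ 1)))

  -- weight equals 2^{n-1} + 2^{n-1-k/2} (as a real number), i.e.
  -- w > 2^{n-1} and (w - 2^{n-1})² · 2^k = 2^{2(n-1)}
  hasWeightₖ : ℕ → List Bool → Bool
  hasWeightₖ k w = (2 ^ (n ∸ 1) <ᵇ weight w) ∧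
                   (((weight w ∸ 2 ^ (n ∸ 1)) ^ 2) * 2 ^ k ≡ᵇ 2 ^ (2 * (n ∸ 1)))

  Aₖ : List (List Bool) → ℕ → ℕ
  Aₖ R k = length (filterᵇ (hasWeightₖ k) R)

  A : List (List Bool) → ℕ
  A R = length (filterᵇ (λ w → weight w ≡ᵇ 2 ^ (n ∸ 1)) R)

-- Polynomials with ℕ coefficients (in z), lowest degree first

NPoly : Set
NPoly = List ℕ

_+ᴺ_ : NPoly → NPoly → NPoly
[] +ᴺ g = g
(c ∷ f) +ᴺ [] = c ∷ f
(c ∷ f) +ᴺ (d ∷ g) = (c + d) ∷ (f +ᴺ g)

_*ᴺ_ : NPoly → NPoly → NPoly
[] *ᴺ g = []
(c ∷ f) *ᴺ g = map (c *_) g +ᴺ (0 ∷ (f *ᴺ g))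

mono : ℕ → ℕ → NPoly
mono c e = replicate e 0 ++ (c ∷ [])

oneᴺ : NPoly
oneᴺ = 1 ∷ []

sumᴺ : List NPoly → NPoly
sumᴺ = foldr _+ᴺ_ []

prodᴺ : List NPoly → NPoly
prodᴺ = foldr _*ᴺ_ oneᴺ

coeff : ℕ → NPoly → ℕ
coeff k [] = 0
coeff zero (c ∷ _) = c
coeff (suc k) (_ ∷ f) = coeff k f

range1 : ℕ → List ℕ
range1 N = map suc (upTo N)

prodℕ : List ℕ → ℕ
prodℕ = foldr _*_ 1

open import Data.Integer using (ℤ; +_; _-_)
open import Data.Nat using (_/_)

P₀ : ℕ → NPoly
P₀ t = sumᴺ (oneᴺ ∷ map (λ j → mono (2 ^ (3 * j ∸ 1)) (2 * j)) (range1 (2 ^ (t ∸ 1))))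

Wᵢ : ℕ → Poly → NPoly
Wᵢ t r = sumᴺ (oneᴺ ∷ map (λ j → mono (2 ^ ⌊ 3 * j * deg r /2⌋ ∸ 2 ^ ⌊ (3 * j ∸ 1) * deg r /2⌋) (j * deg r))
                          (range1 (2 ^ t)))

W₂ : ℕ → List Poly → NPoly
W₂ t rs = P₀ t *ᴺ prodᴺ (map (Wᵢ t) rs)

A₂formula : ℕ → ℕ → List Poly → ℤ
A₂formula n t rs =
  + (2 ^ (n + 1 + 2 ^ (t ∸ 1)) *
     prodℕ (map (λ r → 1 + sum (map (λ j → 2 ^ ⌊ j * deg r /2⌋ ∸ 2 ^ ⌊ (j ∸ 1) * deg r /2⌋) (range1 (2 ^ t)))) rs))
  - + (((2 ^ (3 * (2 ^ (t ∸ 1) + 1)) + 6) / 7) *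
     prodℕ (map (λ r → 1 + sum (map (λ j → 2 ^ ⌊ 3 * j * deg r /2⌋ ∸ 2 ^ ⌊ (3 * j ∸ 1) * deg r /2⌋) (range1 (2 ^ t)))) rs))

W₁ : List Poly → NPoly
W₁ rs = prodᴺ (map (λ r → oneᴺ +ᴺ mono (2 ^ ⌊ 3 * deg r /2⌋ ∸ 2 ^ deg r) (deg r)) rs)

A₁formula : ℕ → List Poly → ℤ
A₁formula n rs = + (2 ^ ((3 * n + 1) / 2)) - + (2 * prodℕ (map (λ r → 1 + 2 ^ ⌊ 3 * deg r /2⌋ ∸ 2 ^ deg r) rs))

{-# OPTIONS --safe #-}

-- Write w = x + 1/x. Every coefficient vector of 𝒞₁ or 𝒞₂ corresponds to a unique s ∈ 𝔽₂[w] of degree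
-- below N (N = (n-1)/2 or n/2) such that the radical of the polarisation of Q is the kernel of s(ω),
-- resp. of ω s(ω), where ω = φ + φ⁻¹ and φ is the Frobenius map. The palindromic polynomial rᵢ is
-- x^{deg Rᵢ} Rᵢ(w) with Rᵢ irreducible in 𝔽₂[w], and (x+1)² = x w; hence x^n + 1, which annihilates φ,
-- becomes D(ω) = 0 with D = w^{2^{t-1}} ∏ Rᵢ^{2^t} (even n), resp. (φ+1) D(ω) = 0 with D = ∏ Rᵢ (odd n).
-- A skew polynomial of degree d in φ has at most 2^d roots; applied to gcd(s, D) and to its cofactor
-- in D, these bounds multiply to 2^n, so both are sharp and Q has rank 2(N - deg gcd(s, D)).
--
-- Counting the s with given gcd: splitting residues modulo P^e D' (P prime, P ∤ D') by divisibility by P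
-- gives the factor 1 + Σⱼ (|P|^j - |P|^{j-1}) y^{j deg P}. Finally, for Q of rank k the square of the
-- Walsh coefficient of Q + Tr(bx) is 0 or 2^{2n-k}, and Parseval's identity leaves 2^k values of b
-- for which it is nonzero; each of them contributes one codeword of either extreme weight.
module Submission where

open import Relation.Binary.PropositionalEquality hiding ([_])
open import Defs
open import Algebra.Structures using (IsCommutativeMonoid)
open import Data.Bool using (Bool; true; false; if_then_else_; _xor_; not; _∧_; _∨_)
open import Data.Bool.Properties using (xor-identityʳ)
open import Data.Nat using (ℕ; zero; suc; _+_; _*_; _^_; _≤_; _<_; z≤n; s≤s; _∸_; ⌊_/2⌋; _/_; _<ᵇ_; _≡ᵇ_; ≢-nonZero)
open import Data.Vec using (Vec; []; _∷_; zipWith; toList; fromList)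
open import Data.Product using (∃; _×_; _,_; proj₁; proj₂; ∃₂)
open import Data.Sum using (_⊎_; inj₁; inj₂)
open import Data.Empty using (⊥-elim)
open import Relation.Nullary using (¬_; Dec; yes; no; does)
open import Function using (_∘_)
open import Algebra.Bundles using (CommutativeSemiring; RawRing)
open import Algebra.Structures.Biased using (isCommutativeSemiringˡ)
open import Algebra.Solver.Ring.AlmostCommutativeRing using (AlmostCommutativeRing; _-Raw-AlmostCommutative⟶_; Induced-equivalence)
open import Relation.Binary.Definitions using (WeaklyDecidable; tri<; tri≈; tri>)
open import Relation.Binary.Bundles using (Setoid)
open import Relation.Binary.Structures using (IsEquivalence)
open import Data.Maybe using (just; nothing)
open import Data.List using (List; []; _∷_; length; map; _++_; replicate; upTo; foldr; reverse; initLast; _∷ʳ_; _∷ʳ′_; zip; applyUpTo; concatMap; filterᵇ; deduplicate)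
open import Data.Nat.ListAction using (sum)
open import Data.Nat.Divisibility using (_∣_; divides)
open import Data.List.Relation.Unary.All using (All; []; _∷_)
open import Data.List.Relation.Binary.Pointwise using (Pointwise; []; _∷_)
open import Data.Bool.Solver using (module xor-∧-Solver)
open import Data.List.Relation.Unary.Any using (here; there)
open import Data.List.Relation.Unary.AllPairs using ([]; _∷_)
open import Data.List.Relation.Unary.Unique.Propositional using (Unique)
open import Data.List.Membership.Propositional using (_∈_; find; lose)
import Data.Bool.Properties as 𝔹ₚ
import Data.Nat.Properties as ℕₚ
import Data.Vec as V
import Data.Vec.Properties as Vₚ
import Algebra.Solver.Ring
import Relation.Binary.Reasoning.Setoid
import Data.List.Properties as Lₚ
import Data.Nat.Solver
import Data.Nat.ListAction.Properties as Sumₚ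
import Data.Nat.DivMod as DM
import Data.Integer as ℤ
import Data.Integer.Properties as ℤₚ
import Data.List.Relation.Unary.All.Properties as Allₚ
import Data.List.Relation.Unary.Any as Any
import Data.List.Relation.Unary.Unique.Propositional.Properties as Uniqueₚ
import Data.List.Membership.Propositional.Properties as ∈ₚ
open ℤ using (ℤ)

-- A prime self-reciprocal polynomial may be reducible, as g g*; in the variable w both kinds become
-- ordinary irreducible polynomials, so Euclid's algorithm in 𝔽₂[w] governs everything. The
-- exponents 3j deg(rᵢ)/2 have two sources. Put p = deg Rᵢ = deg(rᵢ)/2. Among the residues modulo a
-- power of Rᵢ, those of codegree jp number 2^{jp} - 2^{(j-1)p}, and each belongs to a form of rank
-- 2jp, which yields 2^{2jp} codewords of either extreme weight. The parity of n matters because of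
-- the middle coefficient. For even n the coefficient a_{n/2} contributes φ^{n/2} alone; once the
-- factor φ^{n/2} is removed, the polar map is a polynomial in ω with constant term a_{n/2}.
-- Subspaces are measured by cardinality: rank k means |ker| · 2^k = 2^n, and the inequality |ker (h
-- ∘ g)| ≤ |ker h| · |ker g| yields both the root bounds and their sharpness.

infixl 6 _⊕_
_⊕_ : ∀ {n} → Vec Bool n → Vec Bool n → Vec Bool n
_⊕_ = zipWith _xor_

𝟎 : ∀ {n} → Vec Bool n
𝟎 {n} = V.replicate n false

_≟ᵛ_ : ∀ {n} (u v : Vec Bool n) → Dec (u ≡ v)
_≟ᵛ_ = Vₚ.≡-dec 𝔹ₚ._≟_

xor-self : ∀ b → b xor b ≡ false
xor-self false = refl
xor-self true = refl

⊕-assoc : ∀ {n} (u v w : Vec Bool n) → (u ⊕ v) ⊕ w ≡ u ⊕ (v ⊕ w)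
⊕-assoc = Vₚ.zipWith-assoc 𝔹ₚ.xor-assoc

⊕-comm : ∀ {n} (u v : Vec Bool n) → u ⊕ v ≡ v ⊕ u
⊕-comm = Vₚ.zipWith-comm 𝔹ₚ.xor-comm

⊕-identityˡ : ∀ {n} (u : Vec Bool n) → 𝟎 ⊕ u ≡ u
⊕-identityˡ = Vₚ.zipWith-identityˡ 𝔹ₚ.xor-identityˡ

⊕-identityʳ : ∀ {n} (u : Vec Bool n) → u ⊕ 𝟎 ≡ u
⊕-identityʳ = Vₚ.zipWith-identityʳ xor-identityʳ

⊕-self : ∀ {n} (u : Vec Bool n) → u ⊕ u ≡ 𝟎
⊕-self [] = refl
⊕-self (c ∷ u) = cong₂ _∷_ (xor-self c) (⊕-self u)

⊕-cancel : ∀ {n} (u v : Vec Bool n) → (u ⊕ v) ⊕ v ≡ u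
⊕-cancel u v = trans (⊕-assoc u v v) (trans (cong (u ⊕_) (⊕-self v)) (⊕-identityʳ u))

⊕≡𝟎⇒≡ : ∀ {n} {u v : Vec Bool n} → u ⊕ v ≡ 𝟎 → u ≡ v
⊕≡𝟎⇒≡ {u = u} {v} e = trans (sym (⊕-cancel u v)) (trans (cong (_⊕ v) e) (⊕-identityˡ v))

⊕-interchange : ∀ {n} (a b c d : Vec Bool n) → (a ⊕ b) ⊕ (c ⊕ d) ≡ (a ⊕ c) ⊕ (b ⊕ d)
⊕-interchange a b c d = trans (⊕-assoc a b (c ⊕ d)) (trans (cong (a ⊕_)
  (trans (sym (⊕-assoc b c d)) (trans (cong (_⊕ d) (⊕-comm b c)) (⊕-assoc c b d)))) (sym (⊕-assoc a c (b ⊕ d))))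

-- (pushLast c v) is (w , t) with c ∷ v = w ∷ʳ t.
pushLast : ∀ {k} → Bool → Vec Bool k → Vec Bool k × Bool
pushLast c [] = [] , c
pushLast c (d ∷ v) = c ∷ proj₁ (pushLast d v) , proj₂ (pushLast d v)

-- Sums over the Boolean cube

module Sum {A : Set} {_∙_ : A → A → A} {ε : A} (M : IsCommutativeMonoid _≡_ _∙_ ε) where
  open IsCommutativeMonoid M using (assoc; comm; identityˡ; identityʳ)

  -- The monoid is left open to serve counts in ℕ, character sums in ℤ, and products in the field
  -- for Fermat's theorem.
  ∑ : ∀ {n} → (Vec Bool n → A) → A
  ∑ {zero} f = f []
  ∑ {suc n} f = ∑ (λ v → f (false ∷ v) ∙ f (true ∷ v))

  interchange : ∀ a b c d → (a ∙ b) ∙ (c ∙ d) ≡ (a ∙ c) ∙ (b ∙ d)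
  interchange a b c d = trans (assoc a b (c ∙ d)) (trans (cong (a ∙_)
    (trans (sym (assoc b c d)) (trans (cong (_∙ d) (comm b c)) (assoc c b d)))) (sym (assoc a c (b ∙ d))))

  ∑-cong : ∀ {n} {f g : Vec Bool n → A} → (∀ v → f v ≡ g v) → ∑ f ≡ ∑ g
  ∑-cong {zero} e = e []
  ∑-cong {suc n} e = ∑-cong (λ v → cong₂ _∙_ (e (false ∷ v)) (e (true ∷ v)))

  ∑-∙ : ∀ {n} (f g : Vec Bool n → A) → ∑ (λ v → f v ∙ g v) ≡ ∑ f ∙ ∑ g
  ∑-∙ {zero} f g = refl
  ∑-∙ {suc n} f g = trans (∑-cong {n} (λ v → interchange _ _ _ _)) (∑-∙ {n} _ _)

  ∑-ε : ∀ {n} → ∑ {n} (λ _ → ε) ≡ ε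
  ∑-ε {zero} = refl
  ∑-ε {suc n} = trans (∑-cong {n} (λ v → identityˡ ε)) (∑-ε {n})

  ∑-swap : ∀ {n m} (f : Vec Bool n → Vec Bool m → A) →
    ∑ (λ u → ∑ (λ v → f u v)) ≡ ∑ (λ v → ∑ (λ u → f u v))
  ∑-swap {zero} f = refl
  ∑-swap {suc n} f = trans (∑-cong {n} (λ u → sym (∑-∙ (f (false ∷ u)) (f (true ∷ u))))) (∑-swap {n} (λ u v → f (false ∷ u) v ∙ f (true ∷ u) v))

  ∑-single : ∀ {n} (f : Vec Bool n → A) y → (∀ x → x ≢ y → f x ≡ ε) → ∑ f ≡ f y
  ∑-single {zero} f [] e = refl
  ∑-single {suc n} f (false ∷ y) e = trans
    (∑-single _ y (λ x ne → trans (cong₂ _∙_ (e (false ∷ x) (ne ∘ Vₚ.∷-injectiveʳ)) (e (true ∷ x) (λ ()))) (identityˡ ε)))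
    (trans (cong (f (false ∷ y) ∙_) (e (true ∷ y) (λ ()))) (identityʳ _))
  ∑-single {suc n} f (true ∷ y) e = trans
    (∑-single _ y (λ x ne → trans (cong₂ _∙_ (e (false ∷ x) (λ ())) (e (true ∷ x) (ne ∘ Vₚ.∷-injectiveʳ))) (identityˡ ε)))
    (trans (cong (_∙ f (true ∷ y)) (e (false ∷ y) (λ ()))) (identityˡ _))

  ∑-translate : ∀ {n} (f : Vec Bool n → A) u → ∑ (λ x → f (x ⊕ u)) ≡ ∑ f
  ∑-translate f [] = refl
  ∑-translate f (false ∷ u) = ∑-translate (λ v → f (false ∷ v) ∙ f (true ∷ v)) u
  ∑-translate {suc n} f (true ∷ u) = trans (∑-cong {n} (λ x → comm _ _)) (∑-translate (λ v → f (false ∷ v) ∙ f (true ∷ v)) u)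

  -- Both sides run over all vectors of length n + 1, split off once at the first and once at the
  -- last coordinate. Division by a monic polynomial needs this change: a coefficient enters at the
  -- bottom and an overflow bit leaves at the top.
  ∑-pushLast : ∀ {n} (f : Vec Bool n × Bool → A) →
    ∑ (λ v → f (pushLast false v) ∙ f (pushLast true v)) ≡ ∑ (λ w → f (w , false) ∙ f (w , true))
  ∑-pushLast {zero} f = refl
  ∑-pushLast {suc n} f = trans (∑-pushLast {n} (λ p → f (false ∷ proj₁ p , proj₂ p) ∙ f (true ∷ proj₁ p , proj₂ p)))
    (∑-cong {n} (λ w → interchange _ _ _ _))

  -- Double counting over the graph of `σ`: the row of x sums to `f (σ x)`, the column of y to
  -- `f y`.
  ∑-reindex : ∀ {n m} (σ : Vec Bool n → Vec Bool m) (τ : Vec Bool m → Vec Bool n) →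
    (∀ x → τ (σ x) ≡ x) → (∀ y → σ (τ y) ≡ y) → (f : Vec Bool m → A) → ∑ (λ x → f (σ x)) ≡ ∑ f
  ∑-reindex σ τ τσ στ f = begin
      ∑ (λ x → f (σ x))
        ≡⟨ ∑-cong (λ x → sym (row x)) ⟩
      ∑ (λ x → ∑ (λ y → g x y))
        ≡⟨ ∑-swap g ⟩
      ∑ (λ y → ∑ (λ x → g x y))
        ≡⟨ ∑-cong col ⟩
      ∑ f ∎
    where
    open ≡-Reasoning
    g : _ → _ → A
    g x y = if does (σ x ≟ᵛ y) then f y else ε
    diag : ∀ {x y} → σ x ≡ y → g x y ≡ f y
    diag {x} {y} e with σ x ≟ᵛ y
    ... | yes _ = refl
    ... | no ne = ⊥-elim (ne e)
    off : ∀ {x y} → σ x ≢ y → g x y ≡ ε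
    off {x} {y} e with σ x ≟ᵛ y
    ... | yes p = ⊥-elim (e p)
    ... | no ne = refl
    row : ∀ x → ∑ (λ y → g x y) ≡ f (σ x)
    row x = trans (∑-single _ (σ x) (λ y ne → off (ne ∘ sym))) (diag refl)
    col : ∀ y → ∑ (λ x → g x y) ≡ f y
    col y = trans (∑-single _ (τ y) (λ x ne → off (λ e → ne (trans (sym (τσ x)) (cong τ e))))) (diag (στ y))

∑-hom : ∀ {A B : Set} {_∙_ ε _∘_ η} (M : IsCommutativeMonoid {A = A} _≡_ _∙_ ε) (N : IsCommutativeMonoid {A = B} _≡_ _∘_ η)
  (h : A → B) → (∀ a b → h (a ∙ b) ≡ h a ∘ h b) → ∀ {n} (f : Vec Bool n → A) → h (Sum.∑ M f) ≡ Sum.∑ N (λ v → h (f v))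
∑-hom M N h e {zero} f = refl
∑-hom M N h e {suc n} f = trans (∑-hom M N h e {n} _) (Sum.∑-cong N {n} (λ v → e _ _))

open Sum ℕₚ.+-0-isCommutativeMonoid public

∑-*ˡ : ∀ {n} c (f : Vec Bool n → ℕ) → ∑ (λ v → c * f v) ≡ c * ∑ f
∑-*ˡ c f = sym (∑-hom ℕₚ.+-0-isCommutativeMonoid ℕₚ.+-0-isCommutativeMonoid (c *_) (ℕₚ.*-distribˡ-+ c) f)

∑-const : ∀ n c → ∑ {n} (λ _ → c) ≡ 2 ^ n * c
∑-const zero c = sym (ℕₚ.+-identityʳ c)
∑-const (suc n) c = trans (∑-const n (c + c)) (trans (cong (λ z → 2 ^ n * (c + z)) (sym (ℕₚ.+-identityʳ c)))
  (trans (sym (ℕₚ.*-assoc (2 ^ n) 2 c)) (cong (_* c) (ℕₚ.*-comm (2 ^ n) 2))))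

∑-mono : ∀ {n} {f g : Vec Bool n → ℕ} → (∀ v → f v ≤ g v) → ∑ f ≤ ∑ g
∑-mono {zero} e = e []
∑-mono {suc n} e = ∑-mono (λ v → ℕₚ.+-mono-≤ (e (false ∷ v)) (e (true ∷ v)))

+-squeeze : ∀ {a b c d} → a ≤ c → b ≤ d → c + d ≤ a + b → c ≤ a × d ≤ b
+-squeeze {a} {b} {c} {d} p q r =
  ℕₚ.+-cancelʳ-≤ d c a (ℕₚ.≤-trans r (ℕₚ.+-monoʳ-≤ a q)) , ℕₚ.+-cancelˡ-≤ c d b (ℕₚ.≤-trans r (ℕₚ.+-monoˡ-≤ b p))

-- A pointwise bound that is attained in total is attained everywhere; this is the form of the
-- pigeonhole principle used for `injective⇒surjective`.
∑-squeeze : ∀ {n} {f g : Vec Bool n → ℕ} → (∀ v → f v ≤ g v) → ∑ g ≤ ∑ f → ∀ v → g v ≤ f v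
∑-squeeze {zero} e r [] = r
∑-squeeze {suc n} e r (c ∷ v) with +-squeeze (e (false ∷ v)) (e (true ∷ v)) (∑-squeeze (λ v → ℕₚ.+-mono-≤ (e (false ∷ v)) (e (true ∷ v))) r v)
∑-squeeze {suc n} e r (false ∷ v) | p , q = p
∑-squeeze {suc n} e r (true ∷ v) | p , q = q

search : ∀ {n} (P : Vec Bool n → Set) → (∀ v → Dec (P v)) → ∃ P ⊎ (∀ v → ¬ P v)
search {zero} P d with d []
... | yes p = inj₁ ([] , p)
... | no ¬p = inj₂ (λ { [] → ¬p })
search {suc n} P d with search (λ v → P (false ∷ v)) (λ v → d (false ∷ v)) | search (λ v → P (true ∷ v)) (λ v → d (true ∷ v))
... | inj₁ (v , p) | _ = inj₁ (false ∷ v , p)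
... | inj₂ _ | inj₁ (v , p) = inj₁ (true ∷ v , p)
... | inj₂ a | inj₂ b = inj₂ (λ { (false ∷ v) → a v ; (true ∷ v) → b v })

[_] : Bool → ℕ
[ b ] = if b then 1 else 0

if-yes : ∀ {P A : Set} (d : Dec P) {a b : A} → P → (if does d then a else b) ≡ a
if-yes (yes _) p = refl
if-yes (no ¬p) p = ⊥-elim (¬p p)

[]-yes : ∀ {P : Set} (d : Dec P) → P → [ does d ] ≡ 1
[]-yes (yes _) p = refl
[]-yes (no ¬p) p = ⊥-elim (¬p p)

[]-no : ∀ {P : Set} (d : Dec P) → ¬ P → [ does d ] ≡ 0
[]-no (yes p) ¬p = ⊥-elim (¬p p)
[]-no (no _) ¬p = refl

[]-mono : ∀ {P Q : Set} (d : Dec P) (e : Dec Q) → (P → Q) → [ does d ] ≤ [ does e ]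
[]-mono (yes p) e h = ℕₚ.≤-reflexive (sym ([]-yes e (h p)))
[]-mono (no _) e h = z≤n

[]-cong : ∀ {P Q : Set} (d : Dec P) (e : Dec Q) → (P → Q) → (Q → P) → [ does d ] ≡ [ does e ]
[]-cong d e h k = ℕₚ.≤-antisym ([]-mono d e h) ([]-mono e d k)

∑-δ : ∀ {n} (y : Vec Bool n) → ∑ (λ x → [ does (x ≟ᵛ y) ]) ≡ 1
∑-δ y = trans (∑-single _ y (λ x ne → []-no (x ≟ᵛ y) ne)) ([]-yes (y ≟ᵛ y) refl)

-- Fibres of an injective map have at most one element and their sizes add up to 2^n, so none of
-- them can be empty.
injective⇒surjective : ∀ {n} (σ : Vec Bool n → Vec Bool n) → (∀ {x y} → σ x ≡ σ y → x ≡ y) → ∀ y → ∃ λ x → σ x ≡ y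
injective⇒surjective {n} σ inj y with search (λ x → σ x ≡ y) (λ x → σ x ≟ᵛ y)
... | inj₁ r = r
... | inj₂ none = ⊥-elim (absurd (ℕₚ.≤-trans (∑-squeeze fib≤1 total y) (ℕₚ.≤-reflexive fib0)))
  where
  fib : Vec Bool n → ℕ
  fib y = ∑ (λ x → [ does (σ x ≟ᵛ y) ])
  fib≤1 : ∀ y → fib y ≤ 1
  fib≤1 y with search (λ x → σ x ≡ y) (λ x → σ x ≟ᵛ y)
  ... | inj₁ (x₀ , e) = ℕₚ.≤-trans (∑-mono (λ x → []-mono (σ x ≟ᵛ y) (x ≟ᵛ x₀) (λ e' → inj (trans e' (sym e))))) (ℕₚ.≤-reflexive (∑-δ x₀))
  ... | inj₂ none = ℕₚ.≤-trans (ℕₚ.≤-reflexive (trans (∑-cong (λ x → []-no (σ x ≟ᵛ y) (none x))) (∑-ε {n}))) z≤n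
  total : ∑ {n} (λ _ → 1) ≤ ∑ fib
  total = ℕₚ.≤-reflexive (trans (∑-cong (λ x → sym (trans (∑-cong (λ y → []-cong (σ x ≟ᵛ y) (y ≟ᵛ σ x) sym sym)) (∑-δ (σ x)))))
    (∑-swap (λ x y → [ does (σ x ≟ᵛ y) ])))
  fib0 : fib y ≡ 0
  fib0 = trans (∑-cong (λ x → []-no (σ x ≟ᵛ y) (none x))) (∑-ε {n})
  absurd : ¬ (1 ≤ 0)
  absurd ()

-- Kernels of additive maps, measured by cardinality

Additive : ∀ {n m} → (Vec Bool n → Vec Bool m) → Set
Additive f = ∀ x y → f (x ⊕ y) ≡ f x ⊕ f y

additive-𝟎 : ∀ {n m} {f : Vec Bool n → Vec Bool m} → Additive f → f 𝟎 ≡ 𝟎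
additive-𝟎 {f = f} a = trans (cong f (sym (⊕-self 𝟎))) (trans (a 𝟎 𝟎) (⊕-self (f 𝟎)))

∣ker_∣ : ∀ {n m} → (Vec Bool n → Vec Bool m) → ℕ
∣ker f ∣ = ∑ (λ x → [ does (f x ≟ᵛ 𝟎) ])

∣ker∣-mono : ∀ {n m k} (f : Vec Bool n → Vec Bool m) (g : Vec Bool n → Vec Bool k) → (∀ x → f x ≡ 𝟎 → g x ≡ 𝟎) → ∣ker f ∣ ≤ ∣ker g ∣
∣ker∣-mono f g h = ∑-mono (λ x → []-mono (f x ≟ᵛ 𝟎) (g x ≟ᵛ 𝟎) (h x))

∣ker∣-cong : ∀ {n m k} (f : Vec Bool n → Vec Bool m) (g : Vec Bool n → Vec Bool k) →
  (∀ x → f x ≡ 𝟎 → g x ≡ 𝟎) → (∀ x → g x ≡ 𝟎 → f x ≡ 𝟎) → ∣ker f ∣ ≡ ∣ker g ∣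
∣ker∣-cong f g h k = ℕₚ.≤-antisym (∣ker∣-mono f g h) (∣ker∣-mono g f k)

-- Translation by a point `x₀` of the fibre carries the fibre into the kernel.
∣fibre∣≤∣ker∣ : ∀ {n m} (g : Vec Bool n → Vec Bool m) → Additive g → ∀ y → ∑ (λ x → [ does (g x ≟ᵛ y) ]) ≤ ∣ker g ∣
∣fibre∣≤∣ker∣ {n} g add y with search (λ x → g x ≡ y) (λ x → g x ≟ᵛ y)
... | inj₂ none = ℕₚ.≤-trans (ℕₚ.≤-reflexive (trans (∑-cong (λ x → []-no (g x ≟ᵛ y) (none x))) (∑-ε {n}))) z≤n
... | inj₁ (x₀ , e) = ℕₚ.≤-trans (ℕₚ.≤-reflexive (sym (∑-translate _ x₀)))
  (∑-mono (λ x → []-mono (g (x ⊕ x₀) ≟ᵛ y) (g x ≟ᵛ 𝟎) (λ p →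
    trans (sym (⊕-cancel (g x) y)) (trans (cong (_⊕ y) (trans (cong (g x ⊕_) (sym e)) (trans (sym (add x x₀)) p))) (⊕-self y)))))

-- The kernel of the composite is split by the value of `g`: only values in the kernel of `h` occur,
-- each on a fibre no larger than the kernel of `g`.
∣ker-∘∣ : ∀ {n m k} (h : Vec Bool m → Vec Bool k) (g : Vec Bool n → Vec Bool m) → Additive g → ∣ker (λ x → h (g x)) ∣ ≤ ∣ker h ∣ * ∣ker g ∣
∣ker-∘∣ h g add = begin
    ∑ (λ x → k (g x))
      ≡⟨ ∑-cong (λ x → sym (row x)) ⟩
    ∑ (λ x → ∑ (λ y → k y * [ does (g x ≟ᵛ y) ]))
      ≡⟨ ∑-swap (λ x y → k y * [ does (g x ≟ᵛ y) ]) ⟩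
    ∑ (λ y → ∑ (λ x → k y * [ does (g x ≟ᵛ y) ]))
      ≡⟨ ∑-cong (λ y → ∑-*ˡ (k y) (λ x → [ does (g x ≟ᵛ y) ])) ⟩
    ∑ (λ y → k y * ∑ (λ x → [ does (g x ≟ᵛ y) ]))
      ≤⟨ ∑-mono (λ y → ℕₚ.*-monoʳ-≤ (k y) (∣fibre∣≤∣ker∣ g add y)) ⟩
    ∑ (λ y → k y * ∣ker g ∣)
      ≡⟨ ∑-cong (λ y → ℕₚ.*-comm (k y) _) ⟩
    ∑ (λ y → ∣ker g ∣ * k y)
      ≡⟨ ∑-*ˡ ∣ker g ∣ k ⟩
    ∣ker g ∣ * ∣ker h ∣
      ≡⟨ ℕₚ.*-comm ∣ker g ∣ ∣ker h ∣ ⟩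
    ∣ker h ∣ * ∣ker g ∣ ∎
  where
  open ℕₚ.≤-Reasoning
  k : _ → ℕ
  k y = [ does (h y ≟ᵛ 𝟎) ]
  row : ∀ x → ∑ (λ y → k y * [ does (g x ≟ᵛ y) ]) ≡ k (g x)
  row x = trans (∑-single _ (g x) (λ y ne → trans (cong (k y *_) ([]-no (g x ≟ᵛ y) (λ e → ne (sym e)))) (ℕₚ.*-zeroʳ (k y))))
    (trans (cong (k (g x) *_) ([]-yes (g x ≟ᵛ g x) refl)) (ℕₚ.*-identityʳ _))

-- Ring solving in characteristic 2

-- Bool is a coefficient ring for every commutative semiring of characteristic 2.
module Char2Solver {a ℓ} (R : CommutativeSemiring a ℓ)
  (x+x≈0 : ∀ x → CommutativeSemiring._≈_ R (CommutativeSemiring._+_ R x x) (CommutativeSemiring.0# R)) where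
  private module R = CommutativeSemiring R

  almostCommutativeRing : AlmostCommutativeRing a ℓ
  almostCommutativeRing = record
    { -_ = λ x → x
    ; isAlmostCommutativeRing = record
      { isCommutativeSemiring = R.isCommutativeSemiring
      ; -‿cong = λ e → e
      ; -‿*-distribˡ = λ x y → R.refl
      ; -‿+-comm = λ x y → R.refl
      }
    }

  𝔽₂ : RawRing _ _
  𝔽₂ = record { Carrier = Bool ; _≈_ = _≡_ ; _+_ = _xor_ ; _*_ = _∧_ ; -_ = λ b → b ; 0# = false ; 1# = true }

  ⟦_⟧₂ : Bool → R.Carrier
  ⟦ b ⟧₂ = if b then R.1# else R.0#

  morphism : 𝔽₂ -Raw-AlmostCommutative⟶ almostCommutativeRing
  morphism = record
    { ⟦_⟧ = ⟦_⟧₂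
    ; +-homo = λ { false y → R.sym (R.+-identityˡ _)
                 ; true false → R.sym (R.+-identityʳ _)
                 ; true true → R.sym (x+x≈0 R.1#) }
    ; *-homo = λ { false y → R.sym (R.zeroˡ _) ; true y → R.sym (R.*-identityˡ _) }
    ; -‿homo = λ _ → R.refl
    ; 0-homo = R.refl
    ; 1-homo = R.refl
    }

  dec : WeaklyDecidable (Induced-equivalence morphism)
  dec false false = just R.refl
  dec true true = just R.refl
  dec _ _ = nothing

  open Algebra.Solver.Ring 𝔽₂ almostCommutativeRing morphism dec public
    using (solve; _:=_; _:+_; _:*_)

-- Kept over an abstract ring: in the concrete field the solver would unfold the multiplication.
module Char2Identities {a ℓ} (R : CommutativeSemiring a ℓ)
  (x+x≈0 : ∀ x → CommutativeSemiring._≈_ R (CommutativeSemiring._+_ R x x) (CommutativeSemiring.0# R)) where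
  private module R = CommutativeSemiring R
  private module RS = Char2Solver R x+x≈0
  open RS using (_:=_; _:+_; _:*_)

  square-+ : ∀ x y → (x R.+ y) R.* (x R.+ y) R.≈ x R.* x R.+ y R.* y
  square-+ = RS.solve 2 (λ x y → (x :+ y) :* (x :+ y) := x :* x :+ y :* y) R.refl

  square-* : ∀ x y → (x R.* y) R.* (x R.* y) R.≈ (x R.* x) R.* (y R.* y)
  square-* = RS.solve 2 (λ x y → (x :* y) :* (x :* y) := (x :* x) :* (y :* y)) R.refl

  square+scale-+ : ∀ v x y → (x R.+ y) R.* (x R.+ y) R.+ v R.* (x R.+ y) R.≈ (x R.* x R.+ v R.* x) R.+ (y R.* y R.+ v R.* y)
  square+scale-+ = RS.solve 3 (λ v x y → (x :+ y) :* (x :+ y) :+ v :* (x :+ y) := (x :* x :+ v :* x) :+ (y :* y :+ v :* y)) R.refl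

  skew-step : ∀ c x s r v y → c R.* x R.+ (s R.+ r R.* y) R.≈ (r R.* (y R.+ v R.* x) R.+ s) R.+ (c R.+ r R.* v) R.* x
  skew-step = RS.solve 6 (λ c x s r v y → c :* x :+ (s :+ r :* y) := (r :* (y :+ v :* x) :+ s) :+ (c :+ r :* v) :* x) R.refl

  +-regroup : ∀ a b y → ((a R.+ b) R.+ y) R.+ y R.≈ (y R.+ a) R.+ (b R.+ y)
  +-regroup = RS.solve 3 (λ a b y → ((a :+ b) :+ y) :+ y := (y :+ a) :+ (b :+ y)) R.refl

-- Polynomials over 𝔽₂ up to trailing zeros

coef : Poly → ℕ → Bool
coef [] i = false
coef (c ∷ f) zero = c
coef (c ∷ f) (suc i) = coef f i

infix 4 _≈_
-- Equality of coefficient sequences, which ignores trailing zeros; `≈⇒≈ₚ` and `≈ₚ⇒≈` connect it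
-- with equality of normal forms. It is a record so that unification can recover `f` and `g` from a
-- proof.
record _≈_ (f g : Poly) : Set where
  constructor mk
  field at : ∀ i → coef f i ≡ coef g i
open _≈_ public

≈-refl : ∀ {f} → f ≈ f
≈-refl = mk λ i → refl

≈-sym : ∀ {f g} → f ≈ g → g ≈ f
≈-sym e = mk λ i → sym (at e i)

≈-trans : ∀ {f g h} → f ≈ g → g ≈ h → f ≈ h
≈-trans e e' = mk λ i → trans (at e i) (at e' i)

≈-reflexive : ∀ {f g} → f ≡ g → f ≈ g
≈-reflexive refl = ≈-refl

≈-isEquivalence : IsEquivalence _≈_
≈-isEquivalence = record { refl = ≈-refl ; sym = ≈-sym ; trans = ≈-trans }

∷-cong : ∀ {c d f g} → c ≡ d → f ≈ g → (c ∷ f) ≈ (d ∷ g)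
∷-cong e e' = mk λ { zero → e ; (suc i) → at e' i }

∷-injʳ : ∀ {c d f g} → (c ∷ f) ≈ (d ∷ g) → f ≈ g
∷-injʳ e = mk λ i → at e (suc i)

∷-≈[] : ∀ {c f} → c ≡ false → f ≈ [] → (c ∷ f) ≈ []
∷-≈[] e e' = mk λ { zero → e ; (suc i) → at e' i }

tail-≈[] : ∀ {c f} → (c ∷ f) ≈ [] → f ≈ []
tail-≈[] e = mk λ i → at e (suc i)

coef-+ : ∀ f g i → coef (f +ₚ g) i ≡ coef f i xor coef g i
coef-+ [] g i = refl
coef-+ (c ∷ f) [] i = sym (𝔹ₚ.xor-identityʳ _)
coef-+ (c ∷ f) (d ∷ g) zero = refl
coef-+ (c ∷ f) (d ∷ g) (suc i) = coef-+ f g i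

coef-scale : ∀ c g i → coef (scaleₚ c g) i ≡ c ∧ coef g i
coef-scale c [] i = sym (𝔹ₚ.∧-zeroʳ c)
coef-scale c (d ∷ g) zero = refl
coef-scale c (d ∷ g) (suc i) = coef-scale c g i

+-cong : ∀ {f f' g g'} → f ≈ f' → g ≈ g' → f +ₚ g ≈ f' +ₚ g'
+-cong {f} {f'} {g} {g'} e e' = mk λ i → trans (coef-+ f g i) (trans (cong₂ _xor_ (at e i) (at e' i)) (sym (coef-+ f' g' i)))

+-assoc : ∀ f g h → (f +ₚ g) +ₚ h ≈ f +ₚ (g +ₚ h)
+-assoc f g h = mk λ i → begin
    coef ((f +ₚ g) +ₚ h) i                      ≡⟨ trans (coef-+ (f +ₚ g) h i) (cong (_xor coef h i) (coef-+ f g i)) ⟩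
    (coef f i xor coef g i) xor coef h i        ≡⟨ 𝔹ₚ.xor-assoc (coef f i) _ _ ⟩
    coef f i xor (coef g i xor coef h i)        ≡⟨ sym (trans (coef-+ f (g +ₚ h) i) (cong (coef f i xor_) (coef-+ g h i))) ⟩
    coef (f +ₚ (g +ₚ h)) i                      ∎
  where open ≡-Reasoning

+-comm : ∀ f g → f +ₚ g ≈ g +ₚ f
+-comm f g = mk λ i → trans (coef-+ f g i) (trans (𝔹ₚ.xor-comm (coef f i) _) (sym (coef-+ g f i)))

+-self : ∀ f → f +ₚ f ≈ []
+-self f = mk λ i → trans (coef-+ f f i) (xor-self (coef f i))

+-isCommutativeMonoid : IsCommutativeMonoid _≈_ _+ₚ_ []
+-isCommutativeMonoid = record
  { isMonoid = record
    { isSemigroup = record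
      { isMagma = record { isEquivalence = ≈-isEquivalence ; ∙-cong = +-cong }
      ; assoc = +-assoc }
    ; identity = (λ f → ≈-refl) , (λ f → +-comm f []) }
  ; comm = +-comm }

+-identityʳ : ∀ f → f +ₚ [] ≈ f
+-identityʳ f = +-comm f []

+-interchange : ∀ a b c d → (a +ₚ b) +ₚ (c +ₚ d) ≈ (a +ₚ c) +ₚ (b +ₚ d)
+-interchange a b c d = ≈-trans (+-assoc a b _) (≈-trans (+-cong (≈-refl {a}) (≈-trans (≈-sym (+-assoc b c d))
  (≈-trans (+-cong (+-comm b c) ≈-refl) (+-assoc c b d)))) (≈-sym (+-assoc a c _)))

scale-cong : ∀ c {f g} → f ≈ g → scaleₚ c f ≈ scaleₚ c g
scale-cong c {f} {g} e = mk λ i → trans (coef-scale c f i) (trans (cong (c ∧_) (at e i)) (sym (coef-scale c g i)))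

scale-true : ∀ f → scaleₚ true f ≈ f
scale-true f = mk (coef-scale true f)

scale-false : ∀ f → scaleₚ false f ≈ []
scale-false f = mk (coef-scale false f)

scale-xor : ∀ c d f → scaleₚ (c xor d) f ≈ scaleₚ c f +ₚ scaleₚ d f
scale-xor false d f = ≈-sym (+-cong (scale-false f) (≈-refl {scaleₚ d f}))
scale-xor true false f = ≈-sym (≈-trans (+-cong (≈-refl {scaleₚ true f}) (scale-false f)) (+-identityʳ _))
scale-xor true true f = ≈-trans (scale-false f) (≈-sym (+-self (scaleₚ true f)))

*-congˡ : ∀ f {g g'} → g ≈ g' → f *ₚ g ≈ f *ₚ g'
*-congˡ [] e = ≈-refl
*-congˡ (c ∷ f) e = +-cong (scale-cong c e) (∷-cong refl (*-congˡ f e))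

*-zeroʳ : ∀ f → f *ₚ [] ≈ []
*-zeroʳ [] = ≈-refl
*-zeroʳ (c ∷ f) = ∷-≈[] refl (*-zeroʳ f)

*-∷ : ∀ f d g → f *ₚ (d ∷ g) ≈ scaleₚ d f +ₚ (false ∷ (f *ₚ g))
*-∷ [] d g = ≈-sym (∷-≈[] refl ≈-refl)
*-∷ (c ∷ f) d g = ∷-cong (cong (_xor false) (𝔹ₚ.∧-comm c d)) (≈-trans (+-cong (≈-refl {scaleₚ c g}) (*-∷ f d g))
  (≈-trans (≈-sym (+-assoc (scaleₚ c g) (scaleₚ d f) _)) (≈-trans (+-cong (+-comm (scaleₚ c g) (scaleₚ d f)) ≈-refl) (+-assoc (scaleₚ d f) (scaleₚ c g) _))))

*-comm : ∀ f g → f *ₚ g ≈ g *ₚ f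
*-comm [] g = ≈-sym (*-zeroʳ g)
*-comm (c ∷ f) g = ≈-trans (+-cong (≈-refl {scaleₚ c g}) (∷-cong refl (*-comm f g))) (≈-sym (*-∷ g c f))

*-cong : ∀ {f f' g g'} → f ≈ f' → g ≈ g' → f *ₚ g ≈ f' *ₚ g'
*-cong {f} {f'} {g} {g'} e e' = ≈-trans (*-congˡ f e') (≈-trans (*-comm f g') (≈-trans (*-congˡ g' e) (*-comm g' f')))

*-distribʳ : ∀ h f g → (f +ₚ g) *ₚ h ≈ (f *ₚ h) +ₚ (g *ₚ h)
*-distribʳ h [] g = ≈-refl
*-distribʳ h (c ∷ f) [] = ≈-sym (+-identityʳ _)
*-distribʳ h (c ∷ f) (d ∷ g) = ≈-trans (+-cong (scale-xor c d h) (∷-cong refl (*-distribʳ h f g)))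
  (+-interchange (scaleₚ c h) (scaleₚ d h) (false ∷ (f *ₚ h)) (false ∷ (g *ₚ h)))

shift-* : ∀ f h → (false ∷ f) *ₚ h ≈ false ∷ (f *ₚ h)
shift-* f h = +-cong (scale-false h) ≈-refl

scale-* : ∀ c g h → scaleₚ c g *ₚ h ≈ scaleₚ c (g *ₚ h)
scale-* true g h = ≈-trans (*-cong (scale-true g) (≈-refl {h})) (≈-sym (scale-true _))
scale-* false g h = ≈-trans (*-cong (scale-false g) (≈-refl {h})) (≈-sym (scale-false _))

*-assoc : ∀ f g h → (f *ₚ g) *ₚ h ≈ f *ₚ (g *ₚ h)
*-assoc [] g h = ≈-refl
*-assoc (c ∷ f) g h = ≈-trans (*-distribʳ h (scaleₚ c g) _)
  (+-cong (scale-* c g h) (≈-trans (shift-* (f *ₚ g) h) (∷-cong refl (*-assoc f g h))))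

*-identityˡ : ∀ f → oneₚ *ₚ f ≈ f
*-identityˡ f = ≈-trans (+-cong (scale-true f) (∷-≈[] refl ≈-refl)) (+-identityʳ f)

𝔽₂[x] : CommutativeSemiring _ _
𝔽₂[x] = record
  { Carrier = Poly ; _≈_ = _≈_ ; _+_ = _+ₚ_ ; _*_ = _*ₚ_ ; 0# = [] ; 1# = oneₚ
  ; isCommutativeSemiring = isCommutativeSemiringˡ record
    { +-isCommutativeMonoid = +-isCommutativeMonoid
    ; *-isCommutativeMonoid = record
      { isMonoid = record
        { isSemigroup = record
          { isMagma = record { isEquivalence = ≈-isEquivalence ; ∙-cong = *-cong }
          ; assoc = *-assoc }
        ; identity = *-identityˡ , (λ f → ≈-trans (*-comm f oneₚ) (*-identityˡ f)) }
      ; comm = *-comm }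
    ; distribʳ = *-distribʳ
    ; zeroˡ = λ f → ≈-refl } }

open Char2Solver 𝔽₂[x] +-self public using (solve; _:=_; _:+_; _:*_)
≈-setoid : Setoid _ _
≈-setoid = record { isEquivalence = ≈-isEquivalence }

module ≈-Reasoning = Relation.Binary.Reasoning.Setoid ≈-setoid

*-identityʳ : ∀ f → f *ₚ oneₚ ≈ f
*-identityʳ = CommutativeSemiring.*-identityʳ 𝔽₂[x]

≈-+⇒ : ∀ {f g} → f +ₚ g ≈ [] → f ≈ g
≈-+⇒ {f} {g} e = mk λ i → xor-false (coef f i) (coef g i) (trans (sym (coef-+ f g i)) (at e i))
  where
  xor-false : ∀ a b → a xor b ≡ false → a ≡ b
  xor-false false false _ = refl
  xor-false true true _ = refl

-- The `with`-branches of `norm` as a function of its own, so that equations for `norm f` can be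
-- substituted.
norm-cons : Bool → Poly → Poly
norm-cons c [] = if c then true ∷ [] else []
norm-cons c (d ∷ ds) = c ∷ d ∷ ds

norm-∷ : ∀ c f → norm (c ∷ f) ≡ norm-cons c (norm f)
norm-∷ c f with norm f
... | [] = refl
... | d ∷ ds = refl

norm-cons-≈ : ∀ c f → norm-cons c f ≈ (c ∷ f)
norm-cons-≈ false [] = ≈-sym (∷-≈[] refl ≈-refl)
norm-cons-≈ true [] = ≈-refl
norm-cons-≈ c (d ∷ f) = ≈-refl

norm-≈ : ∀ f → norm f ≈ f
norm-≈ [] = ≈-refl
norm-≈ (c ∷ f) = ≈-trans (≈-reflexive (norm-∷ c f)) (≈-trans (norm-cons-≈ c (norm f)) (∷-cong refl (norm-≈ f)))

≈[]⇒norm : ∀ f → f ≈ [] → norm f ≡ []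
≈[]⇒norm [] e = refl
≈[]⇒norm (c ∷ f) e = trans (norm-∷ c f) (trans (cong (norm-cons c) (≈[]⇒norm f (tail-≈[] e))) (cong (λ b → if b then true ∷ [] else []) (at e 0)))

≈⇒≈ₚ : ∀ f g → f ≈ g → f ≈ₚ g
≈⇒≈ₚ [] g e = sym (≈[]⇒norm g (≈-sym e))
≈⇒≈ₚ (c ∷ f) [] e = ≈[]⇒norm (c ∷ f) e
≈⇒≈ₚ (c ∷ f) (d ∷ g) e = trans (norm-∷ c f) (trans (cong₂ norm-cons (at e 0) (≈⇒≈ₚ f g (∷-injʳ e))) (sym (norm-∷ d g)))

≈ₚ⇒≈ : ∀ f g → f ≈ₚ g → f ≈ g
≈ₚ⇒≈ f g e = ≈-trans (≈-sym (norm-≈ f)) (≈-trans (≈-reflexive e) (norm-≈ g))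

_≈?_ : ∀ f g → Dec (f ≈ g)
f ≈? g with Lₚ.≡-dec 𝔹ₚ._≟_ (norm f) (norm g)
... | yes e = yes (≈ₚ⇒≈ f g e)
... | no ne = no (λ e → ne (≈⇒≈ₚ f g e))

-- A relation rather than a function: it excludes the zero polynomial, to which `deg` assigns 0.
record Deg (f : Poly) (d : ℕ) : Set where
  constructor mk
  field
    lead : coef f d ≡ true
    above : ∀ i → d < i → coef f i ≡ false
open Deg public

Deg-cong : ∀ {f g d} → f ≈ g → Deg f d → Deg g d
Deg-cong e (mk l a) = mk (trans (sym (at e _)) l) (λ i p → trans (sym (at e i)) (a i p))

Deg-≉ : ∀ {f d} → Deg f d → ¬ f ≈ []
Deg-≉ D e with trans (sym (lead D)) (at e _)
... | ()

Deg-unique : ∀ {f d e} → Deg f d → Deg f e → d ≡ e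
Deg-unique {d = d} {e} D E with ℕₚ.<-cmp d e
... | tri≈ _ p _ = p
... | tri< p _ _ with trans (sym (lead E)) (above D e p)
...   | ()
Deg-unique {d = d} {e} D E | tri> _ _ p with trans (sym (lead D)) (above E d p)
...   | ()

Deg-∷ : ∀ {f d} c → Deg f d → Deg (c ∷ f) (suc d)
Deg-∷ c (mk l a) = mk l λ { (suc i) (s≤s p) → a i p }

≈[]⊎Deg : ∀ f → f ≈ [] ⊎ ∃ (Deg f)
≈[]⊎Deg [] = inj₁ ≈-refl
≈[]⊎Deg (c ∷ f) with ≈[]⊎Deg f
... | inj₂ (d , D) = inj₂ (suc d , Deg-∷ c D)
≈[]⊎Deg (false ∷ f) | inj₁ e = inj₁ (∷-≈[] refl e)
≈[]⊎Deg (true ∷ f) | inj₁ e = inj₂ (0 , mk refl λ { (suc i) _ → at e i })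

Deg-length : ∀ f {d} → Deg f d → length (norm f) ≡ suc d
Deg-length [] D = ⊥-elim (Deg-≉ D ≈-refl)
Deg-length (c ∷ f) {zero} D = trans (cong length (trans (norm-∷ c f) (cong₂ norm-cons (lead D) (≈[]⇒norm f (mk λ i → above D (suc i) (s≤s z≤n)))))) refl
Deg-length (c ∷ f) {suc d} D = trans (cong length (norm-∷ c f)) (lemma (norm f) (Deg-length f {d} (mk (lead D) λ i p → above D (suc i) (s≤s p))))
  where
  lemma : ∀ g → length g ≡ suc d → length (norm-cons c g) ≡ suc (suc d)
  lemma (b ∷ g) e = cong suc e

Deg⇒deg : ∀ {f d} → Deg f d → deg f ≡ d
Deg⇒deg {f} D = cong (_∸ 1) (Deg-length f D)

≉⇒Deg : ∀ f → ¬ f ≈ [] → Deg f (deg f)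
≉⇒Deg f ne with ≈[]⊎Deg f
... | inj₁ e = ⊥-elim (ne e)
... | inj₂ (d , D) = subst (Deg f) (sym (Deg⇒deg D)) D

deg-cong : ∀ {f g} → f ≈ g → deg f ≡ deg g
deg-cong {f} {g} e = cong (λ h → length h ∸ 1) (≈⇒≈ₚ f g e)

Deg-* : ∀ f {g d e} → Deg f d → Deg g e → Deg (f *ₚ g) (d + e)
Deg-* [] D E = ⊥-elim (Deg-≉ D ≈-refl)
Deg-* (c ∷ f) {g} {zero} D E = Deg-cong (≈-sym (≈-trans (*-cong {c ∷ f} {oneₚ} {g} (∷-cong (lead D) (mk λ i → above D (suc i) (s≤s z≤n))) ≈-refl) (*-identityˡ g))) E
Deg-* (c ∷ f) {g} {suc d} {e} D E = mk
    (trans (coef-+ (scaleₚ c g) _ _) (trans (cong (_xor coef (f *ₚ g) (d + e)) (high _ (s≤s (ℕₚ.m≤n+m e d)))) (lead IH)))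
    (λ { (suc i) (s≤s p) → trans (coef-+ (scaleₚ c g) _ _) (trans (cong (_xor coef (f *ₚ g) i) (high (suc i) (s≤s (ℕₚ.≤-trans (ℕₚ.m≤n+m e d) (ℕₚ.<⇒≤ p))))) (above IH i p)) })
  where
  IH : Deg (f *ₚ g) (d + e)
  IH = Deg-* f {g} {d} (mk (lead D) λ i p → above D (suc i) (s≤s p)) E
  high : ∀ i → e < i → coef (scaleₚ c g) i ≡ false
  high i p = trans (coef-scale c g i) (trans (cong (c ∧_) (above E i p)) (𝔹ₚ.∧-zeroʳ c))

Deg-1 : Deg oneₚ 0
Deg-1 = mk refl λ { (suc i) _ → refl }

Deg0⇒≈1 : ∀ {f} → Deg f 0 → f ≈ oneₚ
Deg0⇒≈1 D = mk λ { zero → lead D ; (suc i) → above D (suc i) (s≤s z≤n) }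

-- Divisibility

infix 4 _∣ₚ_
_∣ₚ_ : Poly → Poly → Set
f ∣ₚ g = ∃ λ q → g ≈ q *ₚ f

∣-refl : ∀ {f} → f ∣ₚ f
∣-refl {f} = oneₚ , ≈-sym (*-identityˡ f)

∣-cong : ∀ {f f' g g'} → f ≈ f' → g ≈ g' → f ∣ₚ g → f' ∣ₚ g'
∣-cong e e' (q , p) = q , ≈-trans (≈-sym e') (≈-trans p (*-congˡ q e))

∣-trans : ∀ {f g h} → f ∣ₚ g → g ∣ₚ h → f ∣ₚ h
∣-trans {f} (q , e) (q' , e') = q' *ₚ q , ≈-trans e' (≈-trans (*-congˡ q' e) (≈-sym (*-assoc q' q f)))

∣-*ˡ : ∀ {f} g {h} → f ∣ₚ h → f ∣ₚ g *ₚ h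
∣-*ˡ {f} g (q , e) = g *ₚ q , ≈-trans (*-congˡ g e) (≈-sym (*-assoc g q f))

∣-*ʳ : ∀ {f g} h → f ∣ₚ g → f ∣ₚ g *ₚ h
∣-*ʳ {f} {g} h d = ∣-cong ≈-refl (*-comm h g) (∣-*ˡ h d)

∣-+ : ∀ {f g h} → f ∣ₚ g → f ∣ₚ h → f ∣ₚ g +ₚ h
∣-+ {f} (q , e) (q' , e') = q +ₚ q' , ≈-trans (+-cong e e') (≈-sym (*-distribʳ f q q'))

-- The equation `d + (e ∸ d) ≡ e` carries d ≤ e, and serves below for every comparison of degrees
-- along a divisibility.
∣-Deg : ∀ {f g d e} → f ∣ₚ g → Deg f d → Deg g e → ∃ λ q → Deg q (e ∸ d) × d + (e ∸ d) ≡ e × g ≈ q *ₚ f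
∣-Deg {f} {g} {d} {e} (q , p) D E with q ≈? []
... | yes z = ⊥-elim (Deg-≉ E (≈-trans p (*-cong z (≈-refl {f}))))
... | no nz = q , subst (Deg q) q≡ Q , trans (cong (d +_) (sym q≡)) (trans (ℕₚ.+-comm d (deg q)) s) , p
  where
  Q = ≉⇒Deg q nz
  s : deg q + d ≡ e
  s = Deg-unique (Deg-* q Q D) (Deg-cong p E)
  q≡ : deg q ≡ e ∸ d
  q≡ = trans (sym (ℕₚ.m+n∸n≡m (deg q) d)) (cong (_∸ d) s)

-- The quotient has degree 0, hence is 1: over 𝔽₂ associates coincide.
∣-Deg-≡ : ∀ {f g d} → f ∣ₚ g → Deg f d → Deg g d → f ≈ g
∣-Deg-≡ {f} {g} {d} p D E with ∣-Deg p D E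
... | q , Q , _ , e = ≈-sym (≈-trans e (≈-trans (*-cong {q} {oneₚ} {f} (Deg0⇒≈1 (subst (Deg q) (ℕₚ.n∸n≡0 d) Q)) ≈-refl) (*-identityˡ f)))

∣-antisym : ∀ {f g d e} → Deg f d → Deg g e → f ∣ₚ g → g ∣ₚ f → f ≈ g
∣-antisym {f} {g} {d} {e} D E p q = ∣-Deg-≡ p D (subst (Deg g) (ℕₚ.≤-antisym (le q E D) (le p D E)) E)
  where
  le : ∀ {f g d e} → f ∣ₚ g → Deg f d → Deg g e → d ≤ e
  le p D E with ∣-Deg p D E
  ... | _ , _ , s , _ = ℕₚ.≤-trans (ℕₚ.m≤m+n _ _) (ℕₚ.≤-reflexive s)

-- Division with remainder, Bézout

toList-⊕ : ∀ {n} (u v : Vec Bool n) → toList (u ⊕ v) ≈ toList u +ₚ toList v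
toList-⊕ [] [] = ≈-refl
toList-⊕ (a ∷ u) (b ∷ v) = ∷-cong refl (toList-⊕ u v)

toList-𝟎 : ∀ n → toList (𝟎 {n}) ≈ []
toList-𝟎 zero = ≈-refl
toList-𝟎 (suc n) = ∷-≈[] refl (toList-𝟎 n)

toList≈[] : ∀ {n} (v : Vec Bool n) → toList v ≈ [] → v ≡ 𝟎
toList≈[] [] e = refl
toList≈[] (c ∷ v) e = cong₂ _∷_ (at e 0) (toList≈[] v (tail-≈[] e))

coef-toList : ∀ {n} (v : Vec Bool n) i → n ≤ i → coef (toList v) i ≡ false
coef-toList [] i p = refl
coef-toList (c ∷ v) (suc i) (s≤s p) = coef-toList v i p

Deg-modulus : ∀ {n} (plow : Vec Bool n) → Deg (modulusPoly plow) n
Deg-modulus [] = Deg-1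
Deg-modulus (c ∷ v) = Deg-∷ c (Deg-modulus v)

trunc : ∀ n → Poly → Vec Bool n
trunc zero f = []
trunc (suc n) [] = false ∷ trunc n []
trunc (suc n) (c ∷ f) = c ∷ trunc n f

toList-trunc : ∀ n f → (∀ i → n ≤ i → coef f i ≡ false) → toList (trunc n f) ≈ f
toList-trunc zero f h = mk λ i → sym (h i z≤n)
toList-trunc (suc n) [] h = ∷-≈[] refl (toList-trunc n [] (λ i p → refl))
toList-trunc (suc n) (c ∷ f) h = ∷-cong refl (toList-trunc n f (λ i p → h (suc i) (s≤s p)))

Deg⇒modulus : ∀ {f d} → Deg f d → f ≈ modulusPoly (trunc d f)
Deg⇒modulus {[]} {d} D = ⊥-elim (Deg-≉ D ≈-refl)
Deg⇒modulus {c ∷ f} {zero} D = Deg0⇒≈1 D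
Deg⇒modulus {c ∷ f} {suc d} D = ∷-cong refl (Deg⇒modulus (mk (lead D) λ i p → above D (suc i) (s≤s p)))

toList-pushLast : ∀ {n} c (r : Vec Bool n) → c ∷ toList r ≡ toList (proj₁ (pushLast c r)) ++ (proj₂ (pushLast c r) ∷ [])
toList-pushLast c [] = refl
toList-pushLast c (d ∷ r) = cong (c ∷_) (toList-pushLast d r)

reduce : ∀ {n} → Vec Bool n → Vec Bool n × Bool → Vec Bool n
reduce plow (w , t) = if t then w ⊕ plow else w

reduce-≈ : ∀ {n} (plow : Vec Bool n) w t → toList w ++ (t ∷ []) ≈ scaleₚ t (modulusPoly plow) +ₚ toList (reduce plow (w , t))
reduce-≈ plow w false = ≈-trans (snoc w) (≈-sym (+-cong (scale-false (modulusPoly plow)) ≈-refl))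
  where
  snoc : ∀ {n} (w : Vec Bool n) → toList w ++ (false ∷ []) ≈ toList w
  snoc [] = ∷-≈[] refl ≈-refl
  snoc (c ∷ w) = ∷-cong refl (snoc w)
reduce-≈ plow w true = ≈-trans (go w plow) (+-cong (≈-sym (scale-true (modulusPoly plow))) ≈-refl)
  where
  go : ∀ {n} (w p : Vec Bool n) → toList w ++ (true ∷ []) ≈ modulusPoly p +ₚ toList (w ⊕ p)
  go [] [] = ≈-refl
  go (a ∷ w) (b ∷ p) = ∷-cong (lemma a b) (go w p)
    where
    lemma : ∀ a b → a ≡ b xor (a xor b)
    lemma false false = refl
    lemma false true = refl
    lemma true false = refl
    lemma true true = refl

reduce-pushLast-≈ : ∀ {n} (plow : Vec Bool n) c r →
  c ∷ toList r ≈ scaleₚ (proj₂ (pushLast c r)) (modulusPoly plow) +ₚ toList (reduce plow (pushLast c r))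
reduce-pushLast-≈ plow c r = ≈-trans (≈-reflexive (toList-pushLast c r)) (reduce-≈ plow _ _)

-- Horner's scheme: the remainder of the tail is multiplied by x and receives `c`; the bit pushed
-- out at the top is the new lowest coefficient of the quotient. The length of `r` records the
-- degree bound.
divMod : ∀ {n} (plow : Vec Bool n) f → ∃₂ λ q r → f ≈ (q *ₚ modulusPoly plow) +ₚ toList {n = n} r
divMod plow [] = [] , 𝟎 , ≈-sym (toList-𝟎 _)
divMod plow (c ∷ f) with divMod plow f
... | q , r , e = (proj₂ (pushLast c r) ∷ q) , reduce plow (pushLast c r) , (begin
    c ∷ f
      ≈⟨ ∷-cong (sym (𝔹ₚ.xor-identityˡ c)) e ⟩
    (false ∷ (q *ₚ P)) +ₚ (c ∷ toList r)
      ≈⟨ +-cong (≈-refl {false ∷ (q *ₚ P)}) (reduce-pushLast-≈ plow c r) ⟩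
    (false ∷ (q *ₚ P)) +ₚ (scaleₚ t P +ₚ R)
      ≈⟨ ≈-sym (+-assoc (false ∷ (q *ₚ P)) (scaleₚ t P) R) ⟩
    ((false ∷ (q *ₚ P)) +ₚ scaleₚ t P) +ₚ R
      ≈⟨ +-cong (+-comm (false ∷ (q *ₚ P)) (scaleₚ t P)) ≈-refl ⟩
    ((t ∷ q) *ₚ P) +ₚ R ∎)
  where
  open ≈-Reasoning
  P = modulusPoly plow
  t = proj₂ (pushLast c r)
  R = toList (reduce plow (pushLast c r))

-- Bézout coefficients take the place of the clause that every common divisor divides `g`. Gcd
-- identities are then proved by exhibiting coefficients and appealing to `IsGcd-unique`.
record IsGcd (a b g : Poly) : Set where
  constructor mk
  field
    ∣a : g ∣ₚ a
    ∣b : g ∣ₚ b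
    bezout : ∃₂ λ u v → g ≈ (u *ₚ a) +ₚ (v *ₚ b)
open IsGcd public

IsGcd-cong : ∀ {a a' b b' g} → a ≈ a' → b ≈ b' → IsGcd a b g → IsGcd a' b' g
IsGcd-cong e e' (mk p q (u , v , z)) = mk (∣-cong ≈-refl e p) (∣-cong ≈-refl e' q)
  (u , v , ≈-trans z (+-cong (*-congˡ u e) (*-congˡ v e')))

-- The length `n` bounds the degree of `r`. Each round replaces it by the true degree m < n, so that
-- `r` becomes a monic modulus and the next remainder has length m.
euclid : ∀ fuel n → n ≤ fuel → (a : Poly) (r : Vec Bool n) → ∃ λ g → IsGcd a (toList r) g
euclid fuel n n≤ a r with ≈[]⊎Deg (toList r)
... | inj₁ z = a , mk ∣-refl ([] , z) (oneₚ , [] , ≈-sym (≈-trans (+-identityʳ _) (*-identityˡ a)))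
euclid zero zero z≤n a [] | inj₂ (m , D) = ⊥-elim (Deg-≉ D ≈-refl)
euclid (suc fuel) n n≤ a r | inj₂ (m , D) with divMod (trunc m (toList r)) a
... | q , r' , e with euclid fuel m (ℕₚ.≤-pred (ℕₚ.≤-trans m<n n≤)) (toList r) r'
  where
  m<n : m < n
  m<n with ℕₚ.<-≤-connex m n
  ... | inj₁ p = p
  ... | inj₂ p with trans (sym (lead D)) (coef-toList r m p)
  ...   | ()
... | g , mk p p' (u , v , b) = g , mk
    (∣-cong ≈-refl (≈-sym e') (∣-+ (∣-*ˡ q p) p'))
    p
    (v , u +ₚ (v *ₚ q) , (begin
      g
        ≈⟨ b ⟩
      (u *ₚ B) +ₚ (v *ₚ R)
        ≈⟨ solve 5 (λ u v q B R → u :* B :+ v :* R := v :* (q :* B :+ R) :+ (u :+ v :* q) :* B) ≈-refl u v q B R ⟩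
      (v *ₚ ((q *ₚ B) +ₚ R)) +ₚ ((u +ₚ (v *ₚ q)) *ₚ B)
        ≈⟨ +-cong (*-congˡ v (≈-sym e')) ≈-refl ⟩
      (v *ₚ a) +ₚ ((u +ₚ (v *ₚ q)) *ₚ B) ∎))
  where
  open ≈-Reasoning
  B = toList r
  R = toList r'
  e' : a ≈ (q *ₚ B) +ₚ R
  e' = ≈-trans e (+-cong (*-congˡ q (≈-sym (Deg⇒modulus D))) ≈-refl)

-- Opaque, so that the Euclidean algorithm is never unfolded in types; `IsGcd` determines the result
-- anyway.
abstract
  gcdₚ : (a b : Poly) → ∃ (IsGcd a b)
  gcdₚ a b with euclid (length b) (length b) ℕₚ.≤-refl a (fromList b)
  ... | g , p = g , IsGcd-cong ≈-refl (≈-reflexive (Vₚ.toList∘fromList b)) p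

IsGcd-unique : ∀ {a b g g'} → ¬ b ≈ [] → IsGcd a b g → IsGcd a b g' → g ≈ g'
IsGcd-unique {a} {b} {g} {g'} nb p p' = ∣-antisym (≉⇒Deg g (nz p)) (≉⇒Deg g' (nz p')) (div p p') (div p' p)
  where
  nz : ∀ {g} → IsGcd a b g → ¬ g ≈ []
  nz {g} p z with ∣b p
  ... | q , e = nb (≈-trans e (≈-trans (*-congˡ q z) (*-zeroʳ q)))
  div : ∀ {g g'} → IsGcd a b g → IsGcd a b g' → g ∣ₚ g'
  div p p' with bezout p'
  ... | u , v , e = ∣-cong ≈-refl (≈-sym e) (∣-+ (∣-*ˡ u (∣a p)) (∣-*ˡ v (∣b p)))

-- Coprimality and primes

Coprime : Poly → Poly → Set
Coprime a b = ∃₂ λ u v → oneₚ ≈ (u *ₚ a) +ₚ (v *ₚ b)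

-- Primality as a dichotomy. This is the form in which residues are later split into multiples of P
-- and residues prime to P; units also satisfy it.
Prime : Poly → Set
Prime p = ∀ s → p ∣ₚ s ⊎ Coprime p s

Coprime-∣-* : ∀ {a b c} → Coprime a b → a ∣ₚ b *ₚ c → a ∣ₚ c
Coprime-∣-* {a} {b} {c} (u , v , e) p = ∣-cong ≈-refl
  (≈-sym (≈-trans (≈-sym (*-identityˡ c)) (≈-trans (*-cong e (≈-refl {c}))
    (solve 5 (λ u v a b c → (u :* a :+ v :* b) :* c := (u :* c) :* a :+ v :* (b :* c)) ≈-refl u v a b c))))
  (∣-+ (∣-*ˡ (u *ₚ c) (∣-refl {a})) (∣-*ˡ v p))

Prime-∣-* : ∀ {p} → Prime p → ∀ a {b} → p ∣ₚ a *ₚ b → p ∣ₚ a ⊎ p ∣ₚ b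
Prime-∣-* P a d with P a
... | inj₁ q = inj₁ q
... | inj₂ c = inj₂ (Coprime-∣-* c d)

Irreducible⇒Prime : ∀ {p} → Irreducible p → Prime p
Irreducible⇒Prime {p} (1≤ , irr) s with gcdₚ p s
... | g , G with p ≈? []
...   | yes z = ⊥-elim (contra (subst (1 ≤_) (deg-cong z) 1≤))
  where
  contra : ¬ 1 ≤ 0
  contra ()
...   | no np with ∣a G
...     | q , e with irr q g (≈⇒≈ₚ _ _ (≈-sym e))
...       | inj₁ q0 = inj₁ (∣-cong (≈-sym (≈-trans e (≈-trans (*-cong q≈1 (≈-refl {g})) (*-identityˡ g)))) ≈-refl (∣b G))
  where
  q≈1 : q ≈ oneₚ
  q≈1 = Deg0⇒≈1 (subst (Deg q) q0 (≉⇒Deg q (λ z → np (≈-trans e (*-cong z (≈-refl {g}))))))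
...       | inj₂ g0 with bezout G
...         | u , v , b = inj₂ (u , v , ≈-trans (≈-sym (Deg0⇒≈1 (subst (Deg g) g0 (≉⇒Deg g (λ z → np (≈-trans e (≈-trans (*-congˡ q z) (*-zeroʳ q)))))))) b)

-- Gcd degrees of all residues modulo a polynomial

γ : Poly → Poly → ℕ
γ s D = deg (proj₁ (gcdₚ s D))

γ-unique : ∀ {s D g} → ¬ D ≈ [] → IsGcd s D g → γ s D ≡ deg g
γ-unique {s} {D} nz G = deg-cong (IsGcd-unique nz (proj₂ (gcdₚ s D)) G)

γ-cong : ∀ {s s' D D'} → ¬ D ≈ [] → s ≈ s' → D ≈ D' → γ s D ≡ γ s' D'
γ-cong {s} {s'} {D} {D'} nz e e' = γ-unique nz (IsGcd-cong (≈-sym e) (≈-sym e') (proj₂ (gcdₚ s' D')))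

IsGcd-deg≤ : ∀ {s D g δ} → Deg D δ → IsGcd s D g → deg g ≤ δ
IsGcd-deg≤ {g = g} E G with g ≈? []
... | yes z = ℕₚ.≤-trans (ℕₚ.≤-reflexive (deg-cong z)) z≤n
... | no nz with ∣-Deg (∣b G) (≉⇒Deg g nz) E
...   | _ , _ , s , _ = ℕₚ.≤-trans (ℕₚ.m≤m+n _ _) (ℕₚ.≤-reflexive s)

γ≤deg : ∀ s {D δ} → Deg D δ → γ s D ≤ δ
γ≤deg s {D} E = IsGcd-deg≤ E (proj₂ (gcdₚ s D))

IsGcd-*both : ∀ {s D g} P → IsGcd s D g → IsGcd (P *ₚ s) (P *ₚ D) (P *ₚ g)
IsGcd-*both {s} {D} {g} P (mk p q (u , v , e)) = mk (mul p) (mul q)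
  (u , v , ≈-trans (*-congˡ P e) (solve 5 (λ P u v s D → P :* (u :* s :+ v :* D) := u :* (P :* s) :+ v :* (P :* D)) ≈-refl P u v s D))
  where
  mul : ∀ {a b} → a ∣ₚ b → P *ₚ a ∣ₚ P *ₚ b
  mul {a} {b} (q , e) = q , ≈-trans (*-congˡ P e) (solve 3 (λ P q a → P :* (q :* a) := q :* (P :* a)) ≈-refl P q a)

IsGcd-sym : ∀ {s D g} → IsGcd s D g → IsGcd D s g
IsGcd-sym {s} {D} (mk p q (u , v , e)) = mk q p (v , u , ≈-trans e (+-comm (u *ₚ s) (v *ₚ D)))

-- The Bézout term of `D` is multiplied by 1 = a P + b s. Combined with `IsGcd-sym` the same lemma
-- lets the other argument gain a coprime factor.
IsGcd-coprimeʳ : ∀ {P s D g} → Coprime P s → IsGcd s D g → IsGcd s (P *ₚ D) g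
IsGcd-coprimeʳ {P} {s} {D} {g} (a , b , c) (mk p q (u , v , e)) = mk p (∣-*ˡ P q)
  (u +ₚ ((v *ₚ D) *ₚ b) , v *ₚ a , (begin
    g
      ≈⟨ ≈-trans e (+-cong ≈-refl (≈-sym (*-identityʳ (v *ₚ D)))) ⟩
    (u *ₚ s) +ₚ ((v *ₚ D) *ₚ oneₚ)
      ≈⟨ +-cong (≈-refl {u *ₚ s}) (*-congˡ (v *ₚ D) c) ⟩
    (u *ₚ s) +ₚ ((v *ₚ D) *ₚ ((a *ₚ P) +ₚ (b *ₚ s)))
      ≈⟨ solve 7 (λ u s v D a P b → u :* s :+ (v :* D) :* (a :* P :+ b :* s) := (u :+ (v :* D) :* b) :* s :+ (v :* a) :* (P :* D)) ≈-refl u s v D a P b ⟩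
    ((u +ₚ ((v *ₚ D) *ₚ b)) *ₚ s) +ₚ ((v *ₚ a) *ₚ (P *ₚ D)) ∎))
  where open ≈-Reasoning

IsGcd-+* : ∀ {s D g} q → IsGcd s D g → IsGcd ((q *ₚ D) +ₚ s) D g
IsGcd-+* {s} {D} {g} q (mk p p' (u , v , e)) = mk (∣-+ (∣-*ˡ q p') p) p'
  (u , v +ₚ (u *ₚ q) , ≈-trans e (solve 5 (λ u s v D q → u :* s :+ v :* D := u :* (q :* D :+ s) :+ (v :+ u :* q) :* D) ≈-refl u s v D q))

Deg-^ : ∀ {P p} e → Deg P p → Deg (P ^ₚ e) (e * p)
Deg-^ zero d = Deg-1
Deg-^ {P} (suc e) d = Deg-* P d (Deg-^ e d)

-- When `δ` is the degree of `D`, the vectors run through the residues modulo `D`, and the argument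
-- of `h` is the codegree of the gcd, which will be half the rank of a form.
S : (δ : ℕ) → Poly → (ℕ → ℕ) → ℕ
S δ D h = ∑ {δ} (λ s → h (δ ∸ γ (toList s) D))

S-cong : ∀ {δ δ' D D'} h → ¬ D ≈ [] → δ ≡ δ' → D ≈ D' → S δ D h ≡ S δ' D' h
S-cong {δ} h nz refl e = ∑-cong {δ} (λ s → cong (λ z → h (δ ∸ z)) (γ-cong nz ≈-refl e))

-- Division with remainder is a bijection between polynomials and pairs (q, r). The sum is
-- transformed one quotient coefficient at a time, exchanging the incoming low coefficient for the
-- overflow bit.
∑-divMod : ∀ {n} (plow : Vec Bool n) δ (F : Poly → ℕ) → (∀ {f g} → f ≈ g → F f ≡ F g) →
  ∑ {δ + n} (λ s → F (toList s)) ≡ ∑ {δ} (λ q → ∑ {n} (λ r → F ((toList q *ₚ modulusPoly plow) +ₚ toList r)))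
∑-divMod plow zero F resp = refl
∑-divMod {n} plow (suc δ) F resp = trans
  (∑-divMod plow δ (λ f → F (false ∷ f) + F (true ∷ f)) (λ e → cong₂ _+_ (resp (∷-cong refl e)) (resp (∷-cong refl e))))
  (∑-cong {δ} (λ q → trans (∑-cong {n} (λ r → cong₂ _+_ (step q false r) (step q true r)))
    (trans (∑-pushLast {n} (G q)) (trans (∑-∙ {n} (λ w → G q (w , false)) (λ w → G q (w , true)))
      (cong₂ _+_ (∑-cong {n} (λ w → resp (≈-sym (regroup q false (toList w)))))
        -- For overflow bit 1 `reduce` adds `plow` to w, a translation that the sum over w absorbs.
        (trans (∑-translate {n} (λ w → F ((false ∷ (toList q *ₚ P)) +ₚ (scaleₚ true P +ₚ toList w))) plow)
          (∑-cong {n} (λ w → resp (≈-sym (regroup q true (toList w)))))))))))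
  where
  P = modulusPoly plow
  G : Vec Bool δ → Vec Bool n × Bool → ℕ
  G q wt = F ((false ∷ (toList q *ₚ P)) +ₚ (scaleₚ (proj₂ wt) P +ₚ toList (reduce plow wt)))
  step : ∀ q c r → F (c ∷ ((toList q *ₚ P) +ₚ toList r)) ≡ G q (pushLast c r)
  step q c r = resp (+-cong (≈-refl {false ∷ (toList q *ₚ P)}) (reduce-pushLast-≈ plow c r))
  regroup : ∀ q c f → ((c ∷ toList q) *ₚ P) +ₚ f ≈ (false ∷ (toList q *ₚ P)) +ₚ (scaleₚ c P +ₚ f)
  regroup q c f = ≈-trans (+-cong (+-comm (scaleₚ c P) _) ≈-refl) (+-assoc (false ∷ (toList q *ₚ P)) (scaleₚ c P) f)

∑-divMod-Deg : ∀ {D n} → Deg D n → ∀ δ (F : Poly → ℕ) → (∀ {f g} → f ≈ g → F f ≡ F g) →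
  ∑ {δ + n} (λ s → F (toList s)) ≡ ∑ {δ} (λ q → ∑ {n} (λ r → F ((toList q *ₚ D) +ₚ toList r)))
∑-divMod-Deg {D} {n} E δ F resp = trans (∑-divMod (trunc n D) δ F resp)
  (∑-cong {δ} (λ q → ∑-cong {n} (λ r → resp (+-cong (*-congˡ (toList q) (≈-sym (Deg⇒modulus E))) ≈-refl))))

-- The gcd with `D` depends only on the residue modulo `D`, and division with remainder hits each
-- residue once for each of the 2^k quotients.
∑-γ-periodic : ∀ {D δ} → Deg D δ → ∀ k (h : ℕ → ℕ) →
  ∑ {k + δ} (λ s → h (δ ∸ γ (toList s) D)) ≡ 2 ^ k * S δ D h
∑-γ-periodic {D} {δ} E k h = trans (∑-divMod-Deg E k (λ f → h (δ ∸ γ f D)) (λ e → cong (λ z → h (δ ∸ z)) (γ-cong nz e ≈-refl)))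
  (trans (∑-cong {k} (λ q → ∑-cong {δ} (λ r → cong (λ z → h (δ ∸ z)) (γ-unique nz (IsGcd-+* (toList q) (proj₂ (gcdₚ (toList r) D)))))))
    (∑-const k (S δ D h)))
  where nz = Deg-≉ E

-- Residues modulo P^e D'

module PrimePower {P p D' δ'} (prime : Prime P) (degP : Deg P p) (degD' : Deg D' δ') (P∤D' : ¬ P ∣ₚ D') where

  nzD' : ¬ D' ≈ []
  nzD' = Deg-≉ degD'

  D : ℕ → Poly
  D e = (P ^ₚ e) *ₚ D'

  degD : ∀ e → Deg (D e) (e * p + δ')
  degD e = Deg-* (P ^ₚ e) (Deg-^ e degP) degD'

  P∤r : ∀ (r : Vec Bool p) → r ≢ 𝟎 → ¬ P ∣ₚ toList r
  P∤r r ne d with ≈[]⊎Deg (toList r)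
  ... | inj₁ z = ne (toList≈[] r z)
  ... | inj₂ (m , E) with ∣-Deg d degP E
  ...   | _ , _ , s , _ with trans (sym (lead E)) (coef-toList r m (ℕₚ.≤-trans (ℕₚ.m≤m+n p _) (ℕₚ.≤-reflexive s)))
  ...     | ()

  γ-coprime : ∀ {s} e → Coprime P s → γ s (D e) ≡ γ s D'
  γ-coprime {s} e c = γ-unique (Deg-≉ (degD e)) (go e)
    where
    go : ∀ e → IsGcd s (D e) (proj₁ (gcdₚ s D'))
    go zero = IsGcd-cong ≈-refl (≈-sym (*-identityˡ D')) (proj₂ (gcdₚ s D'))
    go (suc e) = IsGcd-cong ≈-refl (≈-sym (*-assoc P (P ^ₚ e) D')) (IsGcd-coprimeʳ c (go e))

  γ-multiple : ∀ q e → γ (q *ₚ P) (D (suc e)) ≡ p + γ q (D e)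
  γ-multiple q e = trans (γ-unique (Deg-≉ (degD (suc e))) (IsGcd-cong (*-comm P q) (≈-sym (*-assoc P (P ^ₚ e) D')) (IsGcd-*both P (proj₂ (gcdₚ q (D e))))))
    (Deg⇒deg (Deg-* P degP (≉⇒Deg (proj₁ (gcdₚ q (D e))) nz)))
    where
    nz : ¬ proj₁ (gcdₚ q (D e)) ≈ []
    nz z with ∣b (proj₂ (gcdₚ q (D e)))
    ... | k , ek = Deg-≉ (degD e) (≈-trans ek (≈-trans (*-congˡ k z) (*-zeroʳ k)))

  coprimeD' : Coprime P D'
  coprimeD' with prime D'
  ... | inj₁ d = ⊥-elim (P∤D' d)
  ... | inj₂ c = c

  γ-*P : ∀ q → γ (q *ₚ P) D' ≡ γ q D'
  γ-*P q = γ-unique nzD' (IsGcd-cong (*-comm P q) ≈-refl (IsGcd-sym (IsGcd-coprimeʳ coprimeD' (IsGcd-sym (proj₂ (gcdₚ q D'))))))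

  -- Write a residue modulo P^{e+1} D' as qP + r. For r = 0 its codegree is that of q modulo P^e D'.
  -- For r ≠ 0 it is prime to P, so its codegree is (e+1)p plus the codegree with respect to D'.
  -- Summing the latter value over all residues gives 2^{(e+1)p} copies of the sum over D', of which
  -- 2^{ep} belong to r = 0; these stand on the left to avoid subtraction.
  step : ∀ e h → let h' = λ i → h (suc e * p + i) in
    S (suc e * p + δ') (D (suc e)) h + 2 ^ (e * p) * S δ' D' h' ≡ S (e * p + δ') (D e) h + 2 ^ (suc e * p) * S δ' D' h'
  step e h = begin
      S (suc e * p + δ') (D (suc e)) h + 2 ^ (e * p) * S δ' D' h'
        ≡⟨ cong₂ _+_ lhs₁ (sym lhs₂) ⟩
      ∑ {δ} (λ q → ∑ {p} (λ r → a q r)) + ∑ {δ} (λ q → ∑ {p} (λ r → b q r))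
        ≡⟨ sym (merge a b) ⟩
      ∑ {δ} (λ q → ∑ {p} (λ r → a q r + b q r))
        ≡⟨ ∑-cong {δ} (λ q → ∑-cong {p} (λ r → pointwise q r)) ⟩
      ∑ {δ} (λ q → ∑ {p} (λ r → c q r + d q r))
        ≡⟨ merge c d ⟩
      ∑ {δ} (λ q → ∑ {p} (λ r → c q r)) + ∑ {δ} (λ q → ∑ {p} (λ r → d q r))
        ≡⟨ cong₂ _+_ rhs₁ rhs₂ ⟩
      S (e * p + δ') (D e) h + 2 ^ (suc e * p) * S δ' D' h' ∎
    where
    open ≡-Reasoning
    δ = e * p + δ'
    h' : ℕ → ℕ
    h' i = h (suc e * p + i)
    s : Vec Bool δ → Vec Bool p → Poly
    s q r = (toList q *ₚ P) +ₚ toList r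
    a b c d : Vec Bool δ → Vec Bool p → ℕ
    a q r = h ((suc e * p + δ') ∸ γ (s q r) (D (suc e)))
    b q r = [ does (r ≟ᵛ 𝟎) ] * h' (δ' ∸ γ (s q r) D')
    c q r = [ does (r ≟ᵛ 𝟎) ] * h (δ ∸ γ (toList q) (D e))
    d q r = h' (δ' ∸ γ (s q r) D')
    merge : ∀ (f g : Vec Bool δ → Vec Bool p → ℕ) → ∑ {δ} (λ q → ∑ {p} (λ r → f q r + g q r)) ≡ ∑ {δ} (λ q → ∑ {p} (λ r → f q r)) + ∑ {δ} (λ q → ∑ {p} (λ r → g q r))
    merge f g = trans (∑-cong {δ} (λ q → ∑-∙ {p} (f q) (g q))) (∑-∙ {δ} (λ q → ∑ {p} (f q)) (λ q → ∑ {p} (g q)))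
    δ+p : δ + p ≡ suc e * p + δ'
    δ+p = trans (ℕₚ.+-comm δ p) (sym (ℕₚ.+-assoc p (e * p) δ'))
    s𝟎 : ∀ q → s q 𝟎 ≈ toList q *ₚ P
    s𝟎 q = ≈-trans (+-cong (≈-refl {toList q *ₚ P}) (toList-𝟎 p)) (+-identityʳ _)
    single : ∀ (f : Vec Bool p → ℕ) → ∑ {p} (λ r → [ does (r ≟ᵛ 𝟎) ] * f r) ≡ f 𝟎
    single f = trans (∑-single _ 𝟎 (λ r ne → cong (_* f r) ([]-no (r ≟ᵛ 𝟎) ne)))
      (trans (cong (_* f 𝟎) ([]-yes (𝟎 {p} ≟ᵛ 𝟎) refl)) (ℕₚ.*-identityˡ _))
    lhs₁ : S (suc e * p + δ') (D (suc e)) h ≡ ∑ {δ} (λ q → ∑ {p} (λ r → a q r))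
    lhs₁ = trans (cong (λ n → ∑ {n} (λ v → h ((suc e * p + δ') ∸ γ (toList v) (D (suc e))))) (sym δ+p))
      (∑-divMod-Deg degP δ (λ f → h ((suc e * p + δ') ∸ γ f (D (suc e)))) (λ ee → cong (λ z → h ((suc e * p + δ') ∸ z)) (γ-cong (Deg-≉ (degD (suc e))) ee ≈-refl)))
    lhs₂ : ∑ {δ} (λ q → ∑ {p} (λ r → b q r)) ≡ 2 ^ (e * p) * S δ' D' h'
    lhs₂ = trans (∑-cong {δ} (λ q → trans (single (d q)) (cong (λ z → h' (δ' ∸ z)) (trans (γ-cong nzD' (s𝟎 q) ≈-refl) (γ-*P (toList q))))))
      (∑-γ-periodic degD' (e * p) h')
    rhs₁ : ∑ {δ} (λ q → ∑ {p} (λ r → c q r)) ≡ S δ (D e) h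
    rhs₁ = ∑-cong {δ} (λ q → single (λ _ → h (δ ∸ γ (toList q) (D e))))
    rhs₂ : ∑ {δ} (λ q → ∑ {p} (λ r → d q r)) ≡ 2 ^ (suc e * p) * S δ' D' h'
    rhs₂ = trans (sym (∑-divMod-Deg degP δ (λ f → h' (δ' ∸ γ f D')) (λ ee → cong (λ z → h' (δ' ∸ z)) (γ-cong nzD' ee ≈-refl))))
      (trans (cong (λ n → ∑ {n} (λ v → h' (δ' ∸ γ (toList v) D'))) δ+p) (∑-γ-periodic degD' (suc e * p) h'))
    pointwise : ∀ q r → a q r + b q r ≡ c q r + d q r
    pointwise q r with r ≟ᵛ 𝟎
    ... | yes refl = cong₂ _+_ (trans (cong h (begin
          (suc e * p + δ') ∸ γ (s q 𝟎) (D (suc e))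
            ≡⟨ cong₂ _∸_ (ℕₚ.+-assoc p (e * p) δ') (trans (γ-cong (Deg-≉ (degD (suc e))) (s𝟎 q) ≈-refl) (γ-multiple (toList q) e)) ⟩
          (p + δ) ∸ (p + γ (toList q) (D e))
            ≡⟨ ℕₚ.[m+n]∸[m+o]≡n∸o p δ _ ⟩
          δ ∸ γ (toList q) (D e) ∎)) (sym (ℕₚ.*-identityˡ _))) (ℕₚ.*-identityˡ _)
    ... | no ne = trans (ℕₚ.+-identityʳ _) (cong h (trans (cong ((suc e * p + δ') ∸_) (γ-coprime (suc e) cop))
          (ℕₚ.+-∸-assoc (suc e * p) (γ≤deg (s q r) degD'))))
      where
      cop : Coprime P (s q r)
      cop with prime (s q r)
      ... | inj₂ k = k
      ... | inj₁ k = ⊥-elim (P∤r r ne (∣-cong ≈-refl (≈-trans (≈-sym (+-assoc (toList q *ₚ P) _ (toList r))) (+-cong (+-self (toList q *ₚ P)) ≈-refl)) (∣-+ (∣-*ˡ (toList q) (∣-refl {P})) k)))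

sumTo : ℕ → (ℕ → ℕ) → ℕ
sumTo zero f = 0
sumTo (suc N) f = sumTo N f + f N

sumTo-cong : ∀ N {f g : ℕ → ℕ} → (∀ j → f j ≡ g j) → sumTo N f ≡ sumTo N g
sumTo-cong zero e = refl
sumTo-cong (suc N) e = cong₂ _+_ (sumTo-cong N e) (e N)

-- h weighted so that the residues of gcd-codegree ρ carry the 4^ρ codewords of rank 2ρ.
weighted : (ℕ → ℕ) → ℕ → ℕ
weighted h i = 2 ^ (i + i) * h (i + i)

module _ {P p D' δ'} (prime : Prime P) (degP : Deg P p) (degD' : Deg D' δ') (P∤D' : ¬ P ∣ₚ D') where
  open PrimePower prime degP degD' P∤D'

  -- `step` is telescoped. With j = e + 1 the new term carries 2^{jp} - 2^{(j-1)p} residues, and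
  -- shifting `weighted` by jp contributes 4^{jp}; together they give the exponents 3jp and (3j-1)p.
  S-primePower : ∀ e h → S (e * p + δ') ((P ^ₚ e) *ₚ D') (weighted h) ≡
    S δ' D' (weighted h) + sumTo e (λ j → (2 ^ (3 * suc j * p) ∸ 2 ^ ((3 * suc j ∸ 1) * p)) * S δ' D' (weighted (λ x → h (suc j * (p + p) + x))))
  S-primePower zero h = trans (S-cong {δ'} (weighted h) (Deg-≉ (degD zero)) refl (*-identityˡ D')) (sym (ℕₚ.+-identityʳ _))
  S-primePower (suc e) h = begin
      T (suc e)
        ≡⟨ sym (ℕₚ.m+n∸n≡m (T (suc e)) (2 ^ (e * p) * X)) ⟩
      (T (suc e) + 2 ^ (e * p) * X) ∸ 2 ^ (e * p) * X
        ≡⟨ cong (_∸ 2 ^ (e * p) * X) (step e (weighted h)) ⟩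
      (T e + 2 ^ (suc e * p) * X) ∸ 2 ^ (e * p) * X
        ≡⟨ ℕₚ.+-∸-assoc (T e) (ℕₚ.*-monoˡ-≤ X (ℕₚ.^-monoʳ-≤ 2 (ℕₚ.m≤n+m (e * p) p))) ⟩
      T e + (2 ^ (suc e * p) * X ∸ 2 ^ (e * p) * X)
        ≡⟨ cong₂ _+_ (S-primePower e h) last ⟩
      (S δ' D' (weighted h) + sumTo e _) + c * Y
        ≡⟨ ℕₚ.+-assoc _ (sumTo e _) (c * Y) ⟩
      S δ' D' (weighted h) + (sumTo e _ + c * Y) ∎
    where
    open ≡-Reasoning
    T : ℕ → ℕ
    T e = S (e * p + δ') (D e) (weighted h)
    n = suc e * p
    X = S δ' D' (λ i → weighted h (n + i))
    Y = S δ' D' (weighted (λ x → h (suc e * (p + p) + x)))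
    c = 2 ^ (3 * suc e * p) ∸ 2 ^ ((3 * suc e ∸ 1) * p)
    X≡ : X ≡ 2 ^ (n + n) * Y
    X≡ = trans (∑-cong {δ'} (λ s → lemma (δ' ∸ γ (toList s) D'))) (∑-*ˡ {δ'} (2 ^ (n + n)) _)
      where
      lemma : ∀ i → weighted h (n + i) ≡ 2 ^ (n + n) * weighted (λ x → h (suc e * (p + p) + x)) i
      lemma i = trans (cong₂ _*_ (trans (cong (2 ^_) (solveℕ 2 (λ n i → (n :+ℕ i) :+ℕ (n :+ℕ i) :=ℕ (n :+ℕ n) :+ℕ (i :+ℕ i)) refl n i)) (ℕₚ.^-distribˡ-+-* 2 (n + n) (i + i)))
          (cong h (solveℕ 3 (λ e p i → ((p :+ℕ e :*ℕ p) :+ℕ i) :+ℕ ((p :+ℕ e :*ℕ p) :+ℕ i) :=ℕ ((p :+ℕ p) :+ℕ e :*ℕ (p :+ℕ p)) :+ℕ (i :+ℕ i)) refl e p i)))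
        (ℕₚ.*-assoc (2 ^ (n + n)) _ _)
        where open Data.Nat.Solver.+-*-Solver renaming (solve to solveℕ; _:+_ to _:+ℕ_; _:*_ to _:*ℕ_; _:=_ to _:=ℕ_)
    last : 2 ^ n * X ∸ 2 ^ (e * p) * X ≡ c * Y
    last = trans (sym (ℕₚ.*-distribʳ-∸ X (2 ^ n) (2 ^ (e * p)))) (trans (cong ((2 ^ n ∸ 2 ^ (e * p)) *_) X≡)
      (trans (sym (ℕₚ.*-assoc (2 ^ n ∸ 2 ^ (e * p)) (2 ^ (n + n)) Y)) (cong (_* Y)
        (trans (ℕₚ.*-distribʳ-∸ (2 ^ (n + n)) (2 ^ n) (2 ^ (e * p))) (cong₂ _∸_
          (trans (sym (ℕₚ.^-distribˡ-+-* 2 n (n + n))) (cong (2 ^_) (e1 e p)))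
          (trans (sym (ℕₚ.^-distribˡ-+-* 2 (e * p) (n + n))) (cong (2 ^_) (trans (e2 e p) (cong (_* p) (sym e3))))))))))
      where
      open Data.Nat.Solver.+-*-Solver renaming (solve to solveℕ; _:+_ to _:+ℕ_; _:*_ to _:*ℕ_; _:=_ to _:=ℕ_; con to conℕ)
      e1 : ∀ e p → suc e * p + (suc e * p + suc e * p) ≡ 3 * suc e * p
      e1 = solveℕ 2 (λ e p → (p :+ℕ e :*ℕ p) :+ℕ ((p :+ℕ e :*ℕ p) :+ℕ (p :+ℕ e :*ℕ p)) :=ℕ (conℕ 3 :*ℕ (conℕ 1 :+ℕ e)) :*ℕ p) refl
      e2 : ∀ e p → e * p + (suc e * p + suc e * p) ≡ (3 * e + 2) * p
      e2 = solveℕ 2 (λ e p → e :*ℕ p :+ℕ ((p :+ℕ e :*ℕ p) :+ℕ (p :+ℕ e :*ℕ p)) :=ℕ (conℕ 3 :*ℕ e :+ℕ conℕ 2) :*ℕ p) refl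
      e3 : 3 * suc e ∸ 1 ≡ 3 * e + 2
      e3 = trans (cong (_∸ 1) (ℕₚ.*-distribˡ-+ 3 1 e)) (ℕₚ.+-comm 2 (3 * e))

-- A polynomial in z is treated as the functional Σ coeffₖ h(k); products become nested functionals.

⟪_,_⟫ : NPoly → (ℕ → ℕ) → ℕ
⟪ [] , h ⟫ = 0
⟪ c ∷ f , h ⟫ = c * h 0 + ⟪ f , (λ i → h (suc i)) ⟫

⟪⟫-cong : ∀ f {h k : ℕ → ℕ} → (∀ i → h i ≡ k i) → ⟪ f , h ⟫ ≡ ⟪ f , k ⟫
⟪⟫-cong [] e = refl
⟪⟫-cong (c ∷ f) e = cong₂ _+_ (cong (c *_) (e 0)) (⟪⟫-cong f (λ i → e (suc i)))

⟪⟫-+ : ∀ f g h → ⟪ f +ᴺ g , h ⟫ ≡ ⟪ f , h ⟫ + ⟪ g , h ⟫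
⟪⟫-+ [] g h = refl
⟪⟫-+ (c ∷ f) [] h = sym (ℕₚ.+-identityʳ _)
⟪⟫-+ (c ∷ f) (d ∷ g) h = trans (cong₂ _+_ (ℕₚ.*-distribʳ-+ (h 0) c d) (⟪⟫-+ f g _)) (interchange (c * h 0) (d * h 0) _ _)

⟪⟫-scale : ∀ c g h → ⟪ map (c *_) g , h ⟫ ≡ c * ⟪ g , h ⟫
⟪⟫-scale c [] h = sym (ℕₚ.*-zeroʳ c)
⟪⟫-scale c (d ∷ g) h = trans (cong₂ _+_ (ℕₚ.*-assoc c d _) (⟪⟫-scale c g _)) (sym (ℕₚ.*-distribˡ-+ c _ _))

⟪⟫-* : ∀ f g h → ⟪ f *ᴺ g , h ⟫ ≡ ⟪ f , (λ i → ⟪ g , (λ j → h (i + j)) ⟫) ⟫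
⟪⟫-* [] g h = refl
⟪⟫-* (c ∷ f) g h = trans (⟪⟫-+ (map (c *_) g) _ h) (cong₂ _+_ (⟪⟫-scale c g h) (⟪⟫-* f g _))

⟪⟫-mono : ∀ c e h → ⟪ mono c e , h ⟫ ≡ c * h e
⟪⟫-mono c zero h = ℕₚ.+-identityʳ _
⟪⟫-mono c (suc e) h = ⟪⟫-mono c e _

⟪⟫-one : ∀ h → ⟪ oneᴺ , h ⟫ ≡ h 0
⟪⟫-one h = trans (ℕₚ.+-identityʳ _) (ℕₚ.+-identityʳ _)

⟪⟫-zero : ∀ f {h : ℕ → ℕ} → (∀ i → h i ≡ 0) → ⟪ f , h ⟫ ≡ 0
⟪⟫-zero [] e = refl
⟪⟫-zero (c ∷ f) e = cong₂ _+_ (trans (cong (c *_) (e 0)) (ℕₚ.*-zeroʳ c)) (⟪⟫-zero f (λ i → e (suc i)))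

indicator : ℕ → ℕ → ℕ
indicator k i = [ does (k ℕₚ.≟ i) ]

-- Indicator functions read off coefficients, as the constant function 1 gives the value at z = 1.
-- An identity for all `h` thus yields both the enumerator and the count of balanced words.
⟪⟫-coeff : ∀ f k → ⟪ f , indicator k ⟫ ≡ coeff k f
⟪⟫-coeff [] k = refl
⟪⟫-coeff (c ∷ f) zero = trans (cong₂ _+_ (ℕₚ.*-identityʳ c) (⟪⟫-zero f (λ i → refl))) (ℕₚ.+-identityʳ c)
⟪⟫-coeff (c ∷ f) (suc k) = cong₂ _+_ (ℕₚ.*-zeroʳ c) (trans (⟪⟫-cong f (λ i → []-cong (suc k ℕₚ.≟ suc i) (k ℕₚ.≟ i) ℕₚ.suc-injective (cong suc))) (⟪⟫-coeff f k))

range1-snoc : ∀ {A : Set} (f : ℕ → A) N → map f (range1 (suc N)) ≡ map f (range1 N) ++ (f (suc N) ∷ [])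
range1-snoc f N = trans (cong (λ l → map f (map suc l)) (sym (Lₚ.upTo-∷ʳ N))) (trans (cong (map f) (Lₚ.map-++ suc (upTo N) (N ∷ []))) (Lₚ.map-++ f (range1 N) _))

sum-range1 : ∀ f N → sum (map f (range1 N)) ≡ sumTo N (λ j → f (suc j))
sum-range1 f zero = refl
sum-range1 f (suc N) = trans (cong sum (range1-snoc f N)) (trans (Sumₚ.sum-++ (map f (range1 N)) _)
  (cong₂ _+_ (sum-range1 f N) (ℕₚ.+-identityʳ _)))

⟪⟫-sumᴺ-++ : ∀ fs gs h → ⟪ sumᴺ (fs ++ gs) , h ⟫ ≡ ⟪ sumᴺ fs , h ⟫ + ⟪ sumᴺ gs , h ⟫
⟪⟫-sumᴺ-++ [] gs h = refl
⟪⟫-sumᴺ-++ (f ∷ fs) gs h = trans (⟪⟫-+ f (sumᴺ (fs ++ gs)) h) (trans (cong (⟪ f , h ⟫ +_) (⟪⟫-sumᴺ-++ fs gs h))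
  (trans (sym (ℕₚ.+-assoc ⟪ f , h ⟫ _ _)) (cong (_+ ⟪ sumᴺ gs , h ⟫) (sym (⟪⟫-+ f (sumᴺ fs) h)))))

⟪⟫-monomials : ∀ (c e : ℕ → ℕ) N h → ⟪ sumᴺ (oneᴺ ∷ map (λ j → mono (c j) (e j)) (range1 N)) , h ⟫ ≡ h 0 + sumTo N (λ j → c (suc j) * h (e (suc j)))
⟪⟫-monomials c e N h = trans (⟪⟫-+ oneᴺ (sumᴺ (map m (range1 N))) h) (cong₂ _+_ (⟪⟫-one h) (go N))
  where
  m : ℕ → NPoly
  m j = mono (c j) (e j)
  go : ∀ N → ⟪ sumᴺ (map m (range1 N)) , h ⟫ ≡ sumTo N (λ j → c (suc j) * h (e (suc j)))
  go zero = refl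
  go (suc N) = trans (cong (λ l → ⟪ sumᴺ l , h ⟫) (range1-snoc m N)) (trans (⟪⟫-sumᴺ-++ (map m (range1 N)) _ h)
    (cong₂ _+_ (go N) (trans (⟪⟫-+ (m (suc N)) [] h) (trans (ℕₚ.+-identityʳ _) (⟪⟫-mono (c (suc N)) (e (suc N)) h)))))

-- Multiplication by x in the field

-- Field.shift and its local function are private, so they can only be reached by unification:
-- shiftTail is solved to a call of that function on c ∷ d ∷ v, and shiftAux to the function itself.
mutual
  shiftTail : ∀ k (c d : Bool) (v : Vec Bool k) (plow : Vec Bool (suc (suc k))) → Vec Bool k × Bool
  shiftTail = _

  shiftAux : ∀ l (plow : Vec Bool (suc l)) (c : Bool) (u : Vec Bool l) {k} (d : Bool) (v : Vec Bool k) → Vec Bool k × Bool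
  shiftAux = _

  mulX-shiftTail : ∀ k c d (v : Vec Bool k) (plow : Vec Bool (suc (suc k))) → Field.mulX plow (c ∷ d ∷ v) ≡
    reduce plow (false ∷ c ∷ proj₁ (shiftTail k c d v plow) , proj₂ (shiftTail k c d v plow))
  mulX-shiftTail k c d v plow = refl

  shiftTail≡shiftAux : ∀ k c d (v : Vec Bool k) (plow : Vec Bool (suc (suc k))) → shiftTail k c d v plow ≡ shiftAux (suc k) plow c (d ∷ v) d v
  -- Abstracting these two terms turns all arguments of `shiftAux` into distinct variables, a
  -- pattern problem that determines it. `plow` is bound afterwards because its type mentions
  -- `suc k`.
  shiftTail≡shiftAux k c d v with suc k | d ∷ v
  ... | l | u = λ plow → refl

shiftAux≡pushLast : ∀ {l} plow c (u : Vec Bool l) {k} d (v : Vec Bool k) → shiftAux l plow c u d v ≡ pushLast d v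
shiftAux≡pushLast plow c u d [] = refl
shiftAux≡pushLast plow c u d (e ∷ v) = cong (λ p → d ∷ proj₁ p , proj₂ p) (shiftAux≡pushLast plow c u e v)

mulX≡reduce : ∀ {n} (plow v : Vec Bool n) → Field.mulX plow v ≡ reduce plow (pushLast false v)
mulX≡reduce [] [] = refl
mulX≡reduce (p ∷ []) (c ∷ []) = refl
mulX≡reduce plow (c ∷ d ∷ v) = cong (λ q → reduce plow (false ∷ c ∷ proj₁ q , proj₂ q))
  (trans (shiftTail≡shiftAux _ c d v plow) (shiftAux≡pushLast plow c (d ∷ v) d v))

_·ᵇ_ : ∀ {n} → Bool → Vec Bool n → Vec Bool n
c ·ᵇ v = if c then v else 𝟎

·ᵇ-⊕ : ∀ {n} c (u v : Vec Bool n) → c ·ᵇ (u ⊕ v) ≡ (c ·ᵇ u) ⊕ (c ·ᵇ v)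
·ᵇ-⊕ true u v = refl
·ᵇ-⊕ false u v = sym (⊕-self 𝟎)

xor-·ᵇ : ∀ {n} c d (v : Vec Bool n) → (c xor d) ·ᵇ v ≡ (c ·ᵇ v) ⊕ (d ·ᵇ v)
xor-·ᵇ false d v = sym (⊕-identityˡ _)
xor-·ᵇ true false v = sym (⊕-identityʳ _)
xor-·ᵇ true true v = sym (⊕-self v)

-- Vectors become a module over 𝔽₂[x] with x acting as `T`. It is used for three operators: `mulX`,
-- where `act (toList a) b` is by definition the field product of a and b, the Frobenius map φ, and
-- ω.
module Action {n} (T : Vec Bool n → Vec Bool n) (T-additive : Additive T) where

  act : Poly → Vec Bool n → Vec Bool n
  act f v = foldr (λ c acc → (c ·ᵇ v) ⊕ T acc) 𝟎 f

  T-𝟎 : T 𝟎 ≡ 𝟎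
  T-𝟎 = additive-𝟎 T-additive

  act-additive : ∀ f → Additive (act f)
  act-additive [] x y = sym (⊕-self 𝟎)
  act-additive (c ∷ f) x y = trans (cong₂ _⊕_ (·ᵇ-⊕ c x y) (trans (cong T (act-additive f x y)) (T-additive _ _)))
    (⊕-interchange (c ·ᵇ x) (c ·ᵇ y) _ _)

  act-𝟎 : ∀ f → act f 𝟎 ≡ 𝟎
  act-𝟎 f = additive-𝟎 (act-additive f)

  act-+ : ∀ f g v → act (f +ₚ g) v ≡ act f v ⊕ act g v
  act-+ [] g v = sym (⊕-identityˡ _)
  act-+ (c ∷ f) [] v = sym (⊕-identityʳ _)
  act-+ (c ∷ f) (d ∷ g) v = trans (cong₂ _⊕_ (xor-·ᵇ c d v) (trans (cong T (act-+ f g v)) (T-additive _ _)))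
    (⊕-interchange (c ·ᵇ v) (d ·ᵇ v) _ _)

  act-≈[] : ∀ f v → f ≈ [] → act f v ≡ 𝟎
  act-≈[] [] v e = refl
  act-≈[] (c ∷ f) v e = trans (cong₂ _⊕_ (cong (_·ᵇ v) (at e 0)) (trans (cong T (act-≈[] f v (tail-≈[] e))) T-𝟎)) (⊕-self 𝟎)

  act-≈ : ∀ {f g} v → f ≈ g → act f v ≡ act g v
  act-≈ {f} {g} v e = ⊕≡𝟎⇒≡ (trans (sym (act-+ f g v)) (act-≈[] (f +ₚ g) v (≈-trans (+-cong e ≈-refl) (+-self g))))

  act-commute : ∀ (U : Vec Bool n → Vec Bool n) → Additive U → (∀ v → U (T v) ≡ T (U v)) → ∀ f v → act f (U v) ≡ U (act f v)
  act-commute U add com [] v = sym (additive-𝟎 add)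
  act-commute U add com (c ∷ f) v = trans (cong₂ _⊕_ (lemma c) (trans (cong T (act-commute U add com f v)) (sym (com _)))) (sym (add _ _))
    where
    lemma : ∀ c → c ·ᵇ U v ≡ U (c ·ᵇ v)
    lemma true = refl
    lemma false = sym (additive-𝟎 add)

  act-scale : ∀ c g v → act (scaleₚ c g) v ≡ c ·ᵇ act g v
  act-scale true g v = act-≈ v (scale-true g)
  act-scale false g v = act-≈[] (scaleₚ false g) v (scale-false g)

  act-shift : ∀ f v → act (false ∷ f) v ≡ T (act f v)
  act-shift f v = ⊕-identityˡ _

  act-* : ∀ f g v → act (f *ₚ g) v ≡ act f (act g v)
  act-* [] g v = refl
  act-* (c ∷ f) g v = trans (act-+ (scaleₚ c g) _ v) (cong₂ _⊕_ (act-scale c g v) (trans (act-shift (f *ₚ g) v) (cong T (act-* f g v))))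

  act-1 : ∀ v → act oneₚ v ≡ v
  act-1 v = trans (cong (v ⊕_) T-𝟎) (⊕-identityʳ v)

  act-comm : ∀ f g v → act f (act g v) ≡ act g (act f v)
  act-comm f g v = trans (sym (act-* f g v)) (trans (act-≈ v (*-comm f g)) (act-* g f v))

-- The field 𝔽₂[x]/(P): ring laws, Frobenius map, root bound, trace

module FiniteField {n'} (plow : Vec Bool (suc n')) (irr : Irreducible (modulusPoly plow)) where
  open Field plow

  n : ℕ
  n = suc n'

  P : Poly
  P = modulusPoly plow

  degP : Deg P n
  degP = Deg-modulus plow

  mulX-additive : Additive mulX
  mulX-additive x y = trans (mulX≡reduce plow (x ⊕ y)) (trans (lemma x y) (sym (cong₂ _⊕_ (mulX≡reduce plow x) (mulX≡reduce plow y))))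
    where
    push-⊕ : ∀ {k} c d (x y : Vec Bool k) → pushLast (c xor d) (x ⊕ y) ≡
      (proj₁ (pushLast c x) ⊕ proj₁ (pushLast d y) , proj₂ (pushLast c x) xor proj₂ (pushLast d y))
    push-⊕ c d [] [] = refl
    push-⊕ c d (a ∷ x) (b ∷ y) = cong (λ q → (c xor d) ∷ proj₁ q , proj₂ q) (push-⊕ a b x y)
    reduce-⊕ : ∀ (w w' : F) t t' → reduce plow (w ⊕ w' , t xor t') ≡ reduce plow (w , t) ⊕ reduce plow (w' , t')
    reduce-⊕ w w' false false = refl
    reduce-⊕ w w' false true = ⊕-assoc w w' plow
    reduce-⊕ w w' true false = trans (⊕-assoc w w' plow) (trans (cong (w ⊕_) (⊕-comm w' plow)) (sym (⊕-assoc w plow w')))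
    reduce-⊕ w w' true true = sym (trans (⊕-interchange w plow w' plow) (trans (cong ((w ⊕ w') ⊕_) (⊕-self plow)) (⊕-identityʳ _)))
    lemma : ∀ x y → reduce plow (pushLast false (x ⊕ y)) ≡ reduce plow (pushLast false x) ⊕ reduce plow (pushLast false y)
    lemma x y = trans (cong (reduce plow) (push-⊕ false false x y)) (reduce-⊕ (proj₁ (pushLast false x)) (proj₁ (pushLast false y)) (proj₂ (pushLast false x)) (proj₂ (pushLast false y)))

  open Action mulX mulX-additive

  infixl 7 _·_
  _·_ : F → F → F
  _·_ = _*F_

  one : F
  one = true ∷ 𝟎

  -- `act f one` is the remainder of `f` modulo P, so divisibility by P translates into equations
  -- between vectors.
  act-mod : ∀ f → P ∣ₚ f +ₚ toList (act f one)
  act-mod [] = [] , toList-𝟎 n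
  act-mod (c ∷ f) = ∣-cong ≈-refl (≈-sym eq)
    (∣-+ (∣-*ˡ (false ∷ oneₚ) (act-mod f)) (∣-*ˡ (t ∷ []) (∣-refl {P})))
    where
    open ≈-Reasoning
    r = act f one
    X = false ∷ oneₚ
    t = proj₂ (pushLast false r)
    X* : ∀ g → X *ₚ g ≈ false ∷ g
    X* g = ≈-trans (shift-* oneₚ g) (∷-cong refl (*-identityˡ g))
    const : Poly
    const = c ∷ []
    toList-c : toList (c ·ᵇ one) ≈ const
    toList-c = lemma c
      where
      lemma : ∀ c → toList (c ·ᵇ one) ≈ c ∷ []
      lemma true = ∷-cong refl (toList-𝟎 n')
      lemma false = ≈-trans (toList-𝟎 n) (≈-sym (∷-≈[] refl ≈-refl))
    M : toList (mulX r) ≈ (X *ₚ toList r) +ₚ ((t ∷ []) *ₚ P)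
    M = begin
      toList (mulX r)
        ≈⟨ ≈-reflexive (cong toList (mulX≡reduce plow r)) ⟩
      toList (reduce plow (pushLast false r))
        ≈⟨ solve 2 (λ a b → b := (a :+ b) :+ a) ≈-refl (scaleₚ t P) _ ⟩
      (scaleₚ t P +ₚ toList (reduce plow (pushLast false r))) +ₚ scaleₚ t P
        ≈⟨ +-cong (≈-trans (≈-sym (reduce-pushLast-≈ plow false r)) (≈-sym (X* (toList r)))) (≈-sym (≈-trans (+-cong (≈-refl {scaleₚ t P}) (∷-≈[] refl ≈-refl)) (+-identityʳ _))) ⟩
      (X *ₚ toList r) +ₚ ((t ∷ []) *ₚ P) ∎
    eq : (c ∷ f) +ₚ toList (act (c ∷ f) one) ≈ (X *ₚ (f +ₚ toList r)) +ₚ ((t ∷ []) *ₚ P)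
    eq = begin
      (c ∷ f) +ₚ toList ((c ·ᵇ one) ⊕ mulX r)
        ≈⟨ +-cong (≈-trans (∷-cong (sym (𝔹ₚ.xor-identityʳ c)) ≈-refl) (+-cong (≈-refl {const}) (≈-sym (X* f)))) (≈-trans (toList-⊕ (c ·ᵇ one) (mulX r)) (+-cong toList-c M)) ⟩
      (const +ₚ (X *ₚ f)) +ₚ (const +ₚ ((X *ₚ toList r) +ₚ ((t ∷ []) *ₚ P)))
        ≈⟨ solve 5 (λ k X f r z → (k :+ X :* f) :+ (k :+ (X :* r :+ z)) := X :* (f :+ r) :+ z) ≈-refl const X f (toList r) ((t ∷ []) *ₚ P) ⟩
      (X *ₚ (f +ₚ toList r)) +ₚ ((t ∷ []) *ₚ P) ∎

  P∣toList⇒𝟎 : ∀ (v : F) → P ∣ₚ toList v → v ≡ 𝟎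
  P∣toList⇒𝟎 v d with ≈[]⊎Deg (toList v)
  ... | inj₁ z = toList≈[] v z
  ... | inj₂ (m , E) with ∣-Deg d degP E
  ...   | _ , _ , s , _ with trans (sym (lead E)) (coef-toList v m (ℕₚ.≤-trans (ℕₚ.m≤m+n n _) (ℕₚ.≤-reflexive s)))
  ...     | ()

  act-one : ∀ v → act (toList v) one ≡ v
  act-one v = sym (⊕≡𝟎⇒≡ (P∣toList⇒𝟎 _ (∣-cong ≈-refl (≈-sym (toList-⊕ v _)) (act-mod (toList v)))))

  -- Every vector is a polynomial in `mulX` applied to `one`, and such polynomials commute.
  ·-comm : ∀ a b → a · b ≡ b · a
  ·-comm a b = trans (cong (act (toList a)) (sym (act-one b))) (trans (act-comm (toList a) (toList b) one) (cong (act (toList b)) (act-one a)))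

  ·-assoc : ∀ a b c → (a · b) · c ≡ a · (b · c)
  ·-assoc a b c = trans (·-comm (a · b) c) (trans (act-comm (toList c) (toList a) b) (cong (a ·_) (·-comm c b)))

  ·-distribˡ : ∀ a b c → a · (b ⊕ c) ≡ (a · b) ⊕ (a · c)
  ·-distribˡ a = act-additive (toList a)

  ·-distribʳ : ∀ a b c → (b ⊕ c) · a ≡ (b · a) ⊕ (c · a)
  ·-distribʳ a b c = trans (·-comm (b ⊕ c) a) (trans (·-distribˡ a b c) (cong₂ _⊕_ (·-comm a b) (·-comm a c)))

  ·-zeroʳ : ∀ a → a · 𝟎 ≡ 𝟎
  ·-zeroʳ a = act-𝟎 (toList a)

  ·-zeroˡ : ∀ a → 𝟎 · a ≡ 𝟎
  ·-zeroˡ a = trans (·-comm 𝟎 a) (·-zeroʳ a)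

  ·-identityʳ : ∀ a → a · one ≡ a
  ·-identityʳ = act-one

  ·-identityˡ : ∀ a → one · a ≡ a
  ·-identityˡ a = trans (·-comm one a) (act-one a)

  ·-isCommutativeMonoid : IsCommutativeMonoid _≡_ _·_ one
  ·-isCommutativeMonoid = record
    { isMonoid = record
      { isSemigroup = record
        { isMagma = record { isEquivalence = isEquivalence ; ∙-cong = cong₂ _·_ }
        ; assoc = ·-assoc }
      ; identity = ·-identityˡ , ·-identityʳ }
    ; comm = ·-comm }

  𝔽 : CommutativeSemiring _ _
  𝔽 = record
    { Carrier = F ; _≈_ = _≡_ ; _+_ = _⊕_ ; _*_ = _·_ ; 0# = 𝟎 ; 1# = one
    ; isCommutativeSemiring = isCommutativeSemiringˡ record
      { +-isCommutativeMonoid = record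
        { isMonoid = record
          { isSemigroup = record
            { isMagma = record { isEquivalence = isEquivalence ; ∙-cong = cong₂ _⊕_ }
            ; assoc = ⊕-assoc }
          ; identity = ⊕-identityˡ , ⊕-identityʳ }
        ; comm = ⊕-comm }
      ; *-isCommutativeMonoid = ·-isCommutativeMonoid
      ; distribʳ = ·-distribʳ
      ; zeroˡ = ·-zeroˡ } }

  private module FS = Char2Identities 𝔽 ⊕-self

  act-P : ∀ v → act P v ≡ 𝟎
  act-P v = trans (cong (act P) (sym (act-one v))) (trans (act-comm P (toList v) one) (trans (cong (act (toList v)) P-one) (act-𝟎 (toList v))))
    where
    P-one : act P one ≡ 𝟎
    P-one = P∣toList⇒𝟎 _ (∣-cong ≈-refl (≈-trans (≈-sym (+-assoc P P _)) (+-cong (+-self P) ≈-refl)) (∣-+ (∣-refl {P}) (act-mod P)))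

  ·≡𝟎 : ∀ a b → a · b ≡ 𝟎 → a ≡ 𝟎 ⊎ b ≡ 𝟎
  ·≡𝟎 a b e with Irreducible⇒Prime irr (toList a)
  ... | inj₁ d = inj₁ (P∣toList⇒𝟎 a d)
  ... | inj₂ (u , v , c) = inj₂ (begin
      b                                             ≡⟨ sym (act-1 b) ⟩
      act oneₚ b                                    ≡⟨ act-≈ b c ⟩
      act ((u *ₚ P) +ₚ (v *ₚ toList a)) b           ≡⟨ act-+ (u *ₚ P) (v *ₚ toList a) b ⟩
      act (u *ₚ P) b ⊕ act (v *ₚ toList a) b        ≡⟨ cong₂ _⊕_ (act-* u P b) (act-* v (toList a) b) ⟩
      act u (act P b) ⊕ act v (a · b)               ≡⟨ cong₂ _⊕_ (trans (cong (act u) (act-P b)) (act-𝟎 u)) (trans (cong (act v) e) (act-𝟎 v)) ⟩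
      𝟎 ⊕ 𝟎                                         ≡⟨ ⊕-self 𝟎 ⟩
      𝟎                                             ∎)
    where open ≡-Reasoning

  ·-cancelˡ : ∀ a {b c} → a ≢ 𝟎 → a · b ≡ a · c → b ≡ c
  ·-cancelˡ a {b} {c} na e with ·≡𝟎 a (b ⊕ c) (trans (·-distribˡ a b c) (trans (cong (_⊕ (a · c)) e) (⊕-self _)))
  ... | inj₁ z = ⊥-elim (na z)
  ... | inj₂ z = ⊕≡𝟎⇒≡ z

  one≢𝟎 : one ≢ 𝟎
  one≢𝟎 ()

  -- The Frobenius φ

  φ : F → F
  φ = sq

  φ-additive : Additive φ
  φ-additive = FS.square-+

  φ-· : ∀ x y → φ (x · y) ≡ φ x · φ y
  φ-· = FS.square-*

  φ≡𝟎 : ∀ x → φ x ≡ 𝟎 → x ≡ 𝟎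
  φ≡𝟎 x e with ·≡𝟎 x x e
  ... | inj₁ z = z
  ... | inj₂ z = z

  frob-additive : ∀ i → Additive (frob i)
  frob-additive zero x y = refl
  frob-additive (suc i) x y = trans (cong φ (frob-additive i x y)) (φ-additive (frob i x) (frob i y))

  frob-· : ∀ i x y → frob i (x · y) ≡ frob i x · frob i y
  frob-· zero x y = refl
  frob-· (suc i) x y = trans (cong φ (frob-· i x y)) (φ-· (frob i x) (frob i y))

  frob-𝟎 : ∀ i → frob i 𝟎 ≡ 𝟎
  frob-𝟎 i = additive-𝟎 (frob-additive i)

  frob≡𝟎 : ∀ i x → frob i x ≡ 𝟎 → x ≡ 𝟎
  frob≡𝟎 zero x e = e
  frob≡𝟎 (suc i) x e = frob≡𝟎 i x (φ≡𝟎 _ e)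

  frob-+ : ∀ i j x → frob (i + j) x ≡ frob i (frob j x)
  frob-+ zero j x = refl
  frob-+ (suc i) j x = cong φ (frob-+ i j x)

  frob-comm : ∀ i j x → frob i (frob j x) ≡ frob j (frob i x)
  frob-comm i j x = trans (sym (frob-+ i j x)) (trans (cong (λ k → frob k x) (ℕₚ.+-comm i j)) (frob-+ j i x))

  private module ∏ = Sum ·-isCommutativeMonoid

  -- A product of 2^k equal factors is formed along a binary tree, that is, by squaring k times.
  ∏-const : ∀ k a → ∏.∑ {k} (λ _ → a) ≡ frob k a
  ∏-const zero a = refl
  ∏-const (suc k) a = trans (∏-const k (φ a)) (frob-comm k 1 a)

  ∏-≢𝟎 : ∀ k (g : Vec Bool k → F) → (∀ x → g x ≢ 𝟎) → ∏.∑ g ≢ 𝟎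
  ∏-≢𝟎 zero g ng = ng []
  ∏-≢𝟎 (suc k) g ng = ∏-≢𝟎 k _ λ v e → lemma v (·≡𝟎 (g (false ∷ v)) (g (true ∷ v)) e)
    where
    lemma : ∀ v → ¬ (g (false ∷ v) ≡ 𝟎 ⊎ g (true ∷ v) ≡ 𝟎)
    lemma v (inj₁ e) = ng _ e
    lemma v (inj₂ e) = ng _ e

  ·-surjective : ∀ a → a ≢ 𝟎 → ∀ y → ∃ λ x → a · x ≡ y
  ·-surjective a na = injective⇒surjective (a ·_) (·-cancelˡ a na)

  -- Fermat: multiplying all nonzero elements by a permutes them.
  frob-n : ∀ a → frob n a ≡ a
  frob-n a with a ≟ᵛ 𝟎
  ... | yes refl = frob-𝟎 n
  ... | no na = begin
      frob n a                    ≡⟨ sym (∏-const n a) ⟩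
      ∏.∑ {n} (λ x → a)           ≡⟨ ∏.∑-cong (λ x → sym (kk' x)) ⟩
      ∏.∑ (λ x → k x · k' x)      ≡⟨ ∏.∑-∙ k k' ⟩
      ∏.∑ k · ∏.∑ k'              ≡⟨ cong₂ _·_ ∏k ∏k' ⟩
      one · a                     ≡⟨ ·-identityˡ a ⟩
      a                           ∎
    where
    open ≡-Reasoning
    -- Products over all vectors would vanish at 0. So `g` is x with 0 replaced by 1, and the
    -- constant a is split as k x · k' x, where `k'` takes over its value at 0. Then a^{2^n} = ∏ k ·
    -- a, and ∏ k = 1 because multiplication by a permutes the factors of ∏ g.
    g k k' : F → F
    g x = if does (x ≟ᵛ 𝟎) then one else x
    k x = if does (x ≟ᵛ 𝟎) then one else a
    k' x = if does (x ≟ᵛ 𝟎) then a else one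
    kk' : ∀ x → k x · k' x ≡ a
    kk' x with x ≟ᵛ 𝟎
    ... | yes _ = ·-identityˡ a
    ... | no _ = ·-identityʳ a
    g-· : ∀ x → g (a · x) ≡ k x · g x
    g-· x with x ≟ᵛ 𝟎 | (a · x) ≟ᵛ 𝟎
    ... | yes p | yes q = sym (·-identityˡ one)
    ... | yes p | no q = ⊥-elim (q (trans (cong (a ·_) p) (·-zeroʳ a)))
    ... | no p | no q = refl
    ... | no p | yes q with ·≡𝟎 a x q
    ...   | inj₁ z = ⊥-elim (na z)
    ...   | inj₂ z = ⊥-elim (p z)
    g≢𝟎 : ∀ x → g x ≢ 𝟎
    g≢𝟎 x e with x ≟ᵛ 𝟎
    ... | yes _ = one≢𝟎 e
    ... | no p = p e
    ∏k' : ∏.∑ k' ≡ a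
    ∏k' = trans (∏.∑-single k' 𝟎 off) on
      where
      off : ∀ x → x ≢ 𝟎 → k' x ≡ one
      off x ne with x ≟ᵛ 𝟎
      ... | yes p = ⊥-elim (ne p)
      ... | no _ = refl
      on : k' 𝟎 ≡ a
      on = if-yes (𝟎 {n} ≟ᵛ 𝟎) refl
    inv : F → F
    inv y = proj₁ (·-surjective a na y)
    a·inv : ∀ y → a · inv y ≡ y
    a·inv y = proj₂ (·-surjective a na y)
    ∏k : ∏.∑ k ≡ one
    ∏k = ·-cancelˡ (∏.∑ g) (∏-≢𝟎 n g g≢𝟎) (begin
      ∏.∑ g · ∏.∑ k              ≡⟨ ·-comm (∏.∑ g) (∏.∑ k) ⟩
      ∏.∑ k · ∏.∑ g              ≡⟨ sym (∏.∑-∙ k g) ⟩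
      ∏.∑ (λ x → k x · g x)      ≡⟨ ∏.∑-cong (λ x → sym (g-· x)) ⟩
      ∏.∑ (λ x → g (a · x))      ≡⟨ ∏.∑-reindex (a ·_) inv (λ x → ·-cancelˡ a na (a·inv (a · x))) a·inv g ⟩
      ∏.∑ g                      ≡⟨ sym (·-identityʳ _) ⟩
      ∏.∑ g · one                ∎)

  -- Skew polynomials Σ cᵢ φⁱ: a root v ≠ 0 splits off the right factor φ + v.

  skew : ∀ {k} → Vec F k → F → F
  skew [] x = 𝟎
  skew (c ∷ cs) x = c · x ⊕ skew cs (φ x)

  skew-divide : ∀ {k} (cs : Vec F (suc k)) v → ∃₂ λ (ds : Vec F k) r → ∀ x → skew cs x ≡ skew ds (φ x ⊕ v · x) ⊕ r · x
  skew-divide {zero} (c ∷ []) v = [] , c , λ x → trans (⊕-identityʳ (c · x)) (sym (⊕-identityˡ (c · x)))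
  -- The tail acts on `φ x`, and φ(φ x) + φ(v) φ(x) = φ(φ x + v x); hence the tail has to be divided
  -- by φ + φ(v).
  skew-divide {suc k} (c ∷ cs) v with skew-divide cs (φ v)
  ... | ds , r , e = (r ∷ ds) , c ⊕ r · v , λ x → begin
      c · x ⊕ skew cs (φ x)
        ≡⟨ cong (c · x ⊕_) (e (φ x)) ⟩
      c · x ⊕ (skew ds (φ (φ x) ⊕ φ v · φ x) ⊕ r · φ x)
        ≡⟨ cong (λ z → c · x ⊕ (skew ds z ⊕ r · φ x)) (sym (trans (φ-additive (φ x) (v · x)) (cong (φ (φ x) ⊕_) (φ-· v x)))) ⟩
      c · x ⊕ (skew ds (φ (φ x ⊕ v · x)) ⊕ r · φ x)
        ≡⟨ FS.skew-step c x (skew ds (φ (φ x ⊕ v · x))) r v (φ x) ⟩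
      (r · (φ x ⊕ v · x) ⊕ skew ds (φ (φ x ⊕ v · x))) ⊕ (c ⊕ r · v) · x ∎
    where open ≡-Reasoning

  skew-divide-last : ∀ {k} (cs : Vec F (suc (suc k))) v → V.last (proj₁ (skew-divide cs v)) ≡ V.last cs
  skew-divide-last {zero} (c ∷ d ∷ []) v = refl
  skew-divide-last {suc k} (c ∷ c' ∷ cs) v = skew-divide-last (c' ∷ cs) (φ v)

  -- If there is a nonzero root v, evaluation at v shows that the remainder r vanishes, and the
  -- right factor `ψ` = φ + v sends x to x(x + v), with kernel inside 0 and v. Each degree thus at
  -- most doubles the kernel.
  skew-kernel : ∀ k (cs : Vec F (suc k)) → V.last cs ≢ 𝟎 → ∣ker skew cs ∣ ≤ 2 ^ k
  skew-kernel k cs top with search (λ v → v ≢ 𝟎 × skew cs v ≡ 𝟎) dec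
    where
    dec : ∀ v → Dec (v ≢ 𝟎 × skew cs v ≡ 𝟎)
    dec v with v ≟ᵛ 𝟎 | skew cs v ≟ᵛ 𝟎
    ... | yes p | _ = no (λ q → proj₁ q p)
    ... | no p | yes q = yes (p , q)
    ... | no p | no q = no (λ r → q (proj₂ r))
  ... | inj₂ none = ℕₚ.≤-trans (∑-mono (λ x → []-mono (skew cs x ≟ᵛ 𝟎) (x ≟ᵛ 𝟎) (trivial x)))
        (ℕₚ.≤-trans (ℕₚ.≤-reflexive (∑-δ (𝟎 {n}))) (ℕₚ.m^n>0 2 k))
    where
    trivial : ∀ x → skew cs x ≡ 𝟎 → x ≡ 𝟎
    trivial x e with x ≟ᵛ 𝟎
    ... | yes p = p
    ... | no p = ⊥-elim (none x (p , e))
  skew-kernel zero (c ∷ []) top | inj₁ (v , nv , e) with ·≡𝟎 c v (trans (sym (⊕-identityʳ (c · v))) e)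
  ... | inj₁ z = ⊥-elim (top z)
  ... | inj₂ z = ⊥-elim (nv z)
  skew-kernel (suc k) cs top | inj₁ (v , nv , e) = begin
      ∣ker skew cs ∣
        ≤⟨ ∣ker∣-mono (skew cs) (λ x → skew ds (ψ x)) (λ x p → trans (sym (factor x)) p) ⟩
      ∣ker (λ x → skew ds (ψ x)) ∣
        ≤⟨ ∣ker-∘∣ (skew ds) ψ ψ-additive ⟩
      ∣ker skew ds ∣ * ∣ker ψ ∣
        ≤⟨ ℕₚ.*-mono-≤ (skew-kernel k ds (λ z → top (trans (sym (skew-divide-last cs v)) z))) kerψ ⟩
      2 ^ k * 2
        ≡⟨ ℕₚ.*-comm (2 ^ k) 2 ⟩
      2 ^ suc k ∎
    where
    open ℕₚ.≤-Reasoning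
    ds = proj₁ (skew-divide cs v)
    r = proj₁ (proj₂ (skew-divide cs v))
    ψ : F → F
    ψ x = φ x ⊕ v · x
    ψ-additive : Additive ψ
    ψ-additive = FS.square+scale-+ v
    skew-𝟎 : ∀ {j} (es : Vec F j) → skew es 𝟎 ≡ 𝟎
    skew-𝟎 [] = refl
    skew-𝟎 (c ∷ es) = trans (cong₂ _⊕_ (·-zeroʳ c) (trans (cong (skew es) (frob-𝟎 1)) (skew-𝟎 es))) (⊕-self (𝟎 {n}))
    r≡𝟎 : r ≡ 𝟎
    r≡𝟎 with ·≡𝟎 r v (trans (sym (trans (cong (_⊕ r · v) (trans (cong (skew ds) (⊕-self (φ v))) (skew-𝟎 ds))) (⊕-identityˡ _)))
                   (trans (sym (proj₂ (proj₂ (skew-divide cs v)) v)) e))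
    ... | inj₁ z = z
    ... | inj₂ z = ⊥-elim (nv z)
    factor : ∀ x → skew cs x ≡ skew ds (ψ x)
    factor x = trans (proj₂ (proj₂ (skew-divide cs v)) x) (trans (cong (λ z → skew ds (ψ x) ⊕ z · x) r≡𝟎)
      (trans (cong (skew ds (ψ x) ⊕_) (·-zeroˡ x)) (⊕-identityʳ _)))
    roots : ∀ x → ψ x ≡ 𝟎 → x ≡ 𝟎 ⊎ x ≡ v
    roots x p with ·≡𝟎 x (x ⊕ v) (trans (·-distribˡ x x v) (trans (cong (φ x ⊕_) (·-comm x v)) p))
    ... | inj₁ z = inj₁ z
    ... | inj₂ z = inj₂ (⊕≡𝟎⇒≡ z)
    bound : ∀ x → [ does (ψ x ≟ᵛ 𝟎) ] ≤ [ does (x ≟ᵛ 𝟎) ] + [ does (x ≟ᵛ v) ]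
    bound x with ψ x ≟ᵛ 𝟎
    ... | no _ = z≤n
    ... | yes p with roots x p
    ...   | inj₁ z = ℕₚ.≤-trans (ℕₚ.≤-reflexive (sym ([]-yes (x ≟ᵛ 𝟎) z))) (ℕₚ.m≤m+n _ _)
    ...   | inj₂ z = ℕₚ.≤-trans (ℕₚ.≤-reflexive (sym ([]-yes (x ≟ᵛ v) z))) (ℕₚ.m≤n+m _ [ does (x ≟ᵛ 𝟎) ])
    kerψ : ∣ker ψ ∣ ≤ 2
    kerψ = ℕₚ.≤-trans (∑-mono bound) (ℕₚ.≤-reflexive (trans (∑-∙ (λ x → [ does (x ≟ᵛ 𝟎) ]) (λ x → [ does (x ≟ᵛ v) ]))
      (cong₂ _+_ (∑-δ (𝟎 {n})) (∑-δ v))))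

  module Aφ = Action φ φ-additive

  ·ᵇ-one : ∀ c x → (c ·ᵇ one) · x ≡ c ·ᵇ x
  ·ᵇ-one true x = ·-identityˡ x
  ·ᵇ-one false x = ·-zeroˡ x

  act-skew : ∀ {k} (v : Vec Bool k) x → Aφ.act (toList v) x ≡ skew (V.map (_·ᵇ one) v) x
  act-skew [] x = refl
  act-skew (c ∷ v) x = cong₂ _⊕_ (sym (·ᵇ-one c x)) (trans (sym (Aφ.act-commute φ φ-additive (λ _ → refl) (toList v) x)) (act-skew v (φ x)))

  φ-kernel : ∀ {f d} → Deg f d → ∣ker Aφ.act f ∣ ≤ 2 ^ d
  φ-kernel {f} {d} D = ℕₚ.≤-trans
    (∣ker∣-mono (Aφ.act f) (skew (V.map (_·ᵇ one) v)) (λ x p → trans (sym (act-skew v x)) (trans (Aφ.act-≈ x v≈) p)))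
    (skew-kernel d _ (λ z → one≢𝟎 (trans (sym (trans (last-map v) (cong (_·ᵇ one) v-last))) z)))
    where
    v : Vec Bool (suc d)
    v = trunc (suc d) f
    v≈ : toList v ≈ f
    v≈ = toList-trunc (suc d) f (above D)
    last-coef : ∀ {k} (u : Vec Bool (suc k)) → V.last u ≡ coef (toList u) k
    last-coef (c ∷ []) = refl
    last-coef (c ∷ d ∷ u) = last-coef (d ∷ u)
    last-map : ∀ {k} (u : Vec Bool (suc k)) → V.last (V.map (_·ᵇ one) u) ≡ (V.last u) ·ᵇ one
    last-map (c ∷ []) = refl
    last-map (c ∷ d ∷ u) = last-map (d ∷ u)
    v-last : V.last v ≡ true
    v-last = trans (last-coef v) (trans (at v≈ d) (lead D))

  -- Traces

  trace-suc : ∀ k y → traceTo (suc k) y ≡ traceTo k y ⊕ frob k y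
  trace-suc k y = trans (cong (λ l → sumF (map (λ i → frob i y) l)) (sym (Lₚ.upTo-∷ʳ k)))
    (trans (cong sumF (Lₚ.map-++ (λ i → frob i y) (upTo k) _)) (trans (sum-++ (map (λ i → frob i y) (upTo k)) (frob k y ∷ [])) (cong (traceTo k y ⊕_) (⊕-identityʳ (frob k y)))))
    where
    sum-++ : ∀ l l' → sumF (l ++ l') ≡ sumF l ⊕ sumF l'
    sum-++ [] l' = sym (⊕-identityˡ _)
    sum-++ (a ∷ l) l' = trans (cong (a ⊕_) (sum-++ l l')) (sym (⊕-assoc a _ _))

  trace-additive : ∀ k → Additive (traceTo k)
  trace-additive zero x y = sym (⊕-self 𝟎)
  trace-additive (suc k) x y = trans (trace-suc k (x ⊕ y)) (trans (cong₂ _⊕_ (trace-additive k x y) (frob-additive k x y))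
    (trans (⊕-interchange (traceTo k x) (traceTo k y) (frob k x) (frob k y)) (sym (cong₂ _⊕_ (trace-suc k x) (trace-suc k y)))))

  trace-φ : ∀ k y → traceTo k (φ y) ≡ φ (traceTo k y)
  trace-φ zero y = sym (frob-𝟎 1)
  trace-φ (suc k) y = trans (trace-suc k (φ y)) (trans (cong₂ _⊕_ (trace-φ k y) (frob-comm k 1 y)) (trans (sym (φ-additive (traceTo k y) (frob k y))) (cong φ (sym (trace-suc k y)))))

  trace-suc′ : ∀ k y → traceTo (suc k) y ≡ y ⊕ traceTo k (φ y)
  trace-suc′ zero y = refl
  trace-suc′ (suc k) y = trans (trace-suc (suc k) y) (trans (cong (_⊕ frob (suc k) y) (trace-suc′ k y)) (trans (⊕-assoc y _ _)
    (cong (y ⊕_) (trans (cong (traceTo k (φ y) ⊕_) (frob-comm 1 k y)) (sym (trace-suc k (φ y)))))))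

  -- `trace-suc` and `trace-suc′` expand the same sum of k + 1 terms at either end. A general k
  -- covers the half trace as well, on elements fixed by φ^k.
  trace-invariant : ∀ k y → frob k y ≡ y → traceTo k (φ y) ≡ traceTo k y
  trace-invariant k y e = ⊕≡𝟎⇒≡ (begin
      traceTo k (φ y) ⊕ traceTo k y
        ≡⟨ sym (⊕-cancel _ y) ⟩
      ((traceTo k (φ y) ⊕ traceTo k y) ⊕ y) ⊕ y
        ≡⟨ FS.+-regroup (traceTo k (φ y)) (traceTo k y) y ⟩
      (y ⊕ traceTo k (φ y)) ⊕ (traceTo k y ⊕ y)
        ≡⟨ cong₂ _⊕_ (sym (trace-suc′ k y)) (trans (cong (traceTo k y ⊕_) (sym e)) (sym (trace-suc k y))) ⟩
      traceTo (suc k) y ⊕ traceTo (suc k) y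
        ≡⟨ ⊕-self _ ⟩
      𝟎 ∎)
    where open ≡-Reasoning

  trace-frob : ∀ k i y → frob k y ≡ y → traceTo k (frob i y) ≡ traceTo k y
  trace-frob k zero y e = refl
  trace-frob k (suc i) y e = trans (trace-invariant k (frob i y) (trans (frob-comm k i y) (cong (frob i) e))) (trace-frob k i y e)

  trace-+ : ∀ a b y → traceTo (a + b) y ≡ traceTo a y ⊕ traceTo b (frob a y)
  trace-+ a zero y = trans (cong (λ k → traceTo k y) (ℕₚ.+-identityʳ a)) (sym (⊕-identityʳ _))
  trace-+ a (suc b) y = trans (cong (λ k → traceTo k y) (ℕₚ.+-suc a b)) (trans (trace-suc (a + b) y)
    (trans (cong₂ _⊕_ (trace-+ a b y) (trans (cong (λ k → frob k y) (ℕₚ.+-comm a b)) (frob-+ b a y)))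
      (trans (⊕-assoc (traceTo a y) _ _) (cong (traceTo a y ⊕_) (sym (trace-suc b (frob a y)))))))

  -- `toBit` is the disjunction of all coordinates; it is additive on these two elements, but not on
  -- the whole field.
  IsBit : F → Set
  IsBit x = x ≡ 𝟎 ⊎ x ≡ one

  φ-fixed⇒IsBit : ∀ x → φ x ≡ x → IsBit x
  φ-fixed⇒IsBit x e with ·≡𝟎 x (x ⊕ one) (trans (·-distribˡ x x one) (trans (cong₂ _⊕_ e (·-identityʳ x)) (⊕-self x)))
  ... | inj₁ z = inj₁ z
  ... | inj₂ z = inj₂ (⊕≡𝟎⇒≡ z)

  trace-IsBit : ∀ k y → frob k y ≡ y → IsBit (traceTo k y)
  trace-IsBit k y e = φ-fixed⇒IsBit _ (trans (sym (trace-φ k y)) (trace-invariant k y e))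

  toBit-𝟎 : toBit 𝟎 ≡ false
  toBit-𝟎 = go n
    where
    go : ∀ k → foldr _∨_ false (toList (𝟎 {k})) ≡ false
    go zero = refl
    go (suc k) = go k

  toBit-bit : ∀ {x y} b → x ≡ y → toBit y ≡ b → toBit x ≡ b
  toBit-bit b e e' = trans (cong toBit e) e'

  toBit-one : toBit one ≡ true
  toBit-one = refl

  IsBit-⊕ : ∀ {x y} → IsBit x → IsBit y → IsBit (x ⊕ y)
  IsBit-⊕ (inj₁ p) (inj₁ q) = inj₁ (trans (cong₂ _⊕_ p q) (⊕-self (𝟎 {n})))
  IsBit-⊕ (inj₁ p) (inj₂ q) = inj₂ (trans (cong₂ _⊕_ p q) (⊕-identityˡ one))
  IsBit-⊕ (inj₂ p) (inj₁ q) = inj₂ (trans (cong₂ _⊕_ p q) (⊕-identityʳ one))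
  IsBit-⊕ (inj₂ p) (inj₂ q) = inj₁ (trans (cong₂ _⊕_ p q) (⊕-self one))

  toBit-⊕ : ∀ {x y} → IsBit x → IsBit y → toBit (x ⊕ y) ≡ toBit x xor toBit y
  toBit-⊕ (inj₁ p) (inj₁ q) = trans (toBit-bit false (trans (cong₂ _⊕_ p q) (⊕-self (𝟎 {n}))) toBit-𝟎)
    (sym (cong₂ _xor_ (toBit-bit false p toBit-𝟎) (toBit-bit false q toBit-𝟎)))
  toBit-⊕ (inj₁ p) (inj₂ q) = trans (toBit-bit true (trans (cong₂ _⊕_ p q) (⊕-identityˡ one)) toBit-one)
    (sym (cong₂ _xor_ (toBit-bit false p toBit-𝟎) (toBit-bit true q toBit-one)))
  toBit-⊕ (inj₂ p) (inj₁ q) = trans (toBit-bit true (trans (cong₂ _⊕_ p q) (⊕-identityʳ one)) toBit-one)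
    (sym (cong₂ _xor_ (toBit-bit true p toBit-one) (toBit-bit false q toBit-𝟎)))
  toBit-⊕ (inj₂ p) (inj₂ q) = trans (toBit-bit false (trans (cong₂ _⊕_ p q) (⊕-self one)) toBit-𝟎)
    (sym (cong₂ _xor_ (toBit-bit true p toBit-one) (toBit-bit true q toBit-one)))

  tr : F → Bool
  tr x = toBit (Trₙ x)

  Tr-IsBit : ∀ x → IsBit (Trₙ x)
  Tr-IsBit x = trace-IsBit n x (frob-n x)

  tr-⊕ : ∀ x y → tr (x ⊕ y) ≡ tr x xor tr y
  tr-⊕ x y = trans (cong toBit (trace-additive n x y)) (toBit-⊕ (Tr-IsBit x) (Tr-IsBit y))

  IsBit-false : ∀ {y} → IsBit y → toBit y ≡ false → y ≡ 𝟎
  IsBit-false (inj₁ z) e = z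
  IsBit-false (inj₂ z) e = ⊥-elim (true≢false (trans (sym (toBit-bit true z toBit-one)) e))
    where
    true≢false : true ≢ false
    true≢false ()

  tr≡false : ∀ x → tr x ≡ false → Trₙ x ≡ 𝟎
  tr≡false x e = IsBit-false (Tr-IsBit x) e

  trace-skew : ∀ k x → traceTo k x ≡ skew (V.replicate k one) x
  trace-skew zero x = refl
  trace-skew (suc k) x = trans (trace-suc′ k x) (cong₂ _⊕_ (sym (·-identityˡ x)) (trace-skew k (φ x)))

  ∣ker∣-full : ∀ {m} (g : F → Vec Bool m) → (∀ x → g x ≡ 𝟎) → ∣ker g ∣ ≡ 2 ^ n
  ∣ker∣-full g e = trans (∑-cong (λ x → []-yes (g x ≟ᵛ 𝟎) (e x))) (trans (∑-const n 1) (ℕₚ.*-identityʳ _))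

  -- For b ≠ 0 the products b · x exhaust the field, so the trace would vanish identically; as a
  -- skew polynomial of degree n - 1 it has at most 2^{n-1} roots.
  tr-nondegenerate : ∀ b → (∀ x → tr (b · x) ≡ false) → b ≡ 𝟎
  tr-nondegenerate b h with b ≟ᵛ 𝟎
  ... | yes z = z
  ... | no nb = ⊥-elim (ℕₚ.<-irrefl refl (ℕₚ.<-≤-trans (ℕₚ.^-monoʳ-< 2 ℕₚ.≤-refl (ℕₚ.n<1+n n'))
      (ℕₚ.≤-trans (ℕₚ.≤-reflexive (sym (∣ker∣-full Trₙ all𝟎)))
        (ℕₚ.≤-trans (∣ker∣-mono Trₙ (skew (V.replicate n one)) (λ x p → trans (sym (trace-skew n x)) p))
          (skew-kernel n' (V.replicate n one) (λ z → one≢𝟎 (trans (sym (last-replicate n')) z)))))))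
    where
    all𝟎 : ∀ y → Trₙ y ≡ 𝟎
    all𝟎 y = trans (cong Trₙ (sym (proj₂ (·-surjective b nb y)))) (tr≡false _ (h (proj₁ (·-surjective b nb y))))
    last-replicate : ∀ k → V.last (V.replicate (suc k) one) ≡ one
    last-replicate zero = refl
    last-replicate (suc k) = last-replicate k

-- Homogenised substitution

xpow : ℕ → Poly
xpow N = replicate N false ++ (true ∷ [])

X Y : Poly
X = false ∷ true ∷ []
Y = true ∷ false ∷ true ∷ []

X* : ∀ f → X *ₚ f ≈ false ∷ f
X* f = ≈-trans (shift-* oneₚ f) (∷-cong refl (*-identityˡ f))

∷-split : ∀ c f → c ∷ f ≈ (c ∷ []) +ₚ (X *ₚ f)
∷-split c f = ≈-trans (∷-cong (sym (𝔹ₚ.xor-identityʳ c)) ≈-refl) (+-cong (≈-refl {c ∷ []}) (≈-sym (X* f)))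

xpow-+ : ∀ N M → xpow (N + M) ≈ xpow N *ₚ xpow M
xpow-+ zero M = ≈-sym (*-identityˡ (xpow M))
xpow-+ (suc N) M = ≈-trans (∷-cong refl (xpow-+ N M)) (≈-sym (shift-* (xpow N) (xpow M)))

scale-const : ∀ c f → scaleₚ c f ≈ (c ∷ []) *ₚ f
scale-const c f = ≈-sym (≈-trans (+-cong (≈-refl {scaleₚ c f}) (∷-≈[] refl ≈-refl)) (+-identityʳ _))

record Bounded (s : Poly) (N : ℕ) : Set where
  constructor bdd
  field high : ∀ i → N < i → coef s i ≡ false
open Bounded

Bounded-tail : ∀ {c s N} → Bounded (c ∷ s) (suc N) → Bounded s N
Bounded-tail b = bdd λ i p → high b (suc i) (s≤s p)

Bounded-tail₀ : ∀ {c s} → Bounded (c ∷ s) 0 → s ≈ []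
Bounded-tail₀ b = mk λ i → high b (suc i) (s≤s z≤n)

Bounded-+ : ∀ {f g N} → Bounded f N → Bounded g N → Bounded (f +ₚ g) N
Bounded-+ {f} {g} b b' = bdd λ i p → trans (coef-+ f g i) (cong₂ _xor_ (high b i p) (high b' i p))

Bounded-scale : ∀ c {f N} → Bounded f N → Bounded (scaleₚ c f) N
Bounded-scale c {f} b = bdd λ i p → trans (coef-scale c f i) (trans (cong (c ∧_) (high b i p)) (𝔹ₚ.∧-zeroʳ c))

Bounded-mono : ∀ {f N M} → N ≤ M → Bounded f N → Bounded f M
Bounded-mono le b = bdd λ i p → high b i (ℕₚ.≤-<-trans le p)

Bounded-cong : ∀ {f g N} → f ≈ g → Bounded f N → Bounded g N
Bounded-cong e b = bdd λ i p → trans (sym (at e i)) (high b i p)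

Bounded-∷ : ∀ {f N} c → Bounded f N → Bounded (c ∷ f) (suc N)
Bounded-∷ c b = bdd λ { (suc i) (s≤s p) → high b i p }

Deg⇒Bounded : ∀ {f N} → Deg f N → Bounded f N
Deg⇒Bounded D = bdd (above D)

Deg-xpow : ∀ N → Deg (xpow N) N
Deg-xpow zero = Deg-1
Deg-xpow (suc N) = Deg-∷ false (Deg-xpow N)

-- hom y N s = x^N s(y/x); y = x² + 1 expands s(x + 1/x), and y = 1 reverses coefficients.
hom : Poly → ℕ → Poly → Poly
hom y N [] = []
hom y zero (c ∷ s) = scaleₚ c (xpow 0)
hom y (suc N) (c ∷ s) = scaleₚ c (xpow (suc N)) +ₚ (y *ₚ hom y N s)

module _ (y : Poly) where

  hom-≈[] : ∀ N {s} → s ≈ [] → hom y N s ≈ []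
  hom-≈[] N {[]} e = ≈-refl
  hom-≈[] zero {c ∷ s} e = ≈-trans (≈-reflexive (cong (λ c → scaleₚ c (xpow 0)) (at e 0))) (scale-false (xpow 0))
  hom-≈[] (suc N) {c ∷ s} e = ≈-trans (+-cong (≈-trans (≈-reflexive (cong (λ c → scaleₚ c (xpow (suc N))) (at e 0))) (scale-false (xpow (suc N))))
    (≈-trans (*-congˡ y (hom-≈[] N (tail-≈[] e))) (*-zeroʳ y))) ≈-refl

  hom-+ : ∀ N s s' → hom y N (s +ₚ s') ≈ hom y N s +ₚ hom y N s'
  hom-+ N [] s' = ≈-refl
  hom-+ N (c ∷ s) [] = ≈-sym (+-identityʳ _)
  hom-+ zero (c ∷ s) (d ∷ s') = scale-xor c d (xpow 0)
  hom-+ (suc N) (c ∷ s) (d ∷ s') = ≈-trans (+-cong (scale-xor c d x) (*-congˡ y (hom-+ N s s')))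
    (solve 5 (λ a b y h h' → (a :+ b) :+ y :* (h :+ h') := (a :+ y :* h) :+ (b :+ y :* h')) ≈-refl (scaleₚ c x) (scaleₚ d x) y (hom y N s) (hom y N s'))
    where x = xpow (suc N)

  hom-cong : ∀ N {s s'} → s ≈ s' → hom y N s ≈ hom y N s'
  hom-cong N {s} {s'} e = ≈-+⇒ (≈-trans (≈-sym (hom-+ N s s')) (hom-≈[] N (≈-trans (+-cong e ≈-refl) (+-self s'))))

  hom-scale : ∀ N c s → hom y N (scaleₚ c s) ≈ scaleₚ c (hom y N s)
  hom-scale N true s = ≈-trans (hom-cong N (scale-true s)) (≈-sym (scale-true _))
  hom-scale N false s = ≈-trans (hom-≈[] N (scale-false s)) (≈-sym (scale-false _))

  hom-const : ∀ N c → hom y N (c ∷ []) ≈ scaleₚ c (xpow N)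
  hom-const zero c = ≈-refl
  hom-const (suc N) c = ≈-trans (+-cong (≈-refl {scaleₚ c (xpow (suc N))}) (*-zeroʳ y)) (+-identityʳ (scaleₚ c (xpow (suc N))))

  hom-raise : ∀ M N s → Bounded s N → hom y (M + N) s ≈ xpow M *ₚ hom y N s
  hom-raise M N [] b = ≈-sym (*-zeroʳ (xpow M))
  hom-raise M zero (c ∷ s) b = begin
      hom y (M + 0) (c ∷ s)             ≈⟨ hom-cong (M + 0) (∷-cong refl (Bounded-tail₀ {c} b)) ⟩
      hom y (M + 0) (c ∷ [])            ≈⟨ ≈-reflexive (cong (λ k → hom y k (c ∷ [])) (ℕₚ.+-identityʳ M)) ⟩
      hom y M (c ∷ [])                  ≈⟨ hom-const M c ⟩
      scaleₚ c (xpow M)                 ≈⟨ scale-const c (xpow M) ⟩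
      (c ∷ []) *ₚ xpow M                ≈⟨ *-comm (c ∷ []) (xpow M) ⟩
      xpow M *ₚ (c ∷ [])                ≈⟨ *-congˡ (xpow M) (∷-cong (sym (𝔹ₚ.∧-identityʳ c)) ≈-refl) ⟩
      xpow M *ₚ scaleₚ c (xpow 0)       ∎
    where open ≈-Reasoning
  hom-raise M (suc N) (c ∷ s) b = begin
      hom y (M + suc N) (c ∷ s)
        ≈⟨ ≈-reflexive (cong (λ k → hom y k (c ∷ s)) (ℕₚ.+-suc M N)) ⟩
      scaleₚ c (xpow (suc (M + N))) +ₚ (y *ₚ hom y (M + N) s)
        ≈⟨ +-cong (≈-trans (scale-cong c (≈-trans (≈-reflexive (cong xpow (sym (ℕₚ.+-suc M N)))) (xpow-+ M (suc N)))) (scale-const c _)) (*-congˡ y (hom-raise M N s (Bounded-tail {c} b))) ⟩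
      ((c ∷ []) *ₚ (xpow M *ₚ xpow (suc N))) +ₚ (y *ₚ (xpow M *ₚ hom y N s))
        ≈⟨ solve 5 (λ c m n y h → c :* (m :* n) :+ y :* (m :* h) := m :* (c :* n :+ y :* h)) ≈-refl (c ∷ []) (xpow M) (xpow (suc N)) y (hom y N s) ⟩
      xpow M *ₚ (((c ∷ []) *ₚ xpow (suc N)) +ₚ (y *ₚ hom y N s))
        ≈⟨ *-congˡ (xpow M) (+-cong (≈-sym (scale-const c (xpow (suc N)))) (≈-refl {y *ₚ hom y N s})) ⟩
      xpow M *ₚ hom y (suc N) (c ∷ s) ∎
    where open ≈-Reasoning

  hom-* : ∀ N M a b → Bounded a N → Bounded b M → hom y (N + M) (a *ₚ b) ≈ hom y N a *ₚ hom y M b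
  hom-* N M [] b ba bb = ≈-refl
  hom-* zero M (c ∷ a) b ba bb = begin
      hom y M ((c ∷ a) *ₚ b)            ≈⟨ hom-cong M (*-cong {c ∷ a} {c ∷ []} {b} (∷-cong refl (Bounded-tail₀ {c} ba)) ≈-refl) ⟩
      hom y M ((c ∷ []) *ₚ b)           ≈⟨ hom-cong M (≈-sym (scale-const c b)) ⟩
      hom y M (scaleₚ c b)              ≈⟨ hom-scale M c b ⟩
      scaleₚ c (hom y M b)              ≈⟨ scale-const c (hom y M b) ⟩
      (c ∷ []) *ₚ hom y M b             ≈⟨ *-cong {c ∷ []} {scaleₚ c (xpow 0)} {hom y M b} (∷-cong (sym (𝔹ₚ.∧-identityʳ c)) ≈-refl) ≈-refl ⟩
      scaleₚ c (xpow 0) *ₚ hom y M b    ∎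
    where open ≈-Reasoning
  hom-* (suc N) M (c ∷ a) b ba bb = begin
      hom y (suc N + M) (scaleₚ c b +ₚ (false ∷ (a *ₚ b)))
        ≈⟨ hom-+ (suc N + M) (scaleₚ c b) _ ⟩
      hom y (suc N + M) (scaleₚ c b) +ₚ (scaleₚ false (xpow (suc (N + M))) +ₚ (y *ₚ hom y (N + M) (a *ₚ b)))
        ≈⟨ +-cong (≈-trans (hom-scale (suc N + M) c b) (≈-trans (scale-cong c (hom-raise (suc N) M b bb)) (scale-const c _)))
             (+-cong (scale-false (xpow (suc (N + M)))) (*-congˡ y (hom-* N M a b (Bounded-tail {c} ba) bb))) ⟩
      ((c ∷ []) *ₚ (xpow (suc N) *ₚ hom y M b)) +ₚ (y *ₚ (hom y N a *ₚ hom y M b))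
        ≈⟨ solve 5 (λ c x h y k → c :* (x :* h) :+ y :* (k :* h) := (c :* x :+ y :* k) :* h) ≈-refl (c ∷ []) (xpow (suc N)) (hom y M b) y (hom y N a) ⟩
      (((c ∷ []) *ₚ xpow (suc N)) +ₚ (y *ₚ hom y N a)) *ₚ hom y M b
        ≈⟨ *-cong {((c ∷ []) *ₚ xpow (suc N)) +ₚ (y *ₚ hom y N a)} (+-cong (≈-sym (scale-const c (xpow (suc N)))) (≈-refl {y *ₚ hom y N a})) (≈-refl {hom y M b}) ⟩
      hom y (suc N) (c ∷ a) *ₚ hom y M b ∎
    where open ≈-Reasoning

H : ℕ → Poly → Poly
H = hom Y

rev : ℕ → Poly → Poly
rev = hom oneₚ

Deg-H : ∀ N s → Deg s N → Deg (H N s) (N + N)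
Deg-H N [] D = ⊥-elim (Deg-≉ D ≈-refl)
Deg-H zero (c ∷ s) D = Deg-cong (≈-sym (≈-trans (≈-reflexive (cong (λ c → scaleₚ c (xpow 0)) (lead D))) (scale-true oneₚ))) Deg-1
Deg-H (suc N) (c ∷ s) D = subst (Deg _) (cong suc (sym (ℕₚ.+-suc N N)))
    (mk (trans (coef-+ (scaleₚ c x) (Y *ₚ H N s) (2 + (N + N))) (cong₂ _xor_ (low (2 + (N + N)) ℕₚ.≤-refl) (lead D')))
        (λ i p → trans (coef-+ (scaleₚ c x) (Y *ₚ H N s) i) (cong₂ _xor_ (low i (ℕₚ.<⇒≤ p)) (above D' i p))))
  where
  x = xpow (suc N)
  D' : Deg (Y *ₚ H N s) (2 + (N + N))
  D' = Deg-* Y {d = 2} (mk refl λ { (suc (suc (suc i))) _ → refl ; 1 (s≤s ()) ; 2 (s≤s (s≤s ())) }) (Deg-H N s (mk (lead D) (λ i p → above D (suc i) (s≤s p))))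
  low : ∀ i → 2 + (N + N) ≤ i → coef (scaleₚ c x) i ≡ false
  low i p = high (Bounded-scale c (Deg⇒Bounded (Deg-xpow (suc N)))) i (ℕₚ.≤-trans (s≤s (s≤s (ℕₚ.m≤m+n N N))) p)

Bounded-⊎ : ∀ s {N} → Bounded s N → s ≈ [] ⊎ ∃ λ d → d ≤ N × Deg s d
Bounded-⊎ s {N} b with ≈[]⊎Deg s
... | inj₁ z = inj₁ z
... | inj₂ (d , D) with ℕₚ.<-≤-connex N d
...   | inj₂ p = inj₂ (d , p , D)
...   | inj₁ p with trans (sym (lead D)) (high b d p)
...     | ()

Bounded-H : ∀ N s → Bounded s N → Bounded (H N s) (N + N)
Bounded-H N [] b = bdd λ i p → refl
Bounded-H zero (c ∷ s) b = Bounded-scale c (Deg⇒Bounded Deg-1)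
Bounded-H (suc N) (c ∷ s) b = Bounded-+ {scaleₚ c (xpow (suc N))} (Bounded-scale c (Bounded-mono (s≤s (ℕₚ.m≤m+n N (suc N))) (Deg⇒Bounded (Deg-xpow (suc N)))))
  (subst (Bounded (Y *ₚ H N s)) (cong suc (sym (ℕₚ.+-suc N N)))
    (Bounded-+ {scaleₚ true (H N s)} {false ∷ ((false ∷ true ∷ []) *ₚ H N s)}
      (Bounded-scale true (Bounded-mono (ℕₚ.m≤n+m (N + N) 2) IH))
      (Bounded-∷ false (Bounded-cong {false ∷ H N s} (≈-sym (X* (H N s))) (Bounded-∷ false IH)))))
  where
  IH = Bounded-H N s (Bounded-tail {c} b)

rev-xpow : ∀ A B → rev (A + B) (xpow A) ≈ xpow B
rev-xpow zero B = ≈-trans (hom-const oneₚ B true) (scale-true (xpow B))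
rev-xpow (suc A) B = ≈-trans (+-cong (scale-false (xpow (suc (A + B)))) (*-identityˡ _)) (rev-xpow A B)

-- Invariance of w under x ↦ 1/x. Formally, `rev` is multiplicative by `hom-*` and `Y` is a
-- palindrome.
rev-H : ∀ N s → Bounded s N → rev (N + N) (H N s) ≈ H N s
rev-H N [] b = ≈-refl
rev-H zero (c ∷ s) b = ≈-trans (hom-scale oneₚ 0 c (xpow 0)) (scale-cong c (rev-xpow 0 0))
rev-H (suc N) (c ∷ s) b = ≈-trans (hom-+ oneₚ (suc N + suc N) (scaleₚ c (xpow (suc N))) (Y *ₚ H N s))
  (+-cong (≈-trans (hom-scale oneₚ (suc N + suc N) c (xpow (suc N))) (scale-cong c (rev-xpow (suc N) (suc N))))
    (≈-trans (≈-reflexive (cong (λ k → rev k (Y *ₚ H N s)) (cong suc (ℕₚ.+-suc N N))))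
      (≈-trans (hom-* oneₚ 2 (N + N) Y (H N s) bY (Bounded-H N s (Bounded-tail {c} b)))
        (*-cong {rev 2 Y} {Y} {rev (N + N) (H N s)} revY (rev-H N s (Bounded-tail {c} b))))))
  where
  bY : Bounded Y 2
  bY = bdd λ { (suc (suc (suc i))) p → refl ; 1 (s≤s ()) ; 2 (s≤s (s≤s ())) }
  revY : rev 2 Y ≈ Y
  revY = ≈ₚ⇒≈ (rev 2 Y) Y refl

snoc-≈ : ∀ g c → g ++ (c ∷ []) ≈ scaleₚ c (xpow (length g)) +ₚ g
snoc-≈ [] c = ∷-cong (sym (𝔹ₚ.∧-identityʳ c)) ≈-refl
snoc-≈ (a ∷ g) c = ∷-cong (lemma c a) (snoc-≈ g c)
  where
  lemma : ∀ c a → a ≡ (c ∧ false) xor a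
  lemma true a = refl
  lemma false a = refl

rev-reverse : ∀ N f → length f ≡ suc N → rev N f ≈ reverse f
rev-reverse zero (c ∷ []) e = ∷-cong (𝔹ₚ.∧-identityʳ c) ≈-refl
rev-reverse (suc N) (c ∷ f) e = ≈-trans
  (+-cong (≈-refl {scaleₚ c (xpow (suc N))}) (≈-trans (*-identityˡ _) (rev-reverse N f (ℕₚ.suc-injective e))))
  (≈-sym (≈-trans (≈-reflexive (Lₚ.unfold-reverse c f)) (≈-trans (snoc-≈ (reverse f) c)
    (≈-reflexive (cong (λ k → scaleₚ c (xpow k) +ₚ reverse f) (trans (Lₚ.length-reverse f) (ℕₚ.suc-injective e)))))))

-- Uᵢ(w) with x^i + x^-i = w Uᵢ(w), w = x + 1/x
U : ℕ → Poly
U zero = []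
U (suc zero) = oneₚ
U (suc (suc i)) = (false ∷ U (suc i)) +ₚ U i

-- `U 0` is zero and has no degree; the bound `Bounded-U` on w Uᵢ covers it in the recursion.
Deg-U : ∀ i → Deg (U (suc i)) i
Bounded-U : ∀ i → Bounded (false ∷ U i) i

Deg-U zero = Deg-1
Deg-U (suc i) = mk (trans (coef-+ (false ∷ U (suc i)) (U i) (suc i)) (cong₂ _xor_ (lead (Deg-U i)) (high (Bounded-U i) (suc (suc i)) (s≤s (ℕₚ.n≤1+n i)))))
  (λ { (suc j) (s≤s p) → trans (coef-+ (false ∷ U (suc i)) (U i) (suc j)) (cong₂ _xor_ (above (Deg-U i) j p) (high (Bounded-U i) (suc (suc j)) (s≤s (ℕₚ.m≤n⇒m≤1+n (ℕₚ.<⇒≤ p))))) })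

Bounded-U zero = bdd λ { (suc i) p → refl }
Bounded-U (suc i) = Bounded-∷ false (Deg⇒Bounded (Deg-U i))

H-U : ∀ N → H N (false ∷ U N) ≈ oneₚ +ₚ xpow (N + N)
H-U zero = ≈-trans (scale-false (xpow 0)) (≈-sym (+-self oneₚ))
H-U (suc zero) = ≈ₚ⇒≈ (H 1 (false ∷ oneₚ)) (oneₚ +ₚ xpow 2) refl
H-U (suc (suc N)) = begin
    H (2 + N) (false ∷ U (2 + N))
      ≈⟨ hom-+ Y (2 + N) (false ∷ false ∷ U (suc N)) (false ∷ U N) ⟩
    H (2 + N) (false ∷ false ∷ U (suc N)) +ₚ H (2 + N) (false ∷ U N)
      ≈⟨ +-cong (+-cong (scale-false (xpow (2 + N))) (*-congˡ Y (H-U (suc N)))) (≈-trans (hom-raise Y 2 N (false ∷ U N) (Bounded-U N)) (*-congˡ (xpow 2) (H-U N))) ⟩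
    (Y *ₚ (oneₚ +ₚ xpow (suc N + suc N))) +ₚ (xpow 2 *ₚ (oneₚ +ₚ xpow (N + N)))
      ≈⟨ +-cong (*-cong {Y} {oneₚ +ₚ xpow 2} {oneₚ +ₚ xpow (suc N + suc N)} ≈-refl (+-cong (≈-refl {oneₚ}) e1)) ≈-refl ⟩
    ((oneₚ +ₚ xpow 2) *ₚ (oneₚ +ₚ (xpow 2 *ₚ xpow (N + N)))) +ₚ (xpow 2 *ₚ (oneₚ +ₚ xpow (N + N)))
      ≈⟨ solve 3 (λ o x z → (o :+ x) :* (o :+ x :* z) :+ x :* (o :+ z) := o :* o :+ x :* (x :* z) :+ (o :* (x :* z) :+ x :* z)) ≈-refl oneₚ (xpow 2) (xpow (N + N)) ⟩
    ((oneₚ *ₚ oneₚ) +ₚ (xpow 2 *ₚ (xpow 2 *ₚ xpow (N + N)))) +ₚ ((oneₚ *ₚ (xpow 2 *ₚ xpow (N + N))) +ₚ (xpow 2 *ₚ xpow (N + N)))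
      ≈⟨ +-cong (+-cong (*-identityˡ oneₚ) (≈-refl {xpow 2 *ₚ (xpow 2 *ₚ xpow (N + N))})) (≈-trans (+-cong (*-identityˡ (xpow 2 *ₚ xpow (N + N))) ≈-refl) (+-self (xpow 2 *ₚ xpow (N + N)))) ⟩
    (oneₚ +ₚ (xpow 2 *ₚ (xpow 2 *ₚ xpow (N + N)))) +ₚ []
      ≈⟨ +-identityʳ _ ⟩
    oneₚ +ₚ (xpow 2 *ₚ (xpow 2 *ₚ xpow (N + N)))
      ≈⟨ +-cong (≈-refl {oneₚ}) (≈-sym (≈-trans (≈-trans (≈-reflexive (cong xpow e2)) (xpow-+ 2 (2 + (N + N)))) (*-congˡ (xpow 2) (xpow-+ 2 (N + N))))) ⟩
    oneₚ +ₚ xpow ((2 + N) + (2 + N)) ∎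
  where
  open ≈-Reasoning
  e1 : xpow (suc N + suc N) ≈ xpow 2 *ₚ xpow (N + N)
  e1 = ≈-trans (≈-reflexive (cong xpow (cong suc (ℕₚ.+-suc N N)))) (xpow-+ 2 (N + N))
  e2 : (2 + N) + (2 + N) ≡ 2 + (2 + (N + N))
  e2 = cong (2 +_) (trans (ℕₚ.+-suc N (suc N)) (cong suc (ℕₚ.+-suc N N)))

-- The outer coefficients of a palindrome agree and contribute c (1 + x^{2N+2}), which `H-U`
-- realises as c w U_{N+1}; the inner palindrome is x times a homogenisation of smaller order.
palindrome⇒H : ∀ N p → length p ≡ suc (N + N) → reverse p ≡ p → ∃ λ R → Bounded R N × H N R ≈ p
palindrome⇒H zero (c ∷ []) l e = (c ∷ []) , bdd (λ { (suc i) p → refl }) , ∷-cong (𝔹ₚ.∧-identityʳ c) ≈-refl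
palindrome⇒H (suc N) (c ∷ p) l e with initLast p
palindrome⇒H (suc N) (c ∷ .[]) l e | [] with ℕₚ.suc-injective l
... | ()
palindrome⇒H (suc N) (c ∷ .(q ∷ʳ d)) l e | q ∷ʳ′ d = R' +ₚ scaleₚ c D ,
    Bounded-+ {R'} (Bounded-mono (ℕₚ.n≤1+n N) bR') (Bounded-scale c (Bounded-U (suc N))) , (begin
      H (suc N) (R' +ₚ scaleₚ c D)
        ≈⟨ hom-+ Y (suc N) R' (scaleₚ c D) ⟩
      H (suc N) R' +ₚ H (suc N) (scaleₚ c D)
        ≈⟨ +-cong (≈-trans (hom-raise Y 1 N R' bR') (*-congˡ X hR')) (≈-trans (hom-scale Y (suc N) c D) (≈-trans (scale-cong c (H-U (suc N))) (scale-const c _))) ⟩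
      (X *ₚ q) +ₚ ((c ∷ []) *ₚ (oneₚ +ₚ xpow (suc N + suc N)))
        ≈⟨ +-cong (≈-refl {X *ₚ q}) (*-congˡ (c ∷ []) (+-cong (≈-refl {oneₚ}) (≈-trans (≈-reflexive (cong xpow (cong suc (ℕₚ.+-suc N N)))) (≈-sym (X* (xpow (suc (N + N)))))))) ⟩
      (X *ₚ q) +ₚ ((c ∷ []) *ₚ (oneₚ +ₚ (X *ₚ xpow (suc (N + N)))))
        ≈⟨ solve 5 (λ X q c o z → X :* q :+ c :* (o :+ X :* z) := c :* o :+ X :* (c :* z :+ q)) ≈-refl X q (c ∷ []) oneₚ (xpow (suc (N + N))) ⟩
      ((c ∷ []) *ₚ oneₚ) +ₚ (X *ₚ (((c ∷ []) *ₚ xpow (suc (N + N))) +ₚ q))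
        ≈⟨ +-cong (*-identityʳ (c ∷ [])) (*-congˡ X (≈-trans (+-cong (≈-trans (≈-sym (scale-const c (xpow (suc (N + N))))) (≈-reflexive (cong₂ (λ c k → scaleₚ c (xpow k)) c≡d (sym lq)))) ≈-refl) (≈-sym (snoc-≈ q d)))) ⟩
      (c ∷ []) +ₚ (X *ₚ (q ++ (d ∷ [])))
        ≈⟨ ≈-sym (∷-split c (q ++ (d ∷ []))) ⟩
      c ∷ (q ++ (d ∷ [])) ∎)
  where
  open ≈-Reasoning
  lq : length q ≡ suc (N + N)
  lq = ℕₚ.suc-injective (trans (sym (trans (Lₚ.length-++ q) (ℕₚ.+-comm (length q) 1))) (ℕₚ.suc-injective (trans l (cong suc (cong suc (ℕₚ.+-suc N N))))))
  e' : d ∷ (reverse q ∷ʳ c) ≡ c ∷ (q ∷ʳ d)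
  e' = trans (sym (trans (Lₚ.unfold-reverse c (q ∷ʳ d)) (cong (_∷ʳ c) (Lₚ.reverse-++ q (d ∷ []))))) e
  c≡d : c ≡ d
  c≡d = sym (Lₚ.∷-injectiveˡ e')
  q≡ : reverse q ≡ q
  q≡ = Lₚ.∷ʳ-injectiveˡ (reverse q) q (Lₚ.∷-injectiveʳ e')
  IH = palindrome⇒H N q lq q≡
  R' = proj₁ IH
  bR' = proj₁ (proj₂ IH)
  hR' = proj₂ (proj₂ IH)
  D = false ∷ U (suc N)

-- Prime self-reciprocal polynomials of even degree are H(R) with R prime

norm-Deg : ∀ {f d} → Deg f d → length (norm f) ≡ suc d
norm-Deg {f} = Deg-length f

const-∷ : ∀ {f} → constTerm f ≡ true → ∃ λ f' → f ≡ true ∷ f'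
const-∷ {true ∷ f'} e = f' , refl

Deg-snoc : ∀ g → Deg (g ++ (true ∷ [])) (length g)
Deg-snoc [] = Deg-1
Deg-snoc (c ∷ g) = Deg-∷ c (Deg-snoc g)

recip≈rev : ∀ {f d} → Deg f d → recip f ≈ rev d f
recip≈rev {f} {d} D = ≈-trans (norm-≈ (reverse (norm f))) (≈-trans (≈-sym (rev-reverse d (norm f) (norm-Deg D))) (hom-cong oneₚ d (norm-≈ f)))

reverse-true : ∀ {f d} → length f ≡ suc d → constTerm f ≡ true → Deg (reverse f) d
reverse-true {f} {d} l c with const-∷ {f} c
... | f' , refl = subst (Deg _) (trans (Lₚ.length-reverse f') (ℕₚ.suc-injective l))
  (Deg-cong (≈-reflexive (sym (Lₚ.unfold-reverse true f'))) (Deg-snoc (reverse f')))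

Deg-recip : ∀ {f d} → Deg f d → constTerm (norm f) ≡ true → Deg (recip f) d
Deg-recip {f} D c = Deg-cong (≈-sym (norm-≈ (reverse (norm f)))) (reverse-true {norm f} (norm-Deg D) c)

rev-recip : ∀ {f d} → Deg f d → rev d (recip f) ≈ f
rev-recip {f} {d} D = ≈-trans (hom-cong oneₚ d (norm-≈ (reverse (norm f))))
  (≈-trans (rev-reverse d (reverse (norm f)) (trans (Lₚ.length-reverse (norm f)) (norm-Deg D)))
    (≈-trans (≈-reflexive (Lₚ.reverse-involutive (norm f))) (norm-≈ f)))

norm-full : ∀ f {d} → length f ≡ suc d → Deg f d → norm f ≡ f
norm-full (c ∷ []) {zero} l D = trans (norm-∷ c []) (trans (cong (λ c → norm-cons c []) (lead D)) (cong (_∷ []) (sym (lead D))))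
norm-full (c ∷ f) {suc d} l D = trans (norm-∷ c f) (trans (cong (norm-cons c) IH) (lemma f (ℕₚ.suc-injective l)))
  where
  IH : norm f ≡ f
  IH = norm-full f (ℕₚ.suc-injective l) (mk (lead D) (λ i p → above D (suc i) (s≤s p)))
  lemma : ∀ g → length g ≡ suc d → norm-cons c g ≡ c ∷ g
  lemma (b ∷ g) e = refl

-- The condition 1 ≤ N excludes R = 1, which satisfies `Prime`.
record Lift (r R : Poly) : Set where
  constructor lift
  field
    {N} : ℕ
    degR : Deg R N
    Hr : H N R ≈ r
    prime : Prime R
    N>0 : 1 ≤ N
  deg-r : deg r ≡ N + N
  deg-r = Deg⇒deg (Deg-cong Hr (Deg-H N R degR))

self-rev⇒palindrome : ∀ {f N} → Deg f (N + N) → rev (N + N) f ≈ f → ∃ λ R → Deg R N × H N R ≈ f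
self-rev⇒palindrome {f} {N} D e with palindrome⇒H N (norm f) (norm-Deg D) pal
  where
  dr : Deg (reverse (norm f)) (N + N)
  dr = Deg-cong (≈-trans (≈-sym e) (≈-trans (hom-cong oneₚ (N + N) (≈-sym (norm-≈ f))) (rev-reverse (N + N) (norm f) (norm-Deg D)))) D
  pal : reverse (norm f) ≡ norm f
  pal = trans (sym (norm-full (reverse (norm f)) (trans (Lₚ.length-reverse (norm f)) (norm-Deg D)) dr))
    (≈⇒≈ₚ (reverse (norm f)) f (≈-trans (≈-sym (rev-reverse (N + N) (norm f) (norm-Deg D))) (≈-trans (hom-cong oneₚ (N + N) (norm-≈ f)) e)))
... | R , b , h with Bounded-⊎ R b
...   | inj₁ z = ⊥-elim (Deg-≉ D (≈-trans (≈-sym (≈-trans h (norm-≈ f))) (hom-≈[] Y N z)))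
...   | inj₂ (d , d≤ , E) = R , subst (Deg R) d≡N E , ≈-trans h (norm-≈ f)
  where
  -- `palindrome⇒H` only bounds the degree d of R by N. The excess k would split off x^k, and k + 2d
  -- = 2N together with k + d = N forces d = N.
  k = N ∸ d
  kd : k + d ≡ N
  kd = ℕₚ.m∸n+n≡m d≤
  H≈ : H N R ≈ xpow k *ₚ H d R
  H≈ = ≈-trans (≈-reflexive (cong (λ j → H j R) (sym kd))) (hom-raise Y k d R (Deg⇒Bounded E))
  sum≡ : k + (d + d) ≡ N + N
  sum≡ = Deg-unique (Deg-* (xpow k) (Deg-xpow k) (Deg-H d R E)) (Deg-cong (≈-trans (≈-sym (≈-trans h (norm-≈ f))) H≈) D)
  d≡N : d ≡ N
  d≡N = ℕₚ.+-cancelˡ-≡ N d N (trans (cong (_+ d) (sym kd)) (trans (ℕₚ.+-assoc k d d) sum≡))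

H-factor : ∀ {R N a b da db} → Deg R N → Deg a da → Deg b db → R ≈ a *ₚ b → H N R ≈ H da a *ₚ H db b × da + db ≡ N
H-factor {R} {N} {a} {b} {da} {db} D A B e = ≈-trans (hom-cong Y N e) (≈-trans (≈-reflexive (cong (λ k → H k (a *ₚ b)) (sym s)))
    (hom-* Y da db a b (Deg⇒Bounded A) (Deg⇒Bounded B))) , s
  where
  s : da + db ≡ N
  s = Deg-unique (Deg-* a A B) (Deg-cong e D)

Deg-factors : ∀ {a b f d} → Deg f d → a *ₚ b ≈ f → ∃₂ λ da db → Deg a da × Deg b db
Deg-factors {a} {b} D e = deg a , deg b , ≉⇒Deg a (λ z → Deg-≉ D (≈-trans (≈-sym e) (*-cong z (≈-refl {b})))) ,
  ≉⇒Deg b (λ z → Deg-≉ D (≈-trans (≈-sym e) (≈-trans (*-congˡ a z) (*-zeroʳ a))))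

double-zero : ∀ k → k + k ≡ 0 → k ≡ 0
double-zero zero e = refl

double-injective : ∀ {a b} → a + a ≡ b + b → a ≡ b
double-injective {a} {b} e = ℕₚ.*-cancelˡ-≡ a b 2 (trans (cong (a +_) (ℕₚ.+-identityʳ a)) (trans e (cong (b +_) (sym (ℕₚ.+-identityʳ b)))))

-- `H` is multiplicative and doubles degrees, so a proper factorisation of R would give one of r.
irreducible-lift : ∀ {r R N} → 1 ≤ N → Irreducible r → Deg R N → H N R ≈ r → Irreducible R
irreducible-lift {r} {R} {N} 1≤ (_ , irr) D h = subst (1 ≤_) (sym (Deg⇒deg D)) 1≤ , go
  where
  go : ∀ a b → (a *ₚ b) ≈ₚ R → deg a ≡ 0 ⊎ deg b ≡ 0
  go a b e' with Deg-factors {a} {b} D (≈ₚ⇒≈ _ _ e')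
  ... | da , db , A , B with H-factor D A B (≈-sym (≈ₚ⇒≈ _ _ e'))
  ...   | e , _ with irr (H da a) (H db b) (≈⇒≈ₚ _ _ (≈-trans (≈-sym e) h))
  ...     | inj₁ z = inj₁ (trans (Deg⇒deg A) (double-zero da (trans (sym (Deg⇒deg (Deg-H da a A))) z)))
  ...     | inj₂ z = inj₂ (trans (Deg⇒deg B) (double-zero db (trans (sym (Deg⇒deg (Deg-H db b B))) z)))

-- A factor H(a) of g g* is self-reciprocal, so it is divisible by both or by none of g, g*.
reciprocal-pair-lift : ∀ {g dg R N} → 1 ≤ N → Irreducible g → Deg g dg → constTerm (norm g) ≡ true → ¬ recip g ≡ norm g →
  Deg R N → H N R ≈ g *ₚ recip g → Irreducible R
reciprocal-pair-lift {g} {dg} {R} {N} 1≤ irr Dg c ne D h = subst (1 ≤_) (sym (Deg⇒deg D)) 1≤ , go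
  where
  g* = recip g
  Dg* : Deg g* dg
  Dg* = Deg-recip Dg c
  primeg : Prime g
  primeg = Irreducible⇒Prime irr
  coprime : Coprime g g*
  coprime with primeg g*
  ... | inj₂ c = c
  ... | inj₁ d = ⊥-elim (ne (trans (sym (lemma (reverse (norm g)))) (sym (≈⇒≈ₚ g g* (∣-Deg-≡ d Dg Dg*)))))
    where
    lemma : ∀ f → norm (norm f) ≡ norm f
    lemma f = ≈⇒≈ₚ (norm f) f (norm-≈ f)
  both : ∀ {a da} → Deg a da → g ∣ₚ H da a → g *ₚ g* ∣ₚ H da a
  both {a} {da} A d with ∣-Deg d Dg (Deg-H da a A)
  ... | q , Q , s , e = combine (Coprime-∣-* (sym-coprime coprime) (∣-cong ≈-refl (≈-trans e (*-comm q g)) g*∣))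
    where
    sym-coprime : ∀ {a b} → Coprime a b → Coprime b a
    sym-coprime {a} {b} (u , v , e) = v , u , ≈-trans e (+-comm (u *ₚ a) (v *ₚ b))
    dq = (da + da) ∸ dg
    -- Apply `rev` to H(a) = q g: the left side is unchanged, and g becomes g*.
    g*∣ : g* ∣ₚ H da a
    g*∣ = rev dq q , ≈-trans (≈-sym (rev-H da a (Deg⇒Bounded A))) (≈-trans (hom-cong oneₚ (da + da) e)
      (≈-trans (≈-reflexive (cong (λ k → rev k (q *ₚ g)) (trans (sym s) (ℕₚ.+-comm dg dq))))
        (≈-trans (hom-* oneₚ dq dg q g (Deg⇒Bounded Q) (Deg⇒Bounded Dg)) (*-congˡ (rev dq q) (≈-sym (recip≈rev Dg))))))
    combine : g* ∣ₚ q → g *ₚ g* ∣ₚ H da a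
    combine (k , ek) = k , ≈-trans e (≈-trans (*-cong ek (≈-refl {g})) (solve 3 (λ k s g → (k :* s) :* g := k :* (g :* s)) ≈-refl k g* g))
  -- If g divides H(a), so does g g*, and comparing degrees gives da ≥ dg = N, which leaves nothing
  -- for b.
  deg-zero : ∀ {a da db} → Deg a da → da + db ≡ N → g ∣ₚ H da a → db ≡ 0
  deg-zero {a} {da} {db} A s d with ∣-Deg (both A d) (Deg-* g Dg Dg*) (Deg-H da a A)
  ... | _ , _ , s' , _ = ℕₚ.n≤0⇒n≡0 (ℕₚ.+-cancelˡ-≤ da db 0 (ℕₚ.≤-trans (ℕₚ.≤-reflexive (trans s N≡)) (ℕₚ.≤-trans dg≤ (ℕₚ.≤-reflexive (sym (ℕₚ.+-identityʳ da))))))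
    where
    N≡ : N ≡ dg
    N≡ = double-injective (Deg-unique (Deg-H N R D) (Deg-cong (≈-sym h) (Deg-* g Dg Dg*)))
    dg≤ : dg ≤ da
    dg≤ with ℕₚ.≤-<-connex dg da
    ... | inj₁ p = p
    ... | inj₂ p = ⊥-elim (ℕₚ.<-irrefl refl (ℕₚ.<-≤-trans (ℕₚ.+-mono-< p p) (ℕₚ.≤-trans (ℕₚ.m≤m+n _ _) (ℕₚ.≤-reflexive s'))))
  go : ∀ a b → (a *ₚ b) ≈ₚ R → deg a ≡ 0 ⊎ deg b ≡ 0
  go a b e' with Deg-factors {a} {b} D (≈ₚ⇒≈ _ _ e')
  ... | da , db , A , B with H-factor D A B (≈-sym (≈ₚ⇒≈ _ _ e'))
  ...   | e , s with Prime-∣-* primeg (H da a) (∣-cong ≈-refl (≈-trans (≈-sym h) e) (∣-*ʳ g* (∣-refl {g})))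
  ...     | inj₁ d = inj₂ (trans (Deg⇒deg B) (deg-zero A s d))
  ...     | inj₂ d = inj₁ (trans (Deg⇒deg A) (deg-zero B (trans (ℕₚ.+-comm db da) s) d))

∣⇒double : ∀ {d} → 2 ∣ d → ∃ λ N → d ≡ N + N
∣⇒double (divides q e) = q , trans e (trans (ℕₚ.*-comm q 2) (cong (q +_) (ℕₚ.+-identityʳ q)))

double>0 : ∀ N → 1 ≤ N + N → 1 ≤ N
double>0 (suc N) _ = s≤s z≤n

prime-self-reciprocal⇒Lift : ∀ r → PrimeSelfReciprocal r × 2 ∣ deg r → ∃ (Lift r)
prime-self-reciprocal⇒Lift r ((monic , inj₁ (irr , c , e)) , 2∣) with ∣⇒double 2∣
... | N , d≡ with self-rev⇒palindrome {r} {N} D (≈-trans (≈-sym (recip≈rev D)) (≈-trans (≈-reflexive (sym e)) (norm-≈ r)))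
  where
  D : Deg r (N + N)
  D = subst (Deg r) d≡ (≉⇒Deg r (λ z → monic (≈[]⇒norm r z)))
... | R , DR , h = R , lift DR h (Irreducible⇒Prime (irreducible-lift N>0 irr DR h)) N>0
  where
  N>0 : 1 ≤ N
  N>0 = double>0 N (subst (1 ≤_) d≡ (proj₁ irr))
prime-self-reciprocal⇒Lift r ((monic , inj₂ (g , mg , irr , c , ne , e)) , 2∣)
  with self-rev⇒palindrome {g *ₚ recip g} {deg g} (Deg-* g Dg (Deg-recip Dg c))
    (≈-trans (hom-* oneₚ (deg g) (deg g) g (recip g) (Deg⇒Bounded Dg) (Deg⇒Bounded (Deg-recip Dg c)))
      (≈-trans (*-cong {rev (deg g) g} (≈-sym (recip≈rev Dg)) (rev-recip Dg)) (*-comm (recip g) g)))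
  where
  Dg : Deg g (deg g)
  Dg = ≉⇒Deg g (λ z → mg (≈[]⇒norm g z))
... | R , DR , h = R , lift DR (≈-trans h (≈-sym (≈ₚ⇒≈ _ _ e)))
  (Irreducible⇒Prime (reciprocal-pair-lift (proj₁ irr) irr (≉⇒Deg g (λ z → mg (≈[]⇒norm g z))) c ne DR h)) (proj₁ irr)

-- Square-freeness of x^m + 1 for odd m: split off even and odd parts, f² = f(x²)

dil : Poly → Poly
dil [] = []
dil (c ∷ f) = c ∷ false ∷ dil f

square≈dil : ∀ f → f *ₚ f ≈ dil f
square≈dil [] = ≈-refl
square≈dil (c ∷ f) = begin
    (c ∷ f) *ₚ (c ∷ f)
      ≈⟨ *-cong {c ∷ f} (∷-split c f) (∷-split c f) ⟩
    ((c ∷ []) +ₚ (X *ₚ f)) *ₚ ((c ∷ []) +ₚ (X *ₚ f))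
      ≈⟨ solve 3 (λ c X f → (c :+ X :* f) :* (c :+ X :* f) := c :* c :+ X :* (X :* (f :* f))) ≈-refl (c ∷ []) X f ⟩
    ((c ∷ []) *ₚ (c ∷ [])) +ₚ (X *ₚ (X *ₚ (f *ₚ f)))
      ≈⟨ +-cong (∷-cong (trans (𝔹ₚ.xor-identityʳ (c ∧ c)) (𝔹ₚ.∧-idem c)) ≈-refl) (≈-trans (X* _) (∷-cong refl (≈-trans (X* _) (∷-cong refl (square≈dil f))))) ⟩
    (c ∷ []) +ₚ (false ∷ false ∷ dil f)
      ≈⟨ ∷-cong (𝔹ₚ.xor-identityʳ c) ≈-refl ⟩
    c ∷ false ∷ dil f ∎
  where open ≈-Reasoning

coef-dil : ∀ f i → coef (dil f) (i + i) ≡ coef f i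
coef-dil [] i = refl
coef-dil (c ∷ f) zero = refl
coef-dil (c ∷ f) (suc i) = trans (cong (coef (false ∷ dil f)) (ℕₚ.+-suc i i)) (coef-dil f i)

coef-x-dil : ∀ f i → coef (false ∷ dil f) (i + i) ≡ false
coef-x-dil f zero = refl
coef-x-dil [] (suc i) = refl
coef-x-dil (c ∷ f) (suc i) = trans (cong (coef (c ∷ false ∷ dil f)) (ℕₚ.+-suc i i)) (coef-x-dil f i)

even-part : ∀ {a b a' b'} → dil a +ₚ (false ∷ dil b) ≈ dil a' +ₚ (false ∷ dil b') → a ≈ a'
even-part {a} {b} {a'} {b'} e = mk λ i → trans (sym (lemma a b i)) (trans (at e (i + i)) (lemma a' b' i))
  where
  lemma : ∀ a b i → coef (dil a +ₚ (false ∷ dil b)) (i + i) ≡ coef a i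
  lemma a b i = trans (coef-+ (dil a) _ (i + i)) (trans (cong₂ _xor_ (coef-dil a i) (coef-x-dil b i)) (𝔹ₚ.xor-identityʳ _))

square-injective : ∀ f g → f *ₚ f ≈ g *ₚ g → f ≈ g
square-injective f g e = mk λ i → trans (sym (coef-dil f i)) (trans (at (≈-trans (≈-sym (square≈dil f)) (≈-trans e (square≈dil g))) (i + i)) (coef-dil g i))

evens odds : Poly → Poly
evens [] = []
evens (c ∷ []) = c ∷ []
evens (c ∷ d ∷ f) = c ∷ evens f
odds [] = []
odds (c ∷ []) = []
odds (c ∷ d ∷ f) = d ∷ odds f

evens-odds : ∀ f → f ≈ dil (evens f) +ₚ (false ∷ dil (odds f))
evens-odds [] = ≈-sym (∷-≈[] refl ≈-refl)
evens-odds (c ∷ []) = ∷-cong (sym (𝔹ₚ.xor-identityʳ c)) (≈-sym (∷-≈[] refl ≈-refl))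
evens-odds (c ∷ d ∷ f) = ∷-cong (sym (𝔹ₚ.xor-identityʳ c)) (≈-trans (∷-cong refl (evens-odds f)) (lemma (dil (evens f)) (dil (odds f))))
  where
  lemma : ∀ g h → d ∷ (g +ₚ (false ∷ h)) ≈ (false ∷ g) +ₚ (d ∷ false ∷ h)
  lemma g h = ≈-refl

dil-* : ∀ f g → dil (f *ₚ g) ≈ dil f *ₚ dil g
dil-* f g = ≈-trans (≈-sym (square≈dil (f *ₚ g))) (≈-trans (solve 2 (λ f g → (f :* g) :* (f :* g) := (f :* f) :* (g :* g)) ≈-refl f g)
  (*-cong (square≈dil f) (square≈dil g)))

dil-xpow : ∀ k → dil (xpow k) ≈ xpow (k + k)
dil-xpow zero = ∷-cong refl (∷-≈[] refl ≈-refl)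
dil-xpow (suc k) = ∷-cong refl (≈-trans (∷-cong refl (dil-xpow k)) (≈-reflexive (cong xpow (sym (ℕₚ.+-suc k k)))))

-- As a² = a(x²) contains only even powers, the even part of a² b is a² times the even part of b.
-- The even part of x^{2k+1} + 1 is 1, so a divides 1.
squarefree : ∀ k a b → (a *ₚ a) *ₚ b ≈ xⁿ+1 (suc (k + k)) → Deg a 0
squarefree k a b e = subst (Deg a) (ℕₚ.m+n≡0⇒m≡0 (deg a) (Deg-unique (Deg-* a A (≉⇒Deg (evens b) nb)) (Deg-cong (≈-sym unit) Deg-1))) A
  where
  open ≈-Reasoning
  unit : a *ₚ evens b ≈ oneₚ
  unit = even-part {b = a *ₚ odds b} {b' = xpow k} (begin
    dil (a *ₚ evens b) +ₚ (false ∷ dil (a *ₚ odds b))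
      ≈⟨ +-cong (dil-* a (evens b)) (≈-trans (∷-cong refl (dil-* a (odds b))) (≈-sym (X* (dil a *ₚ dil (odds b))))) ⟩
    (dil a *ₚ dil (evens b)) +ₚ (X *ₚ (dil a *ₚ dil (odds b)))
      ≈⟨ solve 4 (λ a b X o → a :* b :+ X :* (a :* o) := a :* (b :+ X :* o)) ≈-refl (dil a) (dil (evens b)) X (dil (odds b)) ⟩
    dil a *ₚ (dil (evens b) +ₚ (X *ₚ dil (odds b)))
      ≈⟨ *-cong (≈-sym (square≈dil a)) (≈-trans (+-cong (≈-refl {dil (evens b)}) (X* (dil (odds b)))) (≈-sym (evens-odds b))) ⟩
    (a *ₚ a) *ₚ b
      ≈⟨ e ⟩
    xⁿ+1 (suc (k + k))
      ≈⟨ +-cong {oneₚ} {dil oneₚ} (∷-cong refl (≈-sym (∷-≈[] refl ≈-refl))) (∷-cong {false} refl (≈-sym (dil-xpow k))) ⟩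
    dil oneₚ +ₚ (false ∷ dil (xpow k)) ∎)
  A : Deg a (deg a)
  A = ≉⇒Deg a (λ z → Deg-≉ Deg-1 (≈-trans (≈-sym unit) (*-cong z (≈-refl {evens b}))))
  nb : ¬ evens b ≈ []
  nb z = Deg-≉ Deg-1 (≈-trans (≈-sym unit) (≈-trans (*-congˡ a z) (*-zeroʳ a)))

^-double : ∀ f k → f ^ₚ (2 * k) ≈ (f ^ₚ k) *ₚ (f ^ₚ k)
^-double f k = ≈-trans (^-+ k (k + 0)) (*-congˡ (f ^ₚ k) (≈-reflexive (cong (f ^ₚ_) (ℕₚ.+-identityʳ k))))
  where
  ^-+ : ∀ a b → f ^ₚ (a + b) ≈ (f ^ₚ a) *ₚ (f ^ₚ b)
  ^-+ zero b = ≈-sym (*-identityˡ (f ^ₚ b))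
  ^-+ (suc a) b = ≈-trans (*-congˡ f (^-+ a b)) (≈-sym (*-assoc f (f ^ₚ a) (f ^ₚ b)))

^-distrib-* : ∀ k f g → (f *ₚ g) ^ₚ k ≈ (f ^ₚ k) *ₚ (g ^ₚ k)
^-distrib-* zero f g = ≈-sym (*-identityˡ oneₚ)
^-distrib-* (suc k) f g = ≈-trans (*-congˡ (f *ₚ g) (^-distrib-* k f g))
  (solve 4 (λ f g a b → (f :* g) :* (a :* b) := (f :* a) :* (g :* b)) ≈-refl f g (f ^ₚ k) (g ^ₚ k))

1^ : ∀ k → oneₚ ^ₚ k ≈ oneₚ
1^ zero = ≈-refl
1^ (suc k) = ≈-trans (*-identityˡ (oneₚ ^ₚ k)) (1^ k)

prod-^ : ∀ k fs → prodₚ (map (_^ₚ k) fs) ≈ prodₚ fs ^ₚ k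
prod-^ k [] = ≈-sym (1^ k)
prod-^ k (f ∷ fs) = ≈-trans (*-congˡ (f ^ₚ k) (prod-^ k fs)) (≈-sym (^-distrib-* k f (prodₚ fs)))

2^t-injective : ∀ t f g → f ^ₚ (2 ^ t) ≈ g ^ₚ (2 ^ t) → f ≈ g
2^t-injective zero f g e = ≈-trans (≈-sym (*-identityʳ f)) (≈-trans e (*-identityʳ g))
2^t-injective (suc t) f g e = 2^t-injective t f g (square-injective _ _ (≈-trans (≈-sym (^-double f (2 ^ t))) (≈-trans e (^-double g (2 ^ t)))))

xⁿ+1-2^t : ∀ t m → xⁿ+1 (2 ^ t * m) ≈ xⁿ+1 m ^ₚ (2 ^ t)
xⁿ+1-2^t zero m = ≈-trans (≈-reflexive (cong xⁿ+1 (ℕₚ.+-identityʳ m))) (≈-sym (*-identityʳ (xⁿ+1 m)))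
xⁿ+1-2^t (suc t) m = begin
    xⁿ+1 (2 * 2 ^ t * m)
      ≈⟨ ≈-reflexive (cong xⁿ+1 (trans (ℕₚ.*-assoc 2 (2 ^ t) m) (cong (k +_) (ℕₚ.+-identityʳ k)))) ⟩
    oneₚ +ₚ xpow (k + k)
      ≈⟨ +-cong (≈-sym (*-identityˡ oneₚ)) (xpow-+ k k) ⟩
    (oneₚ *ₚ oneₚ) +ₚ (xpow k *ₚ xpow k)
      ≈⟨ solve 2 (λ o z → o :* o :+ z :* z := (o :+ z) :* (o :+ z)) ≈-refl oneₚ (xpow k) ⟩
    xⁿ+1 k *ₚ xⁿ+1 k
      ≈⟨ *-cong (xⁿ+1-2^t t m) (xⁿ+1-2^t t m) ⟩
    (xⁿ+1 m ^ₚ (2 ^ t)) *ₚ (xⁿ+1 m ^ₚ (2 ^ t))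
      ≈⟨ ≈-sym (^-double (xⁿ+1 m) (2 ^ t)) ⟩
    xⁿ+1 m ^ₚ (2 * 2 ^ t) ∎
  where
  open ≈-Reasoning
  k = 2 ^ t * m

-- Squaring is injective on 𝔽₂[x], so 2^t-th roots can be taken on both sides of the given
-- factorisation.
squarefree-factorization : ∀ t m rs → xⁿ+1 (2 ^ t * m) ≈ (x+1 ^ₚ (2 ^ t)) *ₚ prodₚ (map (λ r → r ^ₚ (2 ^ t)) rs) → xⁿ+1 m ≈ x+1 *ₚ prodₚ rs
squarefree-factorization t m rs e = 2^t-injective t _ _ (≈-trans (≈-sym (xⁿ+1-2^t t m)) (≈-trans e
  (≈-trans (*-congˡ (x+1 ^ₚ (2 ^ t)) (prod-^ (2 ^ t) rs)) (≈-sym (^-distrib-* (2 ^ t) x+1 (prodₚ rs))))))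

H-∣ : ∀ {R N R' N'} → Deg R N → Deg R' N' → R ∣ₚ R' → H N R ∣ₚ H N' R'
H-∣ {R} {N} {R'} {N'} D D' d with ∣-Deg d D D'
... | q , Q , s , e = H (N' ∸ N) q , proj₁ (H-factor D' Q D e)

Prime-∣-^ : ∀ {P} → Prime P → ¬ P ∣ₚ oneₚ → ∀ k f → P ∣ₚ f ^ₚ k → P ∣ₚ f
Prime-∣-^ p n1 zero f d = ⊥-elim (n1 d)
Prime-∣-^ p n1 (suc k) f d with Prime-∣-* p f d
... | inj₁ q = q
... | inj₂ q = Prime-∣-^ p n1 k f q

Deg>0∤1 : ∀ {P d} → 1 ≤ d → Deg P d → ¬ P ∣ₚ oneₚ
Deg>0∤1 (s≤s _) D d with ∣-Deg d D Deg-1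
... | _ , _ , () , _

-- The same coefficient list as `X`, named for its role as the indeterminate of 𝔽₂[w].
w : Poly
w = false ∷ oneₚ

Deg-w : Deg w 1
Deg-w = Deg-∷ false Deg-1

Prime-w : Prime w
Prime-w [] = inj₁ ([] , ≈-refl)
Prime-w (false ∷ s) = inj₁ (s , ≈-trans (≈-sym (X* s)) (*-comm w s))
Prime-w (true ∷ s) = inj₂ (s , oneₚ , ≈-sym (begin
    (s *ₚ w) +ₚ (oneₚ *ₚ (true ∷ s))
      ≈⟨ +-cong (≈-trans (*-comm s w) (X* s)) (*-identityˡ (true ∷ s)) ⟩
    (false ∷ s) +ₚ (true ∷ s)
      ≈⟨ ∷-cong refl (+-self s) ⟩
    oneₚ ∎))
  where open ≈-Reasoning

H-w : H 1 w ≈ x+1 *ₚ x+1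
H-w = ≈ₚ⇒≈ (H 1 w) (x+1 *ₚ x+1) refl

-- Coprimality of the prime powers that make up D

module Coprimality {k : ℕ} where
  n₀ = suc (k + k)

  prime∣prod : ∀ {P q} → Prime P → ¬ P ∣ₚ oneₚ → ∀ {rs Rs} → Pointwise Lift rs Rs → P ∣ₚ prodₚ (map (_^ₚ q) Rs) →
    ∃₂ λ r R → Lift r R × P ∣ₚ R × r ∣ₚ prodₚ rs
  prime∣prod pr n1 [] d = ⊥-elim (n1 d)
  prime∣prod {P} {q} pr n1 {r ∷ rs} {R ∷ Rs} (L ∷ Ls) d with Prime-∣-* pr (R ^ₚ q) d
  ... | inj₁ d' = r , R , L , Prime-∣-^ pr n1 q R d' , ∣-*ʳ (prodₚ rs) (∣-refl {r})
  ... | inj₂ d' with prime∣prod {q = q} pr n1 Ls d'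
  ...   | r' , R' , L' , a , b = r' , R' , L' , a , ∣-*ˡ r b

  square∣⇒Deg0 : ∀ {r} → r *ₚ r ∣ₚ xⁿ+1 n₀ → Deg r 0
  square∣⇒Deg0 {r} (b , e) = squarefree k r b (≈-trans (*-comm (r *ₚ r) b) (≈-sym e))

  *-∣ : ∀ {a b c d} → a ∣ₚ b → c ∣ₚ d → a *ₚ c ∣ₚ b *ₚ d
  *-∣ {a} {b} {c} {d} (q , e) (q' , e') = q *ₚ q' , ≈-trans (*-cong e e') (solve 4 (λ q a q' c → (q :* a) :* (q' :* c) := (q :* q') :* (a :* c)) ≈-refl q a q' c)

  -- If w divided some Rᵢ, then H(w) = (x+1)² would divide rᵢ and hence the square-free polynomial
  -- x^m + 1.
  w∤prod : ∀ {q rs Rs} → Pointwise Lift rs Rs → xⁿ+1 n₀ ≈ x+1 *ₚ prodₚ rs → ¬ w ∣ₚ prodₚ (map (_^ₚ q) Rs)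
  w∤prod {q} {rs} Ls e d with prime∣prod {q = q} Prime-w (Deg>0∤1 (s≤s z≤n) Deg-w) Ls d
  ... | r , R , L , d' , r∣ = nope (Deg-unique Deg-x+1 (square∣⇒Deg0 {x+1} (∣-cong ≈-refl (≈-sym e) (∣-*ˡ x+1 (∣-trans sq∣r r∣)))))
    where
    Deg-x+1 : Deg x+1 1
    Deg-x+1 = Deg-∷ true Deg-1
    nope : ¬ 1 ≡ 0
    nope ()
    sq∣r : x+1 *ₚ x+1 ∣ₚ r
    sq∣r = ∣-cong H-w (Lift.Hr L) (H-∣ Deg-w (Lift.degR L) d')

  -- This is where repetitions in the list of factors are excluded: R dividing a later R' lifts to r
  -- dividing r', which puts r² into x^m + 1.
  R∤prod : ∀ {q r R rs Rs} → Lift r R → Pointwise Lift rs Rs → r *ₚ prodₚ rs ∣ₚ xⁿ+1 n₀ → ¬ R ∣ₚ prodₚ (map (_^ₚ q) Rs)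
  R∤prod {q} {r} {R} {rs} L Ls e d with prime∣prod {q = q} (Lift.prime L) (Deg>0∤1 (Lift.N>0 L) (Lift.degR L)) Ls d
  ... | r' , R' , L' , d' , r'∣ = nope (Lift.N>0 L) (double-zero _ (trans (sym (Lift.deg-r L)) (Deg⇒deg (square∣⇒Deg0 {r} (∣-trans (*-∣ (∣-refl {r}) (∣-trans r∣r' r'∣)) e)))))
    where
    nope : ∀ {N} → 1 ≤ N → ¬ N ≡ 0
    nope (s≤s _) ()
    r∣r' : r ∣ₚ r'
    r∣r' = ∣-cong (Lift.Hr L) (Lift.Hr L') (H-∣ (Lift.degR L) (Lift.degR L') d')

-- The rank generating function as a product

half-double : ∀ k → ⌊ k + k /2⌋ ≡ k
half-double zero = refl
half-double (suc k) = trans (cong (λ z → ⌊ suc z /2⌋) (ℕₚ.+-suc k k)) (cong suc (half-double k))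

half-* : ∀ x p → ⌊ x * (p + p) /2⌋ ≡ x * p
half-* x p = trans (cong ⌊_/2⌋ (ℕₚ.*-distribˡ-+ x p p)) (half-double (x * p))

-- The one property of a factor W that the product formula needs: as a functional it has the terms
-- of `S-primePower`. It is shared by `Wᵢ`, with exponent 2^t, and by the factors of the odd case,
-- with exponent 1.
Factor : ℕ → (Poly → NPoly) → Set
Factor q W = ∀ r p k → deg r ≡ p + p →
  ⟪ W r , k ⟫ ≡ k 0 + sumTo q (λ j → (2 ^ (3 * suc j * p) ∸ 2 ^ ((3 * suc j ∸ 1) * p)) * k (suc j * (p + p)))

Wᵢ-factor : ∀ t → Factor (2 ^ t) (Wᵢ t)
Wᵢ-factor t r p k e = trans (⟪⟫-monomials (λ j → 2 ^ ⌊ 3 * j * deg r /2⌋ ∸ 2 ^ ⌊ (3 * j ∸ 1) * deg r /2⌋) (λ j → j * deg r) (2 ^ t) k)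
  (cong (λ z → k 0 + z) (sumTo-cong (2 ^ t) (λ j → cong₂ _*_
    (cong₂ (λ a b → 2 ^ a ∸ 2 ^ b) (trans (cong (λ d → ⌊ 3 * suc j * d /2⌋) e) (half-* (3 * suc j) p)) (trans (cong (λ d → ⌊ (3 * suc j ∸ 1) * d /2⌋) e) (half-* (3 * suc j ∸ 1) p)))
    (cong (λ d → k (suc j * d)) e))))

W₁ᵢ : Poly → NPoly
W₁ᵢ r = oneᴺ +ᴺ mono (2 ^ ⌊ 3 * deg r /2⌋ ∸ 2 ^ deg r) (deg r)

W₁-factor : Factor 1 W₁ᵢ
W₁-factor r p k e = trans (⟪⟫-+ oneᴺ (mono (2 ^ ⌊ 3 * deg r /2⌋ ∸ 2 ^ deg r) (deg r)) k) (cong₂ _+_ (⟪⟫-one k)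
  (trans (⟪⟫-mono (2 ^ ⌊ 3 * deg r /2⌋ ∸ 2 ^ deg r) (deg r) k) (cong₂ _*_
    (cong₂ (λ a b → 2 ^ a ∸ 2 ^ b) (trans (cong (λ d → ⌊ 3 * d /2⌋) e) (half-* 3 p)) (trans e (cong (p +_) (sym (ℕₚ.+-identityʳ p)))))
    (cong k (trans e (sym (ℕₚ.+-identityʳ (p + p))))))))

total : ℕ → ∀ {rs Rs} → Pointwise Lift rs Rs → ℕ
total q [] = 0
total q (L ∷ Ls) = q * Lift.N L + total q Ls

Deg-prod : ∀ q {rs Rs} (Ls : Pointwise Lift rs Rs) → Deg (prodₚ (map (_^ₚ q) Rs)) (total q Ls)
Deg-prod q [] = Deg-1
Deg-prod q {_} {R ∷ Rs} (L ∷ Ls) = Deg-* (R ^ₚ q) (Deg-^ q (Lift.degR L)) (Deg-prod q Ls)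

module GeneratingFunction {k : ℕ} where
  open Coprimality {k} using (n₀; R∤prod; w∤prod)

  -- The induction runs over all `h` at once: peeling off a prime power leaves sums for the
  -- remaining modulus with shifted test functions, exactly as `⟪⟫-*` does for products.
  S-product : ∀ q W → Factor q W → ∀ {rs Rs} (Ls : Pointwise Lift rs Rs) → prodₚ rs ∣ₚ xⁿ+1 n₀ → ∀ h →
    S (total q Ls) (prodₚ (map (_^ₚ q) Rs)) (weighted h) ≡ ⟪ prodᴺ (map W rs) , h ⟫
  S-product q W WF [] d h = trans (cong (weighted h) (ℕₚ.0∸n≡0 (γ [] oneₚ))) (trans (ℕₚ.+-identityʳ _) (sym (⟪⟫-one h)))
  S-product q W WF {r ∷ rs} {R ∷ Rs} (L ∷ Ls) d h = begin
      S (q * N + δ') ((R ^ₚ q) *ₚ D') (weighted h)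
        ≡⟨ S-primePower (Lift.prime L) (Lift.degR L) (Deg-prod q Ls) (R∤prod {q} L Ls d) q h ⟩
      S δ' D' (weighted h) + sumTo q (λ j → c j * S δ' D' (weighted (λ x → h (suc j * (N + N) + x))))
        ≡⟨ cong₂ _+_ (IH h) (sumTo-cong q (λ j → cong (c j *_) (IH _))) ⟩
      ⟪ prodᴺ (map W rs) , h ⟫ + sumTo q (λ j → c j * ⟪ prodᴺ (map W rs) , (λ x → h (suc j * (N + N) + x)) ⟫)
        ≡⟨ sym (WF r N (λ i → ⟪ prodᴺ (map W rs) , (λ x → h (i + x)) ⟫) (Lift.deg-r L)) ⟩
      ⟪ W r , (λ i → ⟪ prodᴺ (map W rs) , (λ x → h (i + x)) ⟫) ⟫
        ≡⟨ sym (⟪⟫-* (W r) (prodᴺ (map W rs)) h) ⟩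
      ⟪ W r *ᴺ prodᴺ (map W rs) , h ⟫ ∎
    where
    open ≡-Reasoning
    N = Lift.N L
    δ' = total q Ls
    D' = prodₚ (map (_^ₚ q) Rs)
    c : ℕ → ℕ
    c j = 2 ^ (3 * suc j * N) ∸ 2 ^ ((3 * suc j ∸ 1) * N)
    IH : ∀ h → S δ' D' (weighted h) ≡ ⟪ prodᴺ (map W rs) , h ⟫
    IH = S-product q W WF Ls (∣-trans (∣-*ˡ r (∣-refl {prodₚ rs})) d)

  -- The prime w has degree 1, so its coefficients 2^{3j} - 2^{3j-1} collapse to 2^{3j-1}, those of
  -- `P₀`.
  S-W₂ : ∀ t {rs Rs} (Ls : Pointwise Lift rs Rs) → xⁿ+1 n₀ ≈ x+1 *ₚ prodₚ rs → ∀ h → let q = 2 ^ t ; T = 2 ^ (t ∸ 1) in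
    S (T * 1 + total q Ls) ((w ^ₚ T) *ₚ prodₚ (map (_^ₚ q) Rs)) (weighted h) ≡ ⟪ W₂ t rs , h ⟫
  S-W₂ t {rs} {Rs} Ls e h = begin
      S (T * 1 + δ') ((w ^ₚ T) *ₚ D') (weighted h)
        ≡⟨ S-primePower Prime-w Deg-w (Deg-prod q Ls) (w∤prod {q} Ls e) T h ⟩
      S δ' D' (weighted h) + sumTo T (λ j → (2 ^ (3 * suc j * 1) ∸ 2 ^ ((3 * suc j ∸ 1) * 1)) * S δ' D' (weighted (λ x → h (suc j * 2 + x))))
        ≡⟨ cong₂ _+_ (IH h) (sumTo-cong T (λ j → cong₂ _*_ (coefficient j) (trans (IH _) (⟪⟫-cong Π (λ x → cong (λ z → h (z + x)) (ℕₚ.*-comm (suc j) 2)))))) ⟩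
      ⟪ Π , h ⟫ + sumTo T (λ j → 2 ^ (3 * suc j ∸ 1) * ⟪ Π , (λ x → h (2 * suc j + x)) ⟫)
        ≡⟨ sym (⟪⟫-monomials (λ j → 2 ^ (3 * j ∸ 1)) (2 *_) T (λ i → ⟪ Π , (λ x → h (i + x)) ⟫)) ⟩
      ⟪ P₀ t , (λ i → ⟪ Π , (λ x → h (i + x)) ⟫) ⟫
        ≡⟨ sym (⟪⟫-* (P₀ t) Π h) ⟩
      ⟪ W₂ t rs , h ⟫ ∎
    where
    open ≡-Reasoning
    q = 2 ^ t
    T = 2 ^ (t ∸ 1)
    δ' = total q Ls
    D' = prodₚ (map (_^ₚ q) Rs)
    Π = prodᴺ (map (Wᵢ t) rs)
    IH : ∀ h → S δ' D' (weighted h) ≡ ⟪ Π , h ⟫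
    IH = S-product q (Wᵢ t) (Wᵢ-factor t) Ls (∣-cong ≈-refl (≈-sym e) (∣-*ˡ x+1 (∣-refl {prodₚ rs})))
    halve : ∀ a → 2 ^ suc a ∸ 2 ^ a ≡ 2 ^ a
    halve a = trans (ℕₚ.m+n∸m≡n (2 ^ a) (2 ^ a + 0)) (ℕₚ.+-identityʳ _)
    coefficient : ∀ j → 2 ^ (3 * suc j * 1) ∸ 2 ^ ((3 * suc j ∸ 1) * 1) ≡ 2 ^ (3 * suc j ∸ 1)
    coefficient j = trans (cong₂ (λ a b → 2 ^ a ∸ 2 ^ b) (ℕₚ.*-identityʳ (3 * suc j)) (ℕₚ.*-identityʳ (3 * suc j ∸ 1))) (halve (3 * suc j ∸ 1))

⟪⟫-*-1 : ∀ f g → ⟪ f *ᴺ g , (λ _ → 1) ⟫ ≡ ⟪ f , (λ _ → 1) ⟫ * ⟪ g , (λ _ → 1) ⟫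
⟪⟫-*-1 f g = trans (⟪⟫-* f g (λ _ → 1)) (go f)
  where
  go : ∀ f → ⟪ f , (λ _ → ⟪ g , (λ _ → 1) ⟫) ⟫ ≡ ⟪ f , (λ _ → 1) ⟫ * ⟪ g , (λ _ → 1) ⟫
  go [] = refl
  go (a ∷ f) = trans (cong (a * c +_) (go f)) (trans (sym (ℕₚ.*-distribʳ-+ c a _)) (cong (λ z → (z + ⟪ f , (λ _ → 1) ⟫) * c) (sym (ℕₚ.*-identityʳ a))))
    where c = ⟪ g , (λ _ → 1) ⟫

⟪⟫-prod-1 : ∀ (W : Poly → NPoly) rs → ⟪ prodᴺ (map W rs) , (λ _ → 1) ⟫ ≡ prodℕ (map (λ r → ⟪ W r , (λ _ → 1) ⟫) rs)
⟪⟫-prod-1 W [] = refl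
⟪⟫-prod-1 W (r ∷ rs) = trans (⟪⟫-*-1 (W r) (prodᴺ (map W rs))) (cong (⟪ W r , (λ _ → 1) ⟫ *_) (⟪⟫-prod-1 W rs))

prodℕ-cong : ∀ {A : Set} (f g : A → ℕ) rs → (∀ r → f r ≡ g r) → prodℕ (map f rs) ≡ prodℕ (map g rs)
prodℕ-cong f g [] e = refl
prodℕ-cong f g (r ∷ rs) e = cong₂ _*_ (e r) (prodℕ-cong f g rs e)

sum-monomials : ∀ (c e : ℕ → ℕ) N → ⟪ sumᴺ (oneᴺ ∷ map (λ j → mono (c j) (e j)) (range1 N)) , (λ _ → 1) ⟫ ≡ 1 + sum (map c (range1 N))
sum-monomials c e N = trans (⟪⟫-monomials c e N (λ _ → 1)) (cong suc (trans (sumTo-cong N (λ j → ℕₚ.*-identityʳ _)) (sym (sum-range1 c N))))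

telescope : ∀ p N → 1 + sumTo N (λ j → 2 ^ (suc j * p) ∸ 2 ^ (j * p)) ≡ 2 ^ (N * p)
telescope p zero = refl
telescope p (suc N) = trans (cong (_+ (2 ^ (suc N * p) ∸ 2 ^ (N * p))) (telescope p N)) (ℕₚ.m+[n∸m]≡n (ℕₚ.^-monoʳ-≤ 2 (ℕₚ.m≤n+m (N * p) p)))

-- Both sides count the residues modulo ∏ Rᵢ^{2^t}.
prod-telescope : ∀ t {rs Rs} (Ls : Pointwise Lift rs Rs) →
  prodℕ (map (λ r → 1 + sum (map (λ j → 2 ^ ⌊ j * deg r /2⌋ ∸ 2 ^ ⌊ (j ∸ 1) * deg r /2⌋) (range1 (2 ^ t)))) rs) ≡ 2 ^ total (2 ^ t) Ls
prod-telescope t [] = refl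
prod-telescope t {r ∷ rs} (L ∷ Ls) = trans (cong₂ _*_ factor (prod-telescope t Ls)) (sym (ℕₚ.^-distribˡ-+-* 2 (2 ^ t * Lift.N L) (total (2 ^ t) Ls)))
  where
  p = Lift.N L
  exponent : ∀ x → ⌊ x * deg r /2⌋ ≡ x * p
  exponent x = trans (cong (λ d → ⌊ x * d /2⌋) (Lift.deg-r L)) (half-* x p)
  factor : 1 + sum (map (λ j → 2 ^ ⌊ j * deg r /2⌋ ∸ 2 ^ ⌊ (j ∸ 1) * deg r /2⌋) (range1 (2 ^ t))) ≡ 2 ^ (2 ^ t * p)
  factor = trans (cong suc (trans (sum-range1 _ (2 ^ t)) (sumTo-cong (2 ^ t) (λ j → cong₂ (λ a b → 2 ^ a ∸ 2 ^ b) (exponent (suc j)) (exponent j))))) (telescope p (2 ^ t))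

-- A geometric series of ratio 8: 2^{3(N+1)} + 6 is 14 times 1 + Σ 2^{3j-1}, so the division by 7 is
-- exact.
P₀-total : ∀ t → (2 ^ (3 * (2 ^ (t ∸ 1) + 1)) + 6) / 7 ≡ 2 * ⟪ P₀ t , (λ _ → 1) ⟫
P₀-total t = trans (cong (_/ 7) (trans (eq T) (cong (λ z → 2 * z * 7) (sym at1)))) (DM.m*n/n≡m (2 * ⟪ P₀ t , (λ _ → 1) ⟫) 7)
  where
  T = 2 ^ (t ∸ 1)
  s : ℕ → ℕ
  s N = sumTo N (λ j → 2 ^ (3 * suc j ∸ 1))
  at1 : ⟪ P₀ t , (λ _ → 1) ⟫ ≡ 1 + s T
  at1 = trans (sum-monomials (λ j → 2 ^ (3 * j ∸ 1)) (2 *_) T) (cong suc (sum-range1 _ T))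
  open Data.Nat.Solver.+-*-Solver using (con) renaming (solve to solveℕ; _:+_ to _:+ℕ_; _:*_ to _:*ℕ_; _:=_ to _:=ℕ_)
  shape : ∀ N → 2 ^ (3 * (suc N + 1)) ≡ 2 * 2 ^ (3 * suc N ∸ 1) * 8
  shape N = trans (cong (2 ^_) e1) (ℕₚ.^-distribˡ-+-* 2 (suc (3 * suc N ∸ 1)) 3)
    where
    e1 : 3 * (suc N + 1) ≡ suc (3 * suc N ∸ 1) + 3
    e1 = trans (ℕₚ.*-distribˡ-+ 3 (suc N) 1) (cong (_+ 3) (sym (ℕₚ.m+[n∸m]≡n {1} (s≤s z≤n))))
  shape' : ∀ N → 2 ^ (3 * (N + 1)) ≡ 2 * 2 ^ (3 * suc N ∸ 1)
  shape' N = cong (2 ^_) (trans (cong (3 *_) (ℕₚ.+-comm N 1)) (sym (ℕₚ.m+[n∸m]≡n {1} (s≤s z≤n))))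
  eq : ∀ N → 2 ^ (3 * (N + 1)) + 6 ≡ 2 * (1 + s N) * 7
  eq zero = refl
  eq (suc N) = begin
      2 ^ (3 * (suc N + 1)) + 6
        ≡⟨ cong (_+ 6) (shape N) ⟩
      2 * y * 8 + 6
        ≡⟨ solveℕ 1 (λ y → con 2 :*ℕ y :*ℕ con 8 :+ℕ con 6 :=ℕ (con 2 :*ℕ y :+ℕ con 6) :+ℕ con 14 :*ℕ y) refl y ⟩
      (2 * y + 6) + 14 * y
        ≡⟨ cong (_+ 14 * y) (trans (cong (_+ 6) (sym (shape' N))) (eq N)) ⟩
      2 * (1 + s N) * 7 + 14 * y
        ≡⟨ solveℕ 2 (λ s y → con 2 :*ℕ (con 1 :+ℕ s) :*ℕ con 7 :+ℕ con 14 :*ℕ y :=ℕ con 2 :*ℕ (con 1 :+ℕ (s :+ℕ y)) :*ℕ con 7) refl (s N) y ⟩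
      2 * (1 + s (suc N)) * 7 ∎
    where
    open ≡-Reasoning
    y = 2 ^ (3 * suc N ∸ 1)

-- The formula becomes "all codewords minus those of extreme weight": deg D will be the number of
-- quadratic coefficients, and the value of `W₂` at 1 counts the words above 2^{n-1}.
A₂formula≡ : ∀ n t {rs Rs} (Ls : Pointwise Lift rs Rs) →
  A₂formula n t rs ≡ ℤ.+ (2 ^ (n + 1) * 2 ^ (2 ^ (t ∸ 1) * 1 + total (2 ^ t) Ls)) ℤ.- ℤ.+ (2 * ⟪ W₂ t rs , (λ _ → 1) ⟫)
A₂formula≡ n t {rs} Ls = cong₂ (λ a b → ℤ.+ a ℤ.- ℤ.+ b) first second
  where
  T = 2 ^ (t ∸ 1)
  first : _ ≡ 2 ^ (n + 1) * 2 ^ (T * 1 + total (2 ^ t) Ls)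
  first = trans (cong (2 ^ (n + 1 + T) *_) (prod-telescope t Ls)) (trans (sym (ℕₚ.^-distribˡ-+-* 2 (n + 1 + T) (total (2 ^ t) Ls)))
    (trans (cong (2 ^_) (trans (ℕₚ.+-assoc (n + 1) T _) (cong (λ z → n + 1 + (z + total (2 ^ t) Ls)) (sym (ℕₚ.*-identityʳ T))))) (ℕₚ.^-distribˡ-+-* 2 (n + 1) (T * 1 + total (2 ^ t) Ls))))
  second : _ ≡ 2 * ⟪ W₂ t rs , (λ _ → 1) ⟫
  second = trans (cong₂ _*_ (P₀-total t) (sym (trans (⟪⟫-prod-1 (Wᵢ t) rs) (prodℕ-cong _ _ rs (λ r → sum-monomials _ _ (2 ^ t))))))
    (trans (ℕₚ.*-assoc 2 ⟪ P₀ t , (λ _ → 1) ⟫ _) (cong (2 *_) (sym (⟪⟫-*-1 (P₀ t) (prodᴺ (map (Wᵢ t) rs))))))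

A₁formula≡ : ∀ {rs Rs} (Ls : Pointwise Lift rs Rs) → let δ = total 1 Ls ; n = 1 + (δ + δ) in
  A₁formula n rs ≡ ℤ.+ (2 ^ (n + 1) * 2 ^ δ) ℤ.- ℤ.+ (2 * ⟪ W₁ rs , (λ _ → 1) ⟫)
A₁formula≡ {rs} Ls = cong₂ (λ a b → ℤ.+ a ℤ.- ℤ.+ b) first (cong (2 *_) (second Ls))
  where
  δ = total 1 Ls
  open Data.Nat.Solver.+-*-Solver using (con) renaming (solve to solveℕ; _:+_ to _:+ℕ_; _:*_ to _:*ℕ_; _:=_ to _:=ℕ_)
  n = 1 + (δ + δ)
  first : 2 ^ ((3 * n + 1) / 2) ≡ 2 ^ (n + 1) * 2 ^ δ
  first = trans (cong (2 ^_) (trans (cong (_/ 2) (solveℕ 1 (λ d → con 3 :*ℕ (con 1 :+ℕ (d :+ℕ d)) :+ℕ con 1 :=ℕ ((con 1 :+ℕ (d :+ℕ d) :+ℕ con 1) :+ℕ d) :*ℕ con 2) refl δ))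
    (DM.m*n/n≡m ((n + 1) + δ) 2))) (ℕₚ.^-distribˡ-+-* 2 (n + 1) δ)
  second : ∀ {rs Rs} (Ls : Pointwise Lift rs Rs) → prodℕ (map (λ r → 1 + 2 ^ ⌊ 3 * deg r /2⌋ ∸ 2 ^ deg r) rs) ≡ ⟪ W₁ rs , (λ _ → 1) ⟫
  second [] = refl
  second {r ∷ rs} (L ∷ Ls) = trans (cong₂ _*_ factor (second Ls)) (sym (⟪⟫-*-1 (W₁ᵢ r) (prodᴺ (map W₁ᵢ rs))))
    where
    p = Lift.N L
    le : deg r ≤ ⌊ 3 * deg r /2⌋
    le = ℕₚ.≤-trans (ℕₚ.≤-reflexive (Lift.deg-r L)) (ℕₚ.≤-trans (ℕₚ.+-monoʳ-≤ p (ℕₚ.m≤m+n p (p + 0)))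
      (ℕₚ.≤-reflexive (sym (trans (cong (λ d → ⌊ 3 * d /2⌋) (Lift.deg-r L)) (half-* 3 p)))))
    -- The left side parses as (1 + 2^a) ∸ 2^b, and b ≤ a is what allows regrouping it as 1 + (2^a ∸
    -- 2^b).
    factor : 1 + 2 ^ ⌊ 3 * deg r /2⌋ ∸ 2 ^ deg r ≡ ⟪ W₁ᵢ r , (λ _ → 1) ⟫
    factor = trans (ℕₚ.+-∸-assoc 1 (ℕₚ.^-monoʳ-≤ 2 le)) (sym (trans (⟪⟫-+ oneᴺ (mono (2 ^ ⌊ 3 * deg r /2⌋ ∸ 2 ^ deg r) (deg r)) (λ _ → 1))
      (cong₂ _+_ (⟪⟫-one (λ _ → 1)) (trans (⟪⟫-mono (2 ^ ⌊ 3 * deg r /2⌋ ∸ 2 ^ deg r) (deg r) (λ _ → 1)) (ℕₚ.*-identityʳ _)))))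

-- Walsh sums of quadratic forms

module ℤΣ = Sum ℤₚ.+-0-isCommutativeMonoid

∑-+ᶻ : ∀ {n} (f : Vec Bool n → ℕ) → ℤΣ.∑ (λ x → ℤ.+ f x) ≡ ℤ.+ ∑ f
∑-+ᶻ f = sym (∑-hom ℕₚ.+-0-isCommutativeMonoid ℤₚ.+-0-isCommutativeMonoid ℤ.+_ ℤₚ.pos-+ f)

∑ᶻ-*ˡ : ∀ {n} c (f : Vec Bool n → ℤ) → ℤΣ.∑ (λ x → c ℤ.* f x) ≡ c ℤ.* ℤΣ.∑ f
∑ᶻ-*ˡ c f = sym (∑-hom ℤₚ.+-0-isCommutativeMonoid ℤₚ.+-0-isCommutativeMonoid (c ℤ.*_) (ℤₚ.*-distribˡ-+ c) f)

∑ᶻ-*ʳ : ∀ {n} c (f : Vec Bool n → ℤ) → ℤΣ.∑ (λ x → f x ℤ.* c) ≡ ℤΣ.∑ f ℤ.* c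
∑ᶻ-*ʳ c f = sym (∑-hom ℤₚ.+-0-isCommutativeMonoid ℤₚ.+-0-isCommutativeMonoid (ℤ._* c) (ℤₚ.*-distribʳ-+ c) f)

∑ᶻ-neg : ∀ {n} (f : Vec Bool n → ℤ) → ℤΣ.∑ (λ x → ℤ.- f x) ≡ ℤ.- ℤΣ.∑ f
∑ᶻ-neg f = sym (∑-hom ℤₚ.+-0-isCommutativeMonoid ℤₚ.+-0-isCommutativeMonoid ℤ.-_ ℤₚ.neg-distrib-+ f)

sgn : Bool → ℤ
sgn true = ℤ.-1ℤ
sgn false = ℤ.1ℤ

sgn-xor : ∀ a b → sgn (a xor b) ≡ sgn a ℤ.* sgn b
sgn-xor true true = refl
sgn-xor true false = refl
sgn-xor false true = refl
sgn-xor false false = refl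

sgn-not : ∀ a → sgn (not a) ≡ ℤ.- sgn a
sgn-not true = refl
sgn-not false = refl

≡-neg⇒0 : ∀ {i} → i ≡ ℤ.- i → i ≡ ℤ.0ℤ
≡-neg⇒0 {ℤ.+ zero} e = refl
≡-neg⇒0 {ℤ.+ suc n} ()
≡-neg⇒0 {ℤ.-[1+ n ]} ()

module _ {n} (ℓ : Vec Bool n → Bool) (ℓ-⊕ : ∀ x y → ℓ (x ⊕ y) ≡ ℓ x xor ℓ y) where

  -- Translation by `x₀` negates every term but preserves the sum.
  character-sum-0 : ∀ x₀ → ℓ x₀ ≡ true → ℤΣ.∑ (λ x → sgn (ℓ x)) ≡ ℤ.0ℤ
  character-sum-0 x₀ e = ≡-neg⇒0 (trans (sym (ℤΣ.∑-translate (λ x → sgn (ℓ x)) x₀))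
    (trans (ℤΣ.∑-cong (λ x → trans (cong sgn (trans (ℓ-⊕ x x₀) (trans (cong (ℓ x xor_) e) (𝔹ₚ.xor-comm (ℓ x) true)))) (sgn-not (ℓ x)))) (∑ᶻ-neg (λ x → sgn (ℓ x)))))

  character-sum-full : (∀ x → ℓ x ≡ false) → ℤΣ.∑ (λ x → sgn (ℓ x)) ≡ ℤ.+ (2 ^ n)
  character-sum-full e = trans (ℤΣ.∑-cong {n} {λ x → sgn (ℓ x)} {λ _ → ℤ.+ 1} (λ x → cong sgn (e x))) (trans (∑-+ᶻ {n} (λ _ → 1)) (cong ℤ.+_ (trans (∑-const n 1) (ℕₚ.*-identityʳ _))))

+[]* : ∀ {P : Set} (d : Dec P) z → P → ℤ.+ [ does d ] ℤ.* z ≡ z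
+[]* d z p = trans (cong (λ k → ℤ.+ k ℤ.* z) ([]-yes d p)) (ℤₚ.*-identityˡ z)

+[]*0 : ∀ {P : Set} (d : Dec P) z → ¬ P → ℤ.+ [ does d ] ℤ.* z ≡ ℤ.0ℤ
+[]*0 d z ¬p = trans (cong (λ k → ℤ.+ k ℤ.* z) ([]-no d ¬p)) (ℤₚ.*-zeroˡ z)

-- w = h + h/2^{k/2} with h = 2^n'
hasWeight : ℕ → ℕ → ℕ → Bool
hasWeight n' k w = (2 ^ n' <ᵇ w) ∧ (((w ∸ 2 ^ n') ^ 2) * 2 ^ k ≡ᵇ 2 ^ (2 * n'))

<ᵇ-false : ∀ m n → n ≤ m → (m <ᵇ n) ≡ false
<ᵇ-false m zero z≤n = refl
<ᵇ-false (suc m) (suc n) (s≤s p) = <ᵇ-false m n p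

<ᵇ-true : ∀ m n → m < n → (m <ᵇ n) ≡ true
<ᵇ-true zero (suc n) p = refl
<ᵇ-true (suc m) (suc n) (s≤s p) = <ᵇ-true m n p

2*≡ : ∀ a → 2 * a ≡ a + a
2*≡ a = cong (a +_) (ℕₚ.+-identityʳ a)

2^2* : ∀ m → 2 ^ (2 * m) ≡ 2 ^ m * 2 ^ m
2^2* m = trans (cong (2 ^_) (2*≡ m)) (ℕₚ.^-distribˡ-+-* 2 m m)

2^-injective : ∀ {a b} → 2 ^ a ≡ 2 ^ b → a ≡ b
2^-injective {a} {b} e with ℕₚ.<-cmp a b
... | tri≈ _ p _ = p
... | tri< p _ _ = ⊥-elim (ℕₚ.<-irrefl e (ℕₚ.^-monoʳ-< 2 (s≤s (s≤s z≤n)) p))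
... | tri> _ _ p = ⊥-elim (ℕₚ.<-irrefl (sym e) (ℕₚ.^-monoʳ-< 2 (s≤s (s≤s z≤n)) p))

hasWeight-low : ∀ n' k w → w ≤ 2 ^ n' → [ hasWeight n' k w ] ≡ 0
hasWeight-low n' k w p = cong (λ b → [ b ∧ (((w ∸ 2 ^ n') ^ 2) * 2 ^ k ≡ᵇ 2 ^ (2 * n')) ]) (<ᵇ-false (2 ^ n') w p)

-- The relation d² 2^k = h² fixes k once d is given; d is a successor so that d² can be cancelled.
hasWeight-high : ∀ n' k k' d' → let d = suc d' in d * d * 2 ^ k ≡ 2 ^ n' * 2 ^ n' → [ hasWeight n' k' (2 ^ n' + d) ] ≡ [ does (k' ℕₚ.≟ k) ]
hasWeight-high n' k k' d' e = trans (cong (λ b → [ b ∧ (((h + d ∸ h) ^ 2) * 2 ^ k' ≡ᵇ 2 ^ (2 * n')) ]) (<ᵇ-true h (h + d) (ℕₚ.m<m+n h (s≤s z≤n))))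
  ([]-cong ((((h + d ∸ h) ^ 2) * 2 ^ k') ℕₚ.≟ (2 ^ (2 * n'))) (k' ℕₚ.≟ k)
    (λ p → 2^-injective (ℕₚ.*-cancelˡ-≡ (2 ^ k') (2 ^ k) (d * d) (trans (sym (sq k')) (trans p (trans (2^2* n') (sym e))))))
    (λ { refl → trans (sq k) (trans e (sym (2^2* n'))) }))
  where
  d = suc d'
  h = 2 ^ n'
  sq : ∀ k → ((h + d ∸ h) ^ 2) * 2 ^ k ≡ d * d * 2 ^ k
  sq k = cong (_* 2 ^ k) (trans (cong (_^ 2) (ℕₚ.m+n∸m≡n h d)) (cong (d *_) (ℕₚ.*-identityʳ d)))

+-cancel : ∀ a b → ℤ.+ (a + b) ℤ.- ℤ.+ b ≡ ℤ.+ a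
+-cancel a b = trans (cong (ℤ._- ℤ.+ b) (ℤₚ.pos-+ a b)) (trans (ℤₚ.+-assoc (ℤ.+ a) (ℤ.+ b) (ℤ.- (ℤ.+ b))) (trans (cong (λ z → ℤ.+ a ℤ.+ z) (ℤₚ.+-inverseʳ (ℤ.+ b))) (ℤₚ.+-identityʳ (ℤ.+ a))))

[not]-yes : ∀ {P : Set} (d : Dec P) → P → [ not (does d) ] ≡ 0
[not]-yes (yes _) p = refl
[not]-yes (no ¬p) p = ⊥-elim (¬p p)

[not]-no : ∀ {P : Set} (d : Dec P) → ¬ P → [ not (does d) ] ≡ 1
[not]-no (yes p) ¬p = ⊥-elim (¬p p)
[not]-no (no _) ¬p = refl

-- The setting is abstract: `L` is a nondegenerate symmetric pairing, the polarisation of `q` is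
-- `L (A u) x`, its radical is the kernel of `A`, and `kerA` says that the rank is `k`.
module QuadraticForm {n'} (q : Vec Bool (suc n') → Bool) (L : Vec Bool (suc n') → Vec Bool (suc n') → Bool) (A : Vec Bool (suc n') → Vec Bool (suc n'))
  (L-⊕ : ∀ b x y → L b (x ⊕ y) ≡ L b x xor L b y) (L-sym : ∀ b x → L b x ≡ L x b) (L-nondeg : ∀ b → (∀ x → L b x ≡ false) → b ≡ 𝟎)
  (A-additive : Additive A) (polar : ∀ x u → q (x ⊕ u) ≡ (q x xor q u) xor L (A u) x)
  (k : ℕ) (kerA : ∣ker A ∣ * 2 ^ k ≡ 2 ^ suc n') where

  n : ℕ
  n = suc n'

  κ : ℕ
  κ = ∣ker A ∣

  f : Vec Bool n → Vec Bool n → Bool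
  f b x = q x xor L b x

  L-𝟎 : ∀ x → L 𝟎 x ≡ false
  L-𝟎 x = trans (L-sym 𝟎 x) (trans (cong (L x) (sym (⊕-self 𝟎))) (trans (L-⊕ x 𝟎 𝟎) (xor-self (L x 𝟎))))

  f-⊕ : ∀ b x u → f b x xor f b (x ⊕ u) ≡ f b u xor L (A u) x
  f-⊕ b x u = trans (cong₂ (λ s t → (q x xor L b x) xor (s xor t)) (polar x u) (L-⊕ b x u)) (lemma (q x) (q u) (L (A u) x) (L b x) (L b u))
    where
    open xor-∧-Solver using () renaming (solve to solve𝔹; _:+_ to _:⊻_; _:=_ to _:≡_)
    lemma : ∀ a b c d e → (a xor d) xor (((a xor b) xor c) xor (d xor e)) ≡ (b xor e) xor c
    lemma = solve𝔹 5 (λ a b c d e → (a :⊻ d) :⊻ (((a :⊻ b) :⊻ c) :⊻ (d :⊻ e)) :≡ (b :⊻ e) :⊻ c) refl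

  W : Vec Bool n → ℤ
  W b = ℤΣ.∑ (λ x → sgn (f b x))

  K : Vec Bool n → ℤ
  K b = ℤΣ.∑ (λ u → ℤ.+ [ does (A u ≟ᵛ 𝟎) ] ℤ.* sgn (f b u))

  L-sum : ∀ a → ℤΣ.∑ (λ x → sgn (L a x)) ≡ ℤ.+ [ does (a ≟ᵛ 𝟎) ] ℤ.* ℤ.+ (2 ^ n)
  L-sum a with a ≟ᵛ 𝟎
  ... | yes refl = trans (character-sum-full (L 𝟎) (L-⊕ 𝟎) L-𝟎) (sym (ℤₚ.*-identityˡ _))
  ... | no ne with search (λ x → L a x ≡ true) (λ x → L a x 𝔹ₚ.≟ true)
  ...   | inj₁ (x₀ , e) = trans (character-sum-0 (L a) (L-⊕ a) x₀ e) (sym (ℤₚ.*-zeroˡ (ℤ.+ (2 ^ n))))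
  ...   | inj₂ none = ⊥-elim (ne (L-nondeg a (λ x → 𝔹ₚ.¬-not (none x))))

  -- Substituting x + u in one factor turns the sum over x into a character sum of `L (A u)`, which
  -- vanishes unless u lies in the radical. `K` is the sum that remains.
  W² : ∀ b → W b ℤ.* W b ≡ ℤ.+ (2 ^ n) ℤ.* K b
  W² b = begin
      W b ℤ.* W b
        ≡⟨ sym (∑ᶻ-*ʳ (W b) (λ x → sgn (f b x))) ⟩
      ℤΣ.∑ (λ x → sgn (f b x) ℤ.* W b)
        ≡⟨ ℤΣ.∑-cong (λ x → trans (cong (sgn (f b x) ℤ.*_) (trans (sym (ℤΣ.∑-translate (λ u → sgn (f b u)) x)) (ℤΣ.∑-cong (λ u → cong (λ z → sgn (f b z)) (⊕-comm u x))))) (sym (∑ᶻ-*ˡ (sgn (f b x)) (λ u → sgn (f b (x ⊕ u)))))) ⟩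
      ℤΣ.∑ (λ x → ℤΣ.∑ (λ u → sgn (f b x) ℤ.* sgn (f b (x ⊕ u))))
        ≡⟨ ℤΣ.∑-cong (λ x → ℤΣ.∑-cong (λ u → trans (sym (sgn-xor (f b x) _)) (trans (cong sgn (f-⊕ b x u)) (sgn-xor (f b u) _)))) ⟩
      ℤΣ.∑ (λ x → ℤΣ.∑ (λ u → sgn (f b u) ℤ.* sgn (L (A u) x)))
        ≡⟨ ℤΣ.∑-swap (λ x u → sgn (f b u) ℤ.* sgn (L (A u) x)) ⟩
      ℤΣ.∑ (λ u → ℤΣ.∑ (λ x → sgn (f b u) ℤ.* sgn (L (A u) x)))
        ≡⟨ ℤΣ.∑-cong (λ u → trans (∑ᶻ-*ˡ (sgn (f b u)) (λ x → sgn (L (A u) x))) (trans (cong (sgn (f b u) ℤ.*_) (L-sum (A u))) (shuffle (sgn (f b u)) (ℤ.+ [ does (A u ≟ᵛ 𝟎) ])))) ⟩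
      ℤΣ.∑ (λ u → ℤ.+ (2 ^ n) ℤ.* (ℤ.+ [ does (A u ≟ᵛ 𝟎) ] ℤ.* sgn (f b u)))
        ≡⟨ ∑ᶻ-*ˡ (ℤ.+ (2 ^ n)) (λ u → ℤ.+ [ does (A u ≟ᵛ 𝟎) ] ℤ.* sgn (f b u)) ⟩
      ℤ.+ (2 ^ n) ℤ.* K b ∎
    where
    open ≡-Reasoning
    shuffle : ∀ s i → s ℤ.* (i ℤ.* ℤ.+ (2 ^ n)) ≡ ℤ.+ (2 ^ n) ℤ.* (i ℤ.* s)
    shuffle s i = trans (sym (ℤₚ.*-assoc s i _)) (trans (ℤₚ.*-comm (s ℤ.* i) _) (cong (ℤ.+ (2 ^ n) ℤ.*_) (ℤₚ.*-comm s i)))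

  -- f b is additive on the radical ker A.
  K-values : ∀ b → K b ≡ ℤ.0ℤ ⊎ K b ≡ ℤ.+ κ
  K-values b with search (λ u → A u ≡ 𝟎 × f b u ≡ true) dec
    where
    dec : ∀ u → Dec (A u ≡ 𝟎 × f b u ≡ true)
    dec u with A u ≟ᵛ 𝟎 | f b u 𝔹ₚ.≟ true
    ... | yes p | yes r = yes (p , r)
    ... | no p | _ = no (λ z → p (proj₁ z))
    ... | yes _ | no r = no (λ z → r (proj₂ z))
  ... | inj₁ (u₀ , p , e) = inj₁ (≡-neg⇒0 (trans (sym (ℤΣ.∑-translate g u₀)) (trans (ℤΣ.∑-cong flip) (∑ᶻ-neg g))))
    where
    g : Vec Bool n → ℤ
    g u = ℤ.+ [ does (A u ≟ᵛ 𝟎) ] ℤ.* sgn (f b u)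
    A-shift : ∀ u → A (u ⊕ u₀) ≡ A u
    A-shift u = trans (A-additive u u₀) (trans (cong (A u ⊕_) p) (⊕-identityʳ (A u)))
    f-shift : ∀ u → f b (u ⊕ u₀) ≡ not (f b u)
    f-shift u = lemma (f b u) (f b (u ⊕ u₀)) (trans (f-⊕ b u u₀) (cong₂ _xor_ e (trans (cong (λ a → L a u) p) (L-𝟎 u))))
      where
      lemma : ∀ s t → s xor t ≡ true → t ≡ not s
      lemma false true _ = refl
      lemma true false _ = refl
    flip : ∀ u → g (u ⊕ u₀) ≡ ℤ.- g u
    flip u = trans (cong₂ (λ a s → ℤ.+ [ does (a ≟ᵛ 𝟎) ] ℤ.* s) (A-shift u) (trans (cong sgn (f-shift u)) (sgn-not (f b u))))
      (sym (ℤₚ.neg-distribʳ-* (ℤ.+ [ does (A u ≟ᵛ 𝟎) ]) (sgn (f b u))))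
  ... | inj₂ none = inj₂ (trans (ℤΣ.∑-cong term) (∑-+ᶻ (λ u → [ does (A u ≟ᵛ 𝟎) ])))
    where
    term : ∀ u → ℤ.+ [ does (A u ≟ᵛ 𝟎) ] ℤ.* sgn (f b u) ≡ ℤ.+ [ does (A u ≟ᵛ 𝟎) ]
    term u with A u ≟ᵛ 𝟎
    ... | no _ = ℤₚ.*-zeroˡ (sgn (f b u))
    ... | yes p = trans (ℤₚ.*-identityˡ _) (cong sgn (𝔹ₚ.¬-not (λ e → none u (p , e))))

  q-𝟎 : q 𝟎 ≡ false
  q-𝟎 = trans (cong q (sym (⊕-self 𝟎))) (trans (polar 𝟎 𝟎) (trans (cong₂ _xor_ (xor-self (q 𝟎)) (trans (cong (λ a → L a 𝟎) (additive-𝟎 A-additive)) (L-𝟎 𝟎))) refl))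

  -- When K is summed over b, orthogonality of the characters leaves only u = 0, where q vanishes.
  parseval : ℤΣ.∑ (λ b → W b ℤ.* W b) ≡ ℤ.+ (2 ^ n * 2 ^ n)
  parseval = begin
      ℤΣ.∑ (λ b → W b ℤ.* W b)
        ≡⟨ ℤΣ.∑-cong W² ⟩
      ℤΣ.∑ (λ b → ℤ.+ (2 ^ n) ℤ.* K b)
        ≡⟨ ∑ᶻ-*ˡ (ℤ.+ (2 ^ n)) K ⟩
      ℤ.+ (2 ^ n) ℤ.* ℤΣ.∑ K
        ≡⟨ cong (ℤ.+ (2 ^ n) ℤ.*_) ∑K ⟩
      ℤ.+ (2 ^ n) ℤ.* ℤ.+ (2 ^ n)
        ≡⟨ sym (ℤₚ.pos-* (2 ^ n) (2 ^ n)) ⟩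
      ℤ.+ (2 ^ n * 2 ^ n) ∎
    where
    open ≡-Reasoning
    c : Vec Bool n → ℤ
    c u = ℤ.+ [ does (A u ≟ᵛ 𝟎) ] ℤ.* sgn (q u)
    at𝟎 : c 𝟎 ≡ ℤ.1ℤ
    at𝟎 = trans (+[]* (A 𝟎 ≟ᵛ 𝟎) (sgn (q 𝟎)) (additive-𝟎 A-additive)) (cong sgn q-𝟎)
    ∑K : ℤΣ.∑ K ≡ ℤ.+ (2 ^ n)
    ∑K = begin
      ℤΣ.∑ (λ b → ℤΣ.∑ (λ u → ℤ.+ [ does (A u ≟ᵛ 𝟎) ] ℤ.* sgn (f b u)))
        ≡⟨ ℤΣ.∑-swap (λ b u → ℤ.+ [ does (A u ≟ᵛ 𝟎) ] ℤ.* sgn (f b u)) ⟩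
      ℤΣ.∑ (λ u → ℤΣ.∑ (λ b → ℤ.+ [ does (A u ≟ᵛ 𝟎) ] ℤ.* sgn (f b u)))
        ≡⟨ ℤΣ.∑-cong (λ u → trans (ℤΣ.∑-cong (λ b → trans (cong (ℤ.+ [ does (A u ≟ᵛ 𝟎) ] ℤ.*_) (trans (sgn-xor (q u) (L b u)) (cong (λ z → sgn (q u) ℤ.* sgn z) (L-sym b u)))) (sym (ℤₚ.*-assoc (ℤ.+ [ does (A u ≟ᵛ 𝟎) ]) (sgn (q u)) _)))) (∑ᶻ-*ˡ (c u) (λ b → sgn (L u b)))) ⟩
      ℤΣ.∑ (λ u → c u ℤ.* ℤΣ.∑ (λ b → sgn (L u b)))
        ≡⟨ ℤΣ.∑-cong (λ u → cong (c u ℤ.*_) (L-sum u)) ⟩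
      ℤΣ.∑ (λ u → c u ℤ.* (ℤ.+ [ does (u ≟ᵛ 𝟎) ] ℤ.* ℤ.+ (2 ^ n)))
        ≡⟨ ℤΣ.∑-single _ 𝟎 (λ u ne → trans (cong (c u ℤ.*_) (+[]*0 (u ≟ᵛ 𝟎) (ℤ.+ (2 ^ n)) ne)) (ℤₚ.*-zeroʳ (c u))) ⟩
      c 𝟎 ℤ.* (ℤ.+ [ does (𝟎 {n} ≟ᵛ 𝟎) ] ℤ.* ℤ.+ (2 ^ n))
        ≡⟨ trans (cong₂ ℤ._*_ at𝟎 (+[]* (𝟎 {n} ≟ᵛ 𝟎) (ℤ.+ (2 ^ n)) refl)) (ℤₚ.*-identityˡ _) ⟩
      ℤ.+ (2 ^ n) ∎

  h : ℕ
  h = 2 ^ n'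

  wt : Vec Bool n → Bool → ℕ
  wt b c = ∑ (λ x → [ f b x xor c ])

  wt-complement : ∀ b → wt b false + wt b true ≡ h + h
  wt-complement b = trans (sym (∑-∙ (λ x → [ f b x xor false ]) (λ x → [ f b x xor true ])))
    (trans (∑-cong (λ x → lemma (f b x))) (trans (∑-const n 1) (trans (ℕₚ.*-identityʳ _) (2*≡ h))))
    where
    lemma : ∀ a → [ a xor false ] + [ a xor true ] ≡ 1
    lemma true = refl
    lemma false = refl

  W≡ : ∀ b → W b ≡ ℤ.+ wt b true ℤ.- ℤ.+ wt b false
  W≡ b = trans (ℤΣ.∑-cong (λ x → lemma (f b x))) (trans (ℤΣ.∑-∙ (λ x → ℤ.+ [ f b x xor true ]) (λ x → ℤ.- (ℤ.+ [ f b x xor false ])))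
    (cong₂ ℤ._+_ (∑-+ᶻ (λ x → [ f b x xor true ])) (trans (∑ᶻ-neg (λ x → ℤ.+ [ f b x xor false ])) (cong ℤ.-_ (∑-+ᶻ (λ x → [ f b x xor false ]))))))
    where
    lemma : ∀ a → sgn a ≡ ℤ.+ [ a xor true ] ℤ.- ℤ.+ [ a xor false ]
    lemma true = refl
    lemma false = refl

  -- W b = ±2(suc d'), where suc d' is the distance of the weights from h.
  distance : ∀ b d' → let d = suc d' in W b ℤ.* W b ≡ ℤ.+ ((d + d) * (d + d)) → ℤ.+ ((d + d) * (d + d)) ≡ ℤ.+ (2 ^ n * κ) × d * d * 2 ^ k ≡ h * h
  distance b d' e = cases (K-values b)
    where
    open ≡-Reasoning
    open Data.Nat.Solver.+-*-Solver using (con) renaming (solve to solveℕ; _:+_ to _:+ℕ_; _:*_ to _:*ℕ_; _:=_ to _:=ℕ_)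
    d = suc d'
    cases : K b ≡ ℤ.0ℤ ⊎ K b ≡ ℤ.+ κ → ℤ.+ ((d + d) * (d + d)) ≡ ℤ.+ (2 ^ n * κ) × d * d * 2 ^ k ≡ h * h
    cases (inj₁ z) = ⊥-elim (nonzero (trans (sym e) (trans (W² b) (trans (cong (ℤ.+ (2 ^ n) ℤ.*_) z) (ℤₚ.*-zeroʳ (ℤ.+ (2 ^ n)))))))
      where
      nonzero : ¬ ℤ.+ ((d + d) * (d + d)) ≡ ℤ.0ℤ
      nonzero ()
    cases (inj₂ z) = e' , ℕₚ.*-cancelˡ-≡ (d * d * 2 ^ k) (h * h) 4 (begin
        4 * (d * d * 2 ^ k)
          ≡⟨ solveℕ 2 (λ d x → con 4 :*ℕ (d :*ℕ d :*ℕ x) :=ℕ (d :+ℕ d) :*ℕ (d :+ℕ d) :*ℕ x) refl d (2 ^ k) ⟩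
        (d + d) * (d + d) * 2 ^ k
          ≡⟨ cong (_* 2 ^ k) (ℤₚ.+-injective e') ⟩
        2 ^ n * κ * 2 ^ k
          ≡⟨ trans (ℕₚ.*-assoc (2 ^ n) κ (2 ^ k)) (cong (2 ^ n *_) kerA) ⟩
        2 ^ n * 2 ^ n
          ≡⟨ solveℕ 1 (λ h → (con 2 :*ℕ h) :*ℕ (con 2 :*ℕ h) :=ℕ con 4 :*ℕ (h :*ℕ h)) refl h ⟩
        4 * (h * h) ∎)
      where
      e' : ℤ.+ ((d + d) * (d + d)) ≡ ℤ.+ (2 ^ n * κ)
      e' = trans (sym e) (trans (W² b) (trans (cong (ℤ.+ (2 ^ n) ℤ.*_) z) (sym (ℤₚ.pos-* (2 ^ n) κ))))

  -- `c` is the constant for which the word is the heavier of the two and `suc d'` its excess over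
  -- h. The two weights are indices, so that matching on `balanced` replaces both by h.
  data Shape (b : Vec Bool n) : ℕ → ℕ → Set where
    balanced : W b ℤ.* W b ≡ ℤ.0ℤ → Shape b h h
    unbalanced : ∀ c d' → let d = suc d' in W b ℤ.* W b ≡ ℤ.+ (2 ^ n * κ) → d * d * 2 ^ k ≡ h * h → wt b (not c) + d ≡ h → wt b c ≡ h + d → Shape b (wt b false) (wt b true)

  shape : ∀ b → Shape b (wt b false) (wt b true)
  shape b with ℕₚ.<-cmp (wt b false) h
  ... | tri≈ _ e _ = subst₂ (Shape b) (sym e) (sym e') (balanced (trans (cong (λ z → z ℤ.* z) W0) (ℤₚ.*-zeroˡ ℤ.0ℤ)))
    where
    e' : wt b true ≡ h
    e' = ℕₚ.+-cancelˡ-≡ h (wt b true) h (trans (cong (_+ wt b true) (sym e)) (wt-complement b))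
    W0 : W b ≡ ℤ.0ℤ
    W0 = trans (W≡ b) (trans (cong₂ (λ x y → ℤ.+ x ℤ.- ℤ.+ y) e' e) (ℤₚ.+-inverseʳ (ℤ.+ h)))
  ... | tri< lt _ _ = unbalanced true d' (trans WW (proj₁ (distance b d' WW))) (proj₂ (distance b d' WW)) e₀ e₁
    where
    d' = h ∸ suc (wt b false)
    d = suc d'
    e₀ : wt b false + d ≡ h
    e₀ = trans (ℕₚ.+-suc (wt b false) d') (ℕₚ.m+[n∸m]≡n lt)
    e₁ : wt b true ≡ h + d
    e₁ = ℕₚ.+-cancelˡ-≡ (wt b false) (wt b true) (h + d) (trans (wt-complement b) (trans (cong (_+ h) (sym e₀)) (trans (ℕₚ.+-assoc (wt b false) d h) (cong (wt b false +_) (ℕₚ.+-comm d h)))))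
    WW : W b ℤ.* W b ≡ ℤ.+ ((d + d) * (d + d))
    WW = trans (cong (λ z → z ℤ.* z) (trans (W≡ b) (trans (cong (ℤ._- ℤ.+ wt b false) (cong ℤ.+_ (trans e₁ (trans (cong (_+ d) (sym e₀)) (trans (ℕₚ.+-assoc (wt b false) d d) (ℕₚ.+-comm (wt b false) (d + d))))))) (+-cancel (d + d) (wt b false)))))
      (sym (ℤₚ.pos-* (d + d) (d + d)))
  ... | tri> _ _ gt = unbalanced false d' (trans WW (proj₁ (distance b d' WW))) (proj₂ (distance b d' WW)) e₁ e₀
    where
    d' = wt b false ∸ suc h
    d = suc d'
    e₀ : wt b false ≡ h + d
    e₀ = sym (trans (ℕₚ.+-suc h d') (ℕₚ.m+[n∸m]≡n gt))
    e₁ : wt b true + d ≡ h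
    e₁ = ℕₚ.+-cancelˡ-≡ h (wt b true + d) h (trans (cong (h +_) (ℕₚ.+-comm (wt b true) d)) (trans (sym (ℕₚ.+-assoc h d _)) (trans (cong (_+ wt b true) (sym e₀)) (wt-complement b))))
    WW : W b ℤ.* W b ≡ ℤ.+ ((d + d) * (d + d))
    WW = trans (cong (λ z → z ℤ.* z) (trans (W≡ b) (trans (cong (λ z → ℤ.+ wt b true ℤ.- ℤ.+ z) (trans e₀ (trans (cong (_+ d) (sym e₁)) (trans (ℕₚ.+-assoc (wt b true) d d) (ℕₚ.+-comm (wt b true) (d + d))))))
      (trans (sym (ℤₚ.neg-involutive _)) (cong ℤ.-_ (trans (neg-minus (ℤ.+ wt b true) (ℤ.+ ((d + d) + wt b true))) (+-cancel (d + d) (wt b true))))))))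
      (trans (neg-square (ℤ.+ (d + d))) (sym (ℤₚ.pos-* (d + d) (d + d))))
      where
      neg-minus : ∀ i j → ℤ.- (i ℤ.- j) ≡ j ℤ.- i
      neg-minus i j = trans (ℤₚ.neg-distrib-+ i (ℤ.- j)) (trans (cong (λ z → ℤ.- i ℤ.+ z) (ℤₚ.neg-involutive j)) (ℤₚ.+-comm (ℤ.- i) j))
      neg-square : ∀ i → (ℤ.- i) ℤ.* (ℤ.- i) ≡ i ℤ.* i
      neg-square i = trans (sym (ℤₚ.neg-distribˡ-* i (ℤ.- i))) (trans (cong ℤ.-_ (sym (ℤₚ.neg-distribʳ-* i i))) (ℤₚ.neg-involutive (i ℤ.* i)))

  nz : Vec Bool n → ℕ
  nz b = [ not (does (wt b false ℕₚ.≟ h)) ]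

  h≢h+d : ∀ {d'} → h + suc d' ≢ h
  h≢h+d {d'} e = ℕₚ.<-irrefl (sym e) (ℕₚ.m<m+n h (s≤s z≤n))

  d+≢h : ∀ {u d'} → u + suc d' ≡ h → u ≢ h
  d+≢h {u} e p = h≢h+d (trans (cong (_+ _) (sym p)) e)

  ≢⇒not : ∀ {u} → u ≢ h → [ not (does (u ℕₚ.≟ h)) ] ≡ 1
  ≢⇒not {u} = [not]-no (u ℕₚ.≟ h)

  ≡⇒not : [ not (does (h ℕₚ.≟ h)) ] ≡ 0
  ≡⇒not = [not]-yes (h ℕₚ.≟ h) refl

  -- What the two words belonging to one b contribute to the extreme count, to the balanced count
  -- and to Parseval's sum, all expressed through the bit telling whether they are unbalanced.
  Statistics : ℕ → ℤ → ℕ → ℕ → Set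
  Statistics k' ww u v =
    [ hasWeight n' k' u ] + [ hasWeight n' k' v ] ≡ [ does (k' ℕₚ.≟ k) ] * [ not (does (u ℕₚ.≟ h)) ]
    × ([ u ≡ᵇ h ] + [ v ≡ᵇ h ]) + 2 * [ not (does (u ℕₚ.≟ h)) ] ≡ 2
    × ww ≡ ℤ.+ (2 ^ n * κ * [ not (does (u ℕₚ.≟ h)) ])

  statistics : ∀ k' b {u v} → Shape b u v → Statistics k' (W b ℤ.* W b) u v
  statistics k' b (balanced e) =
    trans (cong₂ _+_ (hasWeight-low n' k' h ℕₚ.≤-refl) (hasWeight-low n' k' h ℕₚ.≤-refl)) (sym (trans (cong ([ does (k' ℕₚ.≟ k) ] *_) ≡⇒not) (ℕₚ.*-zeroʳ [ does (k' ℕₚ.≟ k) ]))) ,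
    cong₂ (λ x y → (x + x) + 2 * y) ([]-yes (h ℕₚ.≟ h) refl) ≡⇒not ,
    trans e (cong ℤ.+_ (sym (trans (cong (2 ^ n * κ *_) ≡⇒not) (ℕₚ.*-zeroʳ (2 ^ n * κ)))))
  statistics k' b (unbalanced c d' ww dd e₀ e₁) = weights c e₀ e₁ ,
    cong₂ (λ x y → x + 2 * y) (cong₂ _+_ ([]-no (wt b false ℕₚ.≟ h) (off c e₀ e₁ false)) ([]-no (wt b true ℕₚ.≟ h) (off c e₀ e₁ true))) (≢⇒not (off c e₀ e₁ false)) ,
    trans ww (cong ℤ.+_ (sym (trans (cong (2 ^ n * κ *_) (≢⇒not (off c e₀ e₁ false))) (ℕₚ.*-identityʳ _))))
    where
    off : ∀ c → wt b (not c) + suc d' ≡ h → wt b c ≡ h + suc d' → ∀ c' → wt b c' ≢ h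
    off false e₀ e₁ false p = h≢h+d (trans (sym e₁) p)
    off false e₀ e₁ true = d+≢h e₀
    off true e₀ e₁ false = d+≢h e₀
    off true e₀ e₁ true p = h≢h+d (trans (sym e₁) p)
    light : ∀ {u} → u + suc d' ≡ h → [ hasWeight n' k' u ] ≡ 0
    light {u} e = hasWeight-low n' k' u (ℕₚ.≤-trans (ℕₚ.m≤m+n u (suc d')) (ℕₚ.≤-reflexive e))
    heavy : ∀ {u} → u ≡ h + suc d' → [ hasWeight n' k' u ] ≡ [ does (k' ℕₚ.≟ k) ]
    heavy e = trans (cong (λ z → [ hasWeight n' k' z ]) e) (hasWeight-high n' k k' d' dd)
    rhs : ∀ {u} → u ≢ h → [ does (k' ℕₚ.≟ k) ] ≡ [ does (k' ℕₚ.≟ k) ] * [ not (does (u ℕₚ.≟ h)) ]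
    rhs ne = sym (trans (cong ([ does (k' ℕₚ.≟ k) ] *_) (≢⇒not ne)) (ℕₚ.*-identityʳ _))
    weights : ∀ c → wt b (not c) + suc d' ≡ h → wt b c ≡ h + suc d' →
      [ hasWeight n' k' (wt b false) ] + [ hasWeight n' k' (wt b true) ] ≡ [ does (k' ℕₚ.≟ k) ] * [ not (does (wt b false ℕₚ.≟ h)) ]
    weights true e₀ e₁ = trans (cong₂ _+_ (light e₀) (heavy e₁)) (rhs (off true e₀ e₁ false))
    weights false e₀ e₁ = trans (cong₂ _+_ (heavy e₁) (light e₀)) (trans (ℕₚ.+-identityʳ _) (rhs (off false e₀ e₁ false)))

  κ>0 : κ ≢ 0
  κ>0 z = ℕₚ.<-irrefl (trans (cong (_* 2 ^ k) (sym z)) kerA) (ℕₚ.m^n>0 2 n)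

  ∑nz : ∑ nz ≡ 2 ^ k
  ∑nz = ℕₚ.*-cancelˡ-≡ (∑ nz) (2 ^ k) (2 ^ n * κ) ⦃ ℕₚ.m*n≢0 (2 ^ n) κ ⦃ ℕₚ.m^n≢0 2 n ⦄ ⦃ ≢-nonZero κ>0 ⦄ ⦄ (begin
      2 ^ n * κ * ∑ nz
        ≡⟨ sym (∑-*ˡ (2 ^ n * κ) nz) ⟩
      ∑ (λ b → 2 ^ n * κ * nz b)
        ≡⟨ ℤₚ.+-injective (trans (sym (∑-+ᶻ (λ b → 2 ^ n * κ * nz b))) (trans (ℤΣ.∑-cong (λ b → sym (proj₂ (proj₂ (statistics 0 b (shape b)))))) parseval)) ⟩
      2 ^ n * 2 ^ n
        ≡⟨ trans (cong (2 ^ n *_) (sym kerA)) (sym (ℕₚ.*-assoc (2 ^ n) κ (2 ^ k))) ⟩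
      2 ^ n * κ * 2 ^ k ∎)
    where open ≡-Reasoning

  count-weight : ∀ k' → ∑ (λ b → [ hasWeight n' k' (wt b false) ] + [ hasWeight n' k' (wt b true) ]) ≡ [ does (k' ℕₚ.≟ k) ] * 2 ^ k
  count-weight k' = trans (∑-cong (λ b → proj₁ (statistics k' b (shape b)))) (trans (∑-*ˡ [ does (k' ℕₚ.≟ k) ] nz) (cong ([ does (k' ℕₚ.≟ k) ] *_) ∑nz))

  count-balanced : ∑ (λ b → [ wt b false ≡ᵇ h ] + [ wt b true ≡ᵇ h ]) + 2 * 2 ^ k ≡ 2 ^ (n + 1)
  count-balanced = trans (cong (λ z → ∑ bal + 2 * z) (sym ∑nz)) (trans (cong (∑ bal +_) (sym (∑-*ˡ 2 nz))) (trans (sym (∑-∙ bal (λ b → 2 * nz b)))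
    (trans (∑-cong (λ b → proj₁ (proj₂ (statistics 0 b (shape b))))) (trans (∑-const n 2) (sym (ℕₚ.^-distribˡ-+-* 2 n 1))))))
    where
    bal : Vec Bool n → ℕ
    bal b = [ wt b false ≡ᵇ h ] + [ wt b true ≡ᵇ h ]

-- The operator ω, the radicals and the polarisation of the trace forms

module Operators {n'} (plow : Vec Bool (suc n')) (irr : Irreducible (modulusPoly plow)) where
  open Field plow
  open FiniteField plow irr

  -- ω = φ + φ⁻¹

  ω : F → F
  ω x = φ x ⊕ frob n' x

  ω-additive : Additive ω
  ω-additive x y = trans (cong₂ _⊕_ (φ-additive x y) (frob-additive n' x y)) (⊕-interchange (φ x) (φ y) (frob n' x) (frob n' y))

  module Aω = Action ω ω-additive

  frob-ω : ∀ i x → frob i (ω x) ≡ ω (frob i x)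
  frob-ω i x = trans (frob-additive i (φ x) (frob n' x)) (cong₂ _⊕_ (frob-comm i 1 x) (frob-comm i n' x))

  φω : ∀ x → φ (ω x) ≡ φ (φ x) ⊕ x
  φω x = trans (φ-additive (φ x) (frob n' x)) (cong (φ (φ x) ⊕_) (frob-n x))

  frob-·ᵇ : ∀ i c x → frob i (c ·ᵇ x) ≡ c ·ᵇ frob i x
  frob-·ᵇ i true x = refl
  frob-·ᵇ i false x = frob-𝟎 i

  ω-·ᵇ : ∀ c x → ω (c ·ᵇ x) ≡ c ·ᵇ ω x
  ω-·ᵇ true x = refl
  ω-·ᵇ false x = Aω.T-𝟎

  act-xpow : ∀ N v → Aφ.act (xpow N) v ≡ frob N v
  act-xpow zero v = Aφ.act-1 v
  act-xpow (suc N) v = trans (Aφ.act-shift (xpow N) v) (cong φ (act-xpow N v))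

  act-xⁿ+1 : ∀ v → Aφ.act (xⁿ+1 n) v ≡ 𝟎
  act-xⁿ+1 v = trans (Aφ.act-+ oneₚ (xpow n) v) (trans (cong₂ _⊕_ (Aφ.act-1 v) (trans (act-xpow n v) (frob-n v))) (⊕-self v))

  act-Y : ∀ v → Aφ.act Y v ≡ φ (φ v) ⊕ v
  act-Y v = trans (Aφ.act-≈ v Y≈) (trans (Aφ.act-+ oneₚ (xpow 2) v) (trans (cong₂ _⊕_ (Aφ.act-1 v) (act-xpow 2 v)) (⊕-comm v _)))
    where
    Y≈ : Y ≈ oneₚ +ₚ xpow 2
    Y≈ = ≈ₚ⇒≈ Y (oneₚ +ₚ xpow 2) refl

  act-const : ∀ c v → Aω.act (c ∷ []) v ≡ c ·ᵇ v
  act-const c v = trans (cong (λ z → (c ·ᵇ v) ⊕ z) Aω.T-𝟎) (⊕-identityʳ (c ·ᵇ v))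

  -- At x = φ the polynomial x^N s(x + 1/x) becomes φ^N s(ω). The induction step is φ ω = φ² + 1.
  act-H : ∀ N s v → Bounded s N → Aφ.act (H N s) v ≡ frob N (Aω.act s v)
  act-H N [] v b = sym (frob-𝟎 N)
  act-H zero (c ∷ s) v b = trans (Aφ.act-scale c (xpow 0) v) (trans (cong (c ·ᵇ_) (Aφ.act-1 v))
    (sym (trans (Aω.act-≈ v (∷-cong refl (Bounded-tail₀ {c} b))) (act-const c v))))
  act-H (suc N) (c ∷ s) v b = begin
      Aφ.act (scaleₚ c (xpow (suc N)) +ₚ (Y *ₚ H N s)) v
        ≡⟨ Aφ.act-+ (scaleₚ c (xpow (suc N))) (Y *ₚ H N s) v ⟩
      Aφ.act (scaleₚ c (xpow (suc N))) v ⊕ Aφ.act (Y *ₚ H N s) v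
        ≡⟨ cong₂ _⊕_ (trans (Aφ.act-scale c (xpow (suc N)) v) (trans (cong (c ·ᵇ_) (act-xpow (suc N) v)) (sym (frob-·ᵇ (suc N) c v))))
             (trans (Aφ.act-* Y (H N s) v) (trans (cong (Aφ.act Y) (act-H N s v (Bounded-tail {c} b))) (trans (act-Y (frob N u)) step))) ⟩
      frob (suc N) (c ·ᵇ v) ⊕ frob (suc N) (ω u)
        ≡⟨ sym (frob-additive (suc N) (c ·ᵇ v) (ω u)) ⟩
      frob (suc N) ((c ·ᵇ v) ⊕ ω u) ∎
    where
    open ≡-Reasoning
    u = Aω.act s v
    step : φ (φ (frob N u)) ⊕ frob N u ≡ frob (suc N) (ω u)
    step = sym (trans (frob-comm 1 N (ω u)) (trans (cong (frob N) (φω u)) (trans (frob-additive N (φ (φ u)) u) (cong (_⊕ frob N u) (frob-comm N 2 u)))))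

  ω-kernel : ∀ {s d} → Deg s d → ∣ker Aω.act s ∣ ≤ 2 ^ (d + d)
  ω-kernel {s} {d} D = ℕₚ.≤-trans
    (∣ker∣-mono (Aω.act s) (Aφ.act (H d s)) (λ x e → trans (act-H d s x (Deg⇒Bounded D)) (trans (cong (frob d) e) (frob-𝟎 d))))
    (φ-kernel (Deg-H d s D))

  act-U : ∀ N v → N ≤ n → ω (Aω.act (U N) v) ≡ frob N v ⊕ frob (n ∸ N) v
  act-U N v N≤ = ⊕≡𝟎⇒≡ (frob≡𝟎 N _ (trans (frob-additive N (ω (Aω.act (U N) v)) _) (trans (cong₂ _⊕_ lhs rhs) (⊕-self (v ⊕ frob (N + N) v)))))
    where
    lhs : frob N (ω (Aω.act (U N) v)) ≡ v ⊕ frob (N + N) v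
    lhs = trans (cong (frob N) (sym (Aω.act-shift (U N) v))) (trans (sym (act-H N (false ∷ U N) v (Bounded-U N)))
      (trans (Aφ.act-≈ v (H-U N)) (trans (Aφ.act-+ oneₚ (xpow (N + N)) v) (cong₂ _⊕_ (Aφ.act-1 v) (act-xpow (N + N) v)))))
    rhs : frob N (frob N v ⊕ frob (n ∸ N) v) ≡ v ⊕ frob (N + N) v
    rhs = trans (frob-additive N (frob N v) (frob (n ∸ N) v)) (trans (cong₂ _⊕_ (sym (frob-+ N N v))
      (trans (sym (frob-+ N (n ∸ N) v)) (trans (cong (λ k → frob k v) (ℕₚ.m+[n∸m]≡n N≤)) (frob-n v)))) (⊕-comm (frob (N + N) v) v))

  -- The power of φ stays existential: it is injective and so changes no kernel, and powers simply
  -- add in products.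
  Represents : Poly → Poly → Set
  Represents f s = ∃ λ N → ∀ v → Aφ.act f v ≡ frob N (Aω.act s v)

  Represents-* : ∀ {f g s t} → Represents f s → Represents g t → Represents (f *ₚ g) (s *ₚ t)
  Represents-* {f} {g} {s} {t} (N , e) (M , e') = N + M , λ v → begin
      Aφ.act (f *ₚ g) v                               ≡⟨ Aφ.act-* f g v ⟩
      Aφ.act f (Aφ.act g v)                           ≡⟨ cong (Aφ.act f) (e' v) ⟩
      Aφ.act f (frob M (Aω.act t v))                  ≡⟨ e (frob M (Aω.act t v)) ⟩
      frob N (Aω.act s (frob M (Aω.act t v)))         ≡⟨ cong (frob N) (Aω.act-commute (frob M) (frob-additive M) (frob-ω M) s (Aω.act t v)) ⟩
      frob N (frob M (Aω.act s (Aω.act t v)))         ≡⟨ sym (frob-+ N M _) ⟩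
      frob (N + M) (Aω.act s (Aω.act t v))            ≡⟨ cong (frob (N + M)) (sym (Aω.act-* s t v)) ⟩
      frob (N + M) (Aω.act (s *ₚ t) v)                ∎
    where open ≡-Reasoning

  Represents-cong : ∀ {f f' s} → f ≈ f' → Represents f s → Represents f' s
  Represents-cong e (N , r) = N , λ v → trans (Aφ.act-≈ v (≈-sym e)) (r v)

  Represents-1 : Represents oneₚ oneₚ
  Represents-1 = 0 , λ v → trans (Aφ.act-1 v) (sym (Aω.act-1 v))

  Represents-^ : ∀ {f s} k → Represents f s → Represents (f ^ₚ k) (s ^ₚ k)
  Represents-^ zero r = Represents-1
  Represents-^ {f} {s} (suc k) r = Represents-* {f} {f ^ₚ k} {s} {s ^ₚ k} r (Represents-^ k r)

  Represents-H : ∀ {f N s} → Bounded s N → H N s ≈ f → Represents f s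
  Represents-H {f} {N} {s} b e = N , λ v → trans (Aφ.act-≈ v (≈-sym e)) (act-H N s v b)

  Represents-prod : ∀ k {rs Rs} → Pointwise Lift rs Rs → Represents (prodₚ (map (_^ₚ k) rs)) (prodₚ (map (_^ₚ k) Rs))
  Represents-prod k [] = Represents-1
  Represents-prod k {r ∷ rs} {R ∷ Rs} (L ∷ Ls) = Represents-* {r ^ₚ k} {_} {R ^ₚ k}
    (Represents-^ k (Represents-H (Deg⇒Bounded (Lift.degR L)) (Lift.Hr L))) (Represents-prod k Ls)

  Represents-w : Represents (x+1 *ₚ x+1) w
  Represents-w = Represents-H {N = 1} (Deg⇒Bounded Deg-w) H-w

  annihilates : ∀ {s} → Represents (xⁿ+1 n) s → ∀ v → Aω.act s v ≡ 𝟎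
  annihilates (N , e) v = frob≡𝟎 N _ (trans (sym (e v)) (act-xⁿ+1 v))

  -- `T` is what the factorisation of x^n + 1 leaves outside D: the identity with e = 0 for even n,
  -- and φ + 1 with e = 1 for odd n.
  module Radical (T : F → F) (T-additive : Additive T) (e : ℕ) (kerT : ∣ker T ∣ ≤ 2 ^ e) {D δ} (degD : Deg D δ)
    (n≡ : e + (δ + δ) ≡ n) (TD : ∀ v → T (Aω.act D v) ≡ 𝟎) where

    ker-gcd : ∀ {s g} → IsGcd s D g → ∣ker (λ v → T (Aω.act g v)) ∣ * 2 ^ ((δ ∸ γ s D) + (δ ∸ γ s D)) ≡ 2 ^ n
    ker-gcd {s} {g} G = trans (cong₂ _*_ (ℕₚ.≤-antisym upper lower) (cong (2 ^_) ρρ)) (sym split)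
      where
      nzD = Deg-≉ degD
      nzg : ¬ g ≈ []
      nzg z = nzD (≈-trans (proj₂ (∣b G)) (≈-trans (*-congˡ (proj₁ (∣b G)) z) (*-zeroʳ (proj₁ (∣b G)))))
      dg = deg g
      Dg : Deg g dg
      Dg = ≉⇒Deg g nzg
      cofactor = ∣-Deg (∣b G) Dg degD
      c = proj₁ cofactor
      ρ = δ ∸ dg
      ρρ : (δ ∸ γ s D) + (δ ∸ γ s D) ≡ ρ + ρ
      ρρ = cong (λ z → (δ ∸ z) + (δ ∸ z)) (γ-unique nzD G)
      δ≡ : dg + ρ ≡ δ
      δ≡ = proj₁ (proj₂ (proj₂ cofactor))
      κ = ∣ker (λ v → T (Aω.act g v)) ∣
      upper : κ ≤ 2 ^ (e + (dg + dg))
      upper = ℕₚ.≤-trans (∣ker-∘∣ T (Aω.act g) (Aω.act-additive g)) (ℕₚ.≤-trans (ℕₚ.*-mono-≤ kerT (ω-kernel Dg)) (ℕₚ.≤-reflexive (sym (ℕₚ.^-distribˡ-+-* 2 e (dg + dg)))))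
      split : 2 ^ n ≡ 2 ^ (e + (dg + dg)) * 2 ^ (ρ + ρ)
      split = trans (cong (2 ^_) (trans (sym n≡) (trans (cong (e +_) (trans (cong (λ z → z + z) (sym δ≡)) (interchange dg ρ dg ρ))) (sym (ℕₚ.+-assoc e (dg + dg) (ρ + ρ))))))
        (ℕₚ.^-distribˡ-+-* 2 (e + (dg + dg)) (ρ + ρ))
      -- The composite T g(ω) c(ω) = T D(ω) kills all 2^n vectors, and the cofactor c accounts for
      -- at most 4^ρ of this.
      lower : 2 ^ (e + (dg + dg)) ≤ κ
      lower = ℕₚ.*-cancelʳ-≤ (2 ^ (e + (dg + dg))) κ (2 ^ (ρ + ρ)) ⦃ ℕₚ.m^n≢0 2 (ρ + ρ) ⦄
        (ℕₚ.≤-trans (ℕₚ.≤-reflexive (trans (sym split) (sym (∣ker∣-full (λ v → T (Aω.act g (Aω.act c v))) all𝟎))))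
          (ℕₚ.≤-trans (∣ker-∘∣ (λ v → T (Aω.act g v)) (Aω.act c) (Aω.act-additive c)) (ℕₚ.*-monoʳ-≤ κ (ω-kernel (proj₁ (proj₂ cofactor))))))
        where
        all𝟎 : ∀ v → T (Aω.act g (Aω.act c v)) ≡ 𝟎
        all𝟎 v = trans (cong T (trans (sym (Aω.act-* g c v)) (Aω.act-≈ v (≈-trans (*-comm g c) (≈-sym (proj₂ (proj₂ (proj₂ cofactor)))))))) (TD v)

  bezout-act : ∀ {s D g} (G : IsGcd s D g) v → Aω.act g v ≡ Aω.act (proj₁ (bezout G)) (Aω.act s v) ⊕ Aω.act (proj₁ (proj₂ (bezout G))) (Aω.act D v)
  bezout-act {s} {D} G v = trans (Aω.act-≈ v (proj₂ (proj₂ (bezout G)))) (trans (Aω.act-+ (proj₁ (bezout G) *ₚ s) _ v)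
    (cong₂ _⊕_ (Aω.act-* (proj₁ (bezout G)) s v) (Aω.act-* (proj₁ (proj₂ (bezout G))) D v)))

  -- Because D(ω) = 0, Bézout identifies the kernels of s(ω) and g(ω). `B` stands for the polar map,
  -- which agrees with s(ω) only up to a power of φ.
  radical-even : ∀ {D δ} → Deg D δ → δ + δ ≡ n → (∀ v → Aω.act D v ≡ 𝟎) → ∀ s (B : F → F) →
    (∀ v → B v ≡ 𝟎 → Aω.act s v ≡ 𝟎) → (∀ v → Aω.act s v ≡ 𝟎 → B v ≡ 𝟎) → ∣ker B ∣ * 2 ^ ((δ ∸ γ s D) + (δ ∸ γ s D)) ≡ 2 ^ n
  radical-even {D} {δ} degD n≡ D𝟎 s B to from = trans (cong (_* 2 ^ ((δ ∸ γ s D) + (δ ∸ γ s D))) (∣ker∣-cong B (Aω.act g) to' from'))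
    (Radical.ker-gcd (λ x → x) (λ x y → refl) 0 (ℕₚ.≤-reflexive (∑-δ (𝟎 {n}))) degD n≡ D𝟎 G)
    where
    g = proj₁ (gcdₚ s D)
    G = proj₂ (gcdₚ s D)
    to' : ∀ v → B v ≡ 𝟎 → Aω.act g v ≡ 𝟎
    to' v z = trans (bezout-act G v) (trans (cong₂ _⊕_ (trans (cong (Aω.act (proj₁ (bezout G))) (to v z)) (Aω.act-𝟎 (proj₁ (bezout G))))
      (trans (cong (Aω.act (proj₁ (proj₂ (bezout G)))) (D𝟎 v)) (Aω.act-𝟎 (proj₁ (proj₂ (bezout G)))))) (⊕-self (𝟎 {n})))
    from' : ∀ v → Aω.act g v ≡ 𝟎 → B v ≡ 𝟎
    from' v z = from v (trans (Aω.act-≈ v (proj₂ (∣a G))) (trans (Aω.act-* (proj₁ (∣a G)) g v) (trans (cong (Aω.act (proj₁ (∣a G))) z) (Aω.act-𝟎 (proj₁ (∣a G))))))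

  φ+1 : F → F
  φ+1 x = φ x ⊕ x

  φ+1-additive : Additive φ+1
  φ+1-additive x y = trans (cong (_⊕ (x ⊕ y)) (φ-additive x y)) (⊕-interchange (φ x) (φ y) x y)

  φ+1-kernel : ∣ker φ+1 ∣ ≤ 2 ^ 1
  φ+1-kernel = ℕₚ.≤-trans (∣ker∣-mono φ+1 (Aφ.act x+1) (λ v z → trans (act-x+1 v) z)) (φ-kernel {x+1} {1} (Deg-∷ true Deg-1))
    where
    act-x+1 : ∀ v → Aφ.act x+1 v ≡ φ+1 v
    act-x+1 v = trans (cong (λ z → v ⊕ φ z) (Aφ.act-1 v)) (⊕-comm v (φ v))

  φ+1-fixed : ∀ v → φ+1 v ≡ 𝟎 → ω v ≡ 𝟎
  φ+1-fixed v z = φ≡𝟎 (ω v) (trans (φω v) (trans (cong (_⊕ v) (trans (cong φ fix) fix)) (⊕-self v)))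
    where
    fix : φ v ≡ v
    fix = ⊕≡𝟎⇒≡ z

  act-φ+1 : ∀ s v → Aω.act s (φ+1 v) ≡ φ+1 (Aω.act s v)
  act-φ+1 = Aω.act-commute φ+1 φ+1-additive (λ v → sym (trans (ω-additive (φ v) v) (cong (_⊕ ω v) (sym (frob-ω 1 v)))))

  -- x^n + 1 = (x + 1) x^δ D(w), and w is prime to D, so gcd(w s, D) = gcd(s, D).
  radical-odd : ∀ {D δ} → Deg D δ → 1 + (δ + δ) ≡ n → ¬ w ∣ₚ D → (∀ v → φ+1 (Aω.act D v) ≡ 𝟎) → ∀ s →
    ∣ker (λ v → ω (Aω.act s v)) ∣ * 2 ^ ((δ ∸ γ s D) + (δ ∸ γ s D)) ≡ 2 ^ n
  radical-odd {D} {δ} degD n≡ w∤D D𝟎 s = trans (cong (_* 2 ^ ((δ ∸ γ s D) + (δ ∸ γ s D))) (∣ker∣-cong (λ v → ω (Aω.act s v)) (λ v → φ+1 (Aω.act g v)) to from))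
    (Radical.ker-gcd φ+1 φ+1-additive 1 φ+1-kernel degD n≡ D𝟎 G)
    where
    g = proj₁ (gcdₚ s D)
    G : IsGcd s D g
    G = proj₂ (gcdₚ s D)
    coprime : Coprime w D
    coprime = lemma (Prime-w D)
      where
      lemma : w ∣ₚ D ⊎ Coprime w D → Coprime w D
      lemma (inj₁ d) = ⊥-elim (w∤D d)
      lemma (inj₂ c) = c
    Gw : IsGcd (w *ₚ s) D g
    Gw = IsGcd-sym (IsGcd-coprimeʳ coprime (IsGcd-sym G))
    act-w : ∀ f v → Aω.act (w *ₚ f) v ≡ ω (Aω.act f v)
    act-w f v = trans (Aω.act-≈ v (X* f)) (Aω.act-shift f v)
    -- Bézout for w s and D, followed by φ + 1, which annihilates the part coming from D(ω).
    to : ∀ v → ω (Aω.act s v) ≡ 𝟎 → φ+1 (Aω.act g v) ≡ 𝟎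
    to v z = trans (cong φ+1 (bezout-act Gw v)) (trans (φ+1-additive a b) (trans (cong₂ _⊕_ (trans (cong φ+1 a≡) (additive-𝟎 φ+1-additive))
        (trans (sym (act-φ+1 B (Aω.act D v))) (trans (cong (Aω.act B) (D𝟎 v)) (Aω.act-𝟎 B)))) (⊕-self (𝟎 {n}))))
      where
      A = proj₁ (bezout Gw)
      B = proj₁ (proj₂ (bezout Gw))
      a = Aω.act A (Aω.act (w *ₚ s) v)
      b = Aω.act B (Aω.act D v)
      a≡ : a ≡ 𝟎
      a≡ = trans (cong (Aω.act A) (trans (act-w s v) z)) (Aω.act-𝟎 A)
    -- A vector killed by φ + 1 is fixed by φ, so ω sends it to y + y = 0.
    from : ∀ v → φ+1 (Aω.act g v) ≡ 𝟎 → ω (Aω.act s v) ≡ 𝟎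
    from v z = trans (cong ω (trans (Aω.act-≈ v (proj₂ (∣a G))) (Aω.act-* q g v))) (trans (sym (Aω.act-commute ω ω-additive (λ _ → refl) q (Aω.act g v)))
      (trans (cong (Aω.act q) (φ+1-fixed (Aω.act g v) z)) (Aω.act-𝟎 q)))
      where q = proj₁ (∣a G)

  -- A nonzero s of degree at most d leaves a kernel of at most 4^d < 2^n vectors. Hence different
  -- coefficients give different polar maps.
  ω-injective : ∀ s d → Bounded s d → d + d < n → (∀ v → Aω.act s v ≡ 𝟎) → s ≈ []
  ω-injective s d b lt z = lemma (Bounded-⊎ s b)
    where
    lemma : s ≈ [] ⊎ (∃ λ d' → d' ≤ d × Deg s d') → s ≈ []
    lemma (inj₁ z) = z
    lemma (inj₂ (d' , le , D)) = ⊥-elim (ℕₚ.<-irrefl refl (ℕₚ.<-≤-trans (ℕₚ.^-monoʳ-< 2 (s≤s (s≤s z≤n)) lt)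
      (ℕₚ.≤-trans (ℕₚ.≤-reflexive (sym (∣ker∣-full (Aω.act s) z))) (ℕₚ.≤-trans (ω-kernel D) (ℕₚ.^-monoʳ-≤ 2 (ℕₚ.+-mono-≤ le le))))))

  -- Polarisation of the trace forms

  -- The polar map of Σ cⱼ x^{2^{f j}+1}, where φ^{n-i} is the adjoint of φ^i under the trace. The
  -- index function `f` lets the recursion on coefficients shift the exponents.
  Lin : ∀ {K} → (ℕ → ℕ) → Vec Bool K → F → F
  Lin f [] u = 𝟎
  Lin f (c ∷ a) u = (c ·ᵇ (frob (f 0) u ⊕ frob (n ∸ f 0) u)) ⊕ Lin (f ∘ suc) a u

  ·ᵇ-additive : ∀ {f : F → F} → Additive f → ∀ c → Additive (λ u → c ·ᵇ f u)
  ·ᵇ-additive {f} add c x y = trans (cong (c ·ᵇ_) (add x y)) (·ᵇ-⊕ c (f x) (f y))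

  ⊕-additive : ∀ {f g : F → F} → Additive f → Additive g → Additive (λ u → f u ⊕ g u)
  ⊕-additive {f} {g} add add' x y = trans (cong₂ _⊕_ (add x y) (add' x y)) (⊕-interchange (f x) (f y) (g x) (g y))

  Lin-additive : ∀ {K} f (a : Vec Bool K) → Additive (Lin f a)
  Lin-additive f [] x y = sym (⊕-self (𝟎 {n}))
  Lin-additive f (c ∷ a) = ⊕-additive (·ᵇ-additive (⊕-additive (frob-additive (f 0)) (frob-additive (n ∸ f 0))) c) (Lin-additive (f ∘ suc) a)

  golds : ∀ {K} → (ℕ → ℕ) → Vec Bool K → F → F
  golds f [] x = 𝟎
  golds f (c ∷ a) x = (c ·ᵇ gold (f 0) x) ⊕ golds (f ∘ suc) a x

  goldSum≡ : ∀ {K} (a : Vec Bool K) x → goldSum a x ≡ golds suc a x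
  goldSum≡ {K} a x = trans (cong (λ l → sumF (map (term x) (zip (toList a) l))) (Lₚ.map-upTo suc K)) (go suc a)
    where
    term : F → Bool × ℕ → F
    term x p = if proj₁ p then gold (proj₂ p) x else 0F
    go : ∀ {K} f (a : Vec Bool K) → sumF (map (term x) (zip (toList a) (applyUpTo f K))) ≡ golds f a x
    go f [] = refl
    go f (c ∷ a) = cong ((c ·ᵇ gold (f 0) x) ⊕_) (go (f ∘ suc) a)

  gold-polar : ∀ i x u → gold i (x ⊕ u) ≡ (gold i x ⊕ gold i u) ⊕ (frob i x · u ⊕ frob i u · x)
  gold-polar i x u = trans (cong (_· (x ⊕ u)) (frob-additive i x u)) (trans (·-distribʳ (x ⊕ u) (frob i x) (frob i u))
    (trans (cong₂ _⊕_ (·-distribˡ (frob i x) x u) (trans (·-distribˡ (frob i u) x u) (⊕-comm (frob i u · x) (frob i u · u))))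
      (⊕-interchange (frob i x · x) (frob i x · u) (frob i u · u) (frob i u · x))))

  -- The trace is φ-invariant; applying φ^{n-i} inside it moves the Frobenius power from x to u.
  Trace-adjoint : ∀ i x u → i ≤ n → Trₙ (frob i x · u) ≡ Trₙ (frob (n ∸ i) u · x)
  Trace-adjoint i x u i≤ = trans (sym (trace-frob n (n ∸ i) _ (frob-n _))) (cong Trₙ (trans (frob-· (n ∸ i) (frob i x) u)
    (trans (cong (_· frob (n ∸ i) u) (trans (sym (frob-+ (n ∸ i) i x)) (trans (cong (λ k → frob k x) (ℕₚ.m∸n+n≡m i≤)) (frob-n x)))) (·-comm x (frob (n ∸ i) u)))))

  Tr𝟎 : Trₙ 𝟎 ≡ 𝟎
  Tr𝟎 = additive-𝟎 (trace-additive n)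

  ⊕-perm : ∀ (a b c d e f : F) → ((a ⊕ b) ⊕ c) ⊕ ((d ⊕ e) ⊕ f) ≡ ((a ⊕ d) ⊕ (b ⊕ e)) ⊕ (c ⊕ f)
  ⊕-perm a b c d e f = trans (⊕-interchange (a ⊕ b) c (d ⊕ e) f) (cong (_⊕ (c ⊕ f)) (⊕-interchange a b d e))

  Trace-golds-polar : ∀ {K} f (a : Vec Bool K) → (∀ j → j < K → f j ≤ n) → ∀ x u →
    Trₙ (golds f a (x ⊕ u)) ≡ (Trₙ (golds f a x) ⊕ Trₙ (golds f a u)) ⊕ Trₙ (Lin f a u · x)
  Trace-golds-polar f [] le x u = trans Tr𝟎 (sym (trans (cong₂ _⊕_ (trans (cong₂ _⊕_ Tr𝟎 Tr𝟎) (⊕-self (𝟎 {n}))) (trans (cong Trₙ (·-zeroˡ x)) Tr𝟎)) (⊕-self (𝟎 {n}))))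
  Trace-golds-polar f (c ∷ a) le x u = begin
      Trₙ ((c ·ᵇ gold i (x ⊕ u)) ⊕ golds f' a (x ⊕ u))
        ≡⟨ trace-additive n (c ·ᵇ gold i (x ⊕ u)) (golds f' a (x ⊕ u)) ⟩
      Trₙ (c ·ᵇ gold i (x ⊕ u)) ⊕ Trₙ (golds f' a (x ⊕ u))
        ≡⟨ cong₂ _⊕_ (head c) (Trace-golds-polar f' a (λ j lt → le (suc j) (s≤s lt)) x u) ⟩
      ((Trₙ (c ·ᵇ gold i x) ⊕ Trₙ (c ·ᵇ gold i u)) ⊕ Trₙ ((c ·ᵇ l) · x)) ⊕ ((Trₙ (golds f' a x) ⊕ Trₙ (golds f' a u)) ⊕ Trₙ (Lin f' a u · x))
        ≡⟨ ⊕-perm (Trₙ (c ·ᵇ gold i x)) (Trₙ (c ·ᵇ gold i u)) (Trₙ ((c ·ᵇ l) · x)) (Trₙ (golds f' a x)) (Trₙ (golds f' a u)) (Trₙ (Lin f' a u · x)) ⟩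
      ((Trₙ (c ·ᵇ gold i x) ⊕ Trₙ (golds f' a x)) ⊕ (Trₙ (c ·ᵇ gold i u) ⊕ Trₙ (golds f' a u))) ⊕ (Trₙ ((c ·ᵇ l) · x) ⊕ Trₙ (Lin f' a u · x))
        ≡⟨ sym (cong₂ _⊕_ (cong₂ _⊕_ (trace-additive n (c ·ᵇ gold i x) (golds f' a x)) (trace-additive n (c ·ᵇ gold i u) (golds f' a u)))
             (trans (cong Trₙ (·-distribʳ x (c ·ᵇ l) (Lin f' a u))) (trace-additive n ((c ·ᵇ l) · x) (Lin f' a u · x)))) ⟩
      (Trₙ (golds f (c ∷ a) x) ⊕ Trₙ (golds f (c ∷ a) u)) ⊕ Trₙ (Lin f (c ∷ a) u · x) ∎
    where
    open ≡-Reasoning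
    i = f 0
    f' = f ∘ suc
    l = frob i u ⊕ frob (n ∸ i) u
    head : ∀ c → Trₙ (c ·ᵇ gold i (x ⊕ u)) ≡ (Trₙ (c ·ᵇ gold i x) ⊕ Trₙ (c ·ᵇ gold i u)) ⊕ Trₙ ((c ·ᵇ l) · x)
    head false = trans Tr𝟎 (sym (trans (cong₂ _⊕_ (trans (cong₂ _⊕_ Tr𝟎 Tr𝟎) (⊕-self (𝟎 {n}))) (trans (cong Trₙ (·-zeroˡ x)) Tr𝟎)) (⊕-self (𝟎 {n}))))
    head true = trans (cong Trₙ (gold-polar i x u)) (trans (trace-additive n (gold i x ⊕ gold i u) (frob i x · u ⊕ frob i u · x))
      (cong₂ _⊕_ (trace-additive n (gold i x) (gold i u)) (trans (trace-additive n (frob i x · u) (frob i u · x))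
        (trans (cong (_⊕ Trₙ (frob i u · x)) (Trace-adjoint i x u (le 0 (s≤s z≤n)))) (trans (⊕-comm (Trₙ (frob (n ∸ i) u · x)) (Trₙ (frob i u · x)))
          (sym (trans (cong Trₙ (·-distribʳ x (frob i u) (frob (n ∸ i) u))) (trace-additive n (frob i u · x) (frob (n ∸ i) u · x)))))))))

  -- With y = φ^N(u) x the cross terms are y and φ^N(y), and the half traces of these two add up to
  -- the full trace of y.
  half-trace-polar : ∀ N → N + N ≡ n → ∀ x u →
    traceTo N (gold N (x ⊕ u)) ≡ (traceTo N (gold N x) ⊕ traceTo N (gold N u)) ⊕ Trₙ (frob N u · x)
  half-trace-polar N NN x u = trans (cong (traceTo N) (gold-polar N x u)) (trans (trace-additive N (gold N x ⊕ gold N u) (frob N x · u ⊕ frob N u · x))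
    (cong₂ _⊕_ (trace-additive N (gold N x) (gold N u)) (begin
      traceTo N (frob N x · u ⊕ frob N u · x)
        ≡⟨ cong (traceTo N) (trans (⊕-comm (frob N x · u) (frob N u · x)) (cong (frob N u · x ⊕_) conj)) ⟩
      traceTo N (frob N u · x ⊕ frob N (frob N u · x))
        ≡⟨ trace-additive N (frob N u · x) (frob N (frob N u · x)) ⟩
      traceTo N (frob N u · x) ⊕ traceTo N (frob N (frob N u · x))
        ≡⟨ sym (trace-+ N N (frob N u · x)) ⟩
      traceTo (N + N) (frob N u · x)
        ≡⟨ cong (λ k → traceTo k (frob N u · x)) NN ⟩
      Trₙ (frob N u · x) ∎)))
    where
    open ≡-Reasoning
    conj : frob N x · u ≡ frob N (frob N u · x)
    conj = sym (trans (frob-· N (frob N u) x) (trans (cong (_· frob N x) (trans (sym (frob-+ N N u)) (trans (cong (λ k → frob k u) NN) (frob-n u)))) (·-comm u (frob N x))))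

  gold-half-fixed : ∀ N → N + N ≡ n → ∀ x → frob N (gold N x) ≡ gold N x
  gold-half-fixed N NN x = trans (frob-· N (frob N x) x) (trans (cong (_· frob N x) (trans (sym (frob-+ N N x)) (trans (cong (λ k → frob k x) NN) (frob-n x)))) (·-comm x (frob N x)))

-- Coordinates: the coefficients a are replaced by those of Σ aⱼ U_{f j}(w)

Usum : ∀ {K} → (ℕ → ℕ) → Vec Bool K → Poly
Usum f [] = []
Usum f (c ∷ a) = scaleₚ c (U (f 0)) +ₚ Usum (f ∘ suc) a

Usum-⊕ : ∀ {K} f (a b : Vec Bool K) → Usum f (a ⊕ b) ≈ Usum f a +ₚ Usum f b
Usum-⊕ f [] [] = ≈-refl
Usum-⊕ f (c ∷ a) (d ∷ b) = ≈-trans (+-cong (scale-xor c d (U (f 0))) (Usum-⊕ (f ∘ suc) a b)) (+-interchange (scaleₚ c (U (f 0))) (scaleₚ d (U (f 0))) _ _)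

Usum-injective : ∀ {K} f → (∀ (a : Vec Bool K) → Usum f a ≈ [] → a ≡ 𝟎) → ∀ {a b} → Usum f a ≈ Usum f b → a ≡ b
Usum-injective f nz {a} {b} e = ⊕≡𝟎⇒≡ (nz (a ⊕ b) (≈-trans (Usum-⊕ f a b) (≈-trans (+-cong e ≈-refl) (+-self (Usum f b)))))

U-vanish : ∀ k {i} → k ≤ i → coef (U k) i ≡ false
U-vanish k p = Bounded.high (Bounded-U k) _ (s≤s p)

scale-vanish : ∀ c f {i} → coef f i ≡ false → coef (scaleₚ c f) i ≡ false
scale-vanish c f {i} e = trans (coef-scale c f i) (trans (cong (c ∧_) e) (𝔹ₚ.∧-zeroʳ c))

+-vanish : ∀ f g {i} → coef f i ≡ false → coef g i ≡ false → coef (f +ₚ g) i ≡ false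
+-vanish f g {i} e e' = trans (coef-+ f g i) (cong₂ _xor_ e e')

Usum-vanish : ∀ {K} f (a : Vec Bool K) M → (∀ j → j < K → f j ≤ M) → ∀ i → M ≤ i → coef (Usum f a) i ≡ false
Usum-vanish f [] M le i p = refl
Usum-vanish f (c ∷ a) M le i p = +-vanish (scaleₚ c (U (f 0))) _ (scale-vanish c (U (f 0)) (U-vanish (f 0) (ℕₚ.≤-trans (le 0 (s≤s z≤n)) p)))
  (Usum-vanish (f ∘ suc) a M (λ j lt → le (suc j) (s≤s lt)) i p)

Deg-+-lowˡ : ∀ {f g d} → (∀ i → d ≤ i → coef f i ≡ false) → Deg g d → Deg (f +ₚ g) d
Deg-+-lowˡ {f} {g} {d} low D = mk (trans (coef-+ f g d) (cong₂ _xor_ (low d ℕₚ.≤-refl) (lead D)))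
  (λ i p → +-vanish f g (low i (ℕₚ.<⇒≤ p)) (above D i p))

Deg-U′ : ∀ {k} → 1 ≤ k → Deg (U k) (k ∸ 1)
Deg-U′ {suc k} _ = Deg-U k

-- The Uᵢ with i ≥ 1 have distinct degrees i - 1, so leading terms cannot cancel. With growing
-- indices the leading term comes from the last nonzero coefficient; in `Usum-decreasing` it comes
-- from the first.
Usum-increasing : ∀ {K} f → (∀ j → f j < f (suc j)) → 1 ≤ f 0 → (a : Vec Bool K) → a ≡ 𝟎 ⊎ ∃ λ d → f 0 ≤ suc d × Deg (Usum f a) d
Usum-increasing f inc pos [] = inj₁ refl
Usum-increasing f inc pos (c ∷ a) with Usum-increasing (f ∘ suc) (λ j → inc (suc j)) (ℕₚ.≤-trans (s≤s z≤n) (inc 0)) a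
Usum-increasing f inc pos (c ∷ a) | inj₂ (d , le , D) = inj₂ (d , ℕₚ.≤-trans (ℕₚ.<⇒≤ (inc 0)) le ,
  Deg-+-lowˡ {scaleₚ c (U (f 0))} (λ i p → scale-vanish c (U (f 0)) (U-vanish (f 0) (ℕₚ.≤-trans (ℕₚ.≤-pred (ℕₚ.≤-trans (inc 0) le)) p))) D)
Usum-increasing f inc pos (false ∷ a) | inj₁ z = inj₁ (cong (false ∷_) z)
Usum-increasing {suc K} f inc pos (true ∷ a) | inj₁ refl = inj₂ (f 0 ∸ 1 , ℕₚ.≤-reflexive (sym (ℕₚ.m+[n∸m]≡n pos)) ,
  Deg-cong (≈-sym (≈-trans (+-cong (scale-true (U (f 0))) (zero-sum K (f ∘ suc))) (+-identityʳ (U (f 0))))) (Deg-U′ pos))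
  where
  zero-sum : ∀ K f → Usum f (𝟎 {K}) ≈ []
  zero-sum zero f = ≈-refl
  zero-sum (suc K) f = ≈-trans (+-cong (scale-false (U (f 0))) (zero-sum K (f ∘ suc))) ≈-refl

Usum-decreasing : ∀ {K} f → (∀ j → suc j < K → f (suc j) < f j) → (∀ j → j < K → 1 ≤ f j) → (a : Vec Bool K) →
  a ≡ 𝟎 ⊎ ∃ λ d → suc d ≤ f 0 × Deg (Usum f a) d
Usum-decreasing f dec pos [] = inj₁ refl
Usum-decreasing f dec pos (false ∷ []) = inj₁ refl
Usum-decreasing f dec pos (false ∷ c ∷ a) with Usum-decreasing (f ∘ suc) (λ j lt → dec (suc j) (s≤s lt)) (λ j lt → pos (suc j) (s≤s lt)) (c ∷ a)
... | inj₁ z = inj₁ (cong (false ∷_) z)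
... | inj₂ (d , le , D) = inj₂ (d , ℕₚ.≤-trans le (ℕₚ.<⇒≤ (dec 0 (s≤s (s≤s z≤n)))) , Deg-cong (≈-sym (+-cong (scale-false (U (f 0))) ≈-refl)) D)
Usum-decreasing {suc K} f dec pos (true ∷ a) = inj₂ (f 0 ∸ 1 , ℕₚ.≤-reflexive (ℕₚ.m+[n∸m]≡n (pos 0 (s≤s z≤n))) ,
  Deg-cong (≈-trans (+-comm (Usum (f ∘ suc) a) (U (f 0))) (+-cong (≈-sym (scale-true (U (f 0)))) ≈-refl))
    (Deg-+-lowˡ {Usum (f ∘ suc) a} (low a dec) (Deg-U′ (pos 0 (s≤s z≤n)))))
  where
  low : ∀ {K} (a : Vec Bool K) → (∀ j → suc j < suc K → f (suc j) < f j) → ∀ i → f 0 ∸ 1 ≤ i → coef (Usum (f ∘ suc) a) i ≡ false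
  low [] dec i p = refl
  low {suc K} a dec i p = Usum-vanish (f ∘ suc) a (f 0 ∸ 1) bound i p
    where
    bound : ∀ j → j < suc K → f (suc j) ≤ f 0 ∸ 1
    bound zero lt = ℕₚ.<⇒≤pred (dec 0 (s≤s lt))
    bound (suc j) lt = ℕₚ.≤-trans (ℕₚ.<⇒≤ (dec (suc j) (s≤s lt))) (bound j (ℕₚ.<-trans (ℕₚ.n<1+n j) lt))

oddCoords : ∀ {K} → Vec Bool K → Vec Bool K
oddCoords {K} a = trunc K (Usum suc a)

toList-oddCoords : ∀ {K} (a : Vec Bool K) → toList (oddCoords a) ≈ Usum suc a
toList-oddCoords {K} a = toList-trunc K (Usum suc a) (Usum-vanish suc a K (λ j lt → lt))

oddCoords-injective : ∀ {K} {a b : Vec Bool K} → oddCoords a ≡ oddCoords b → a ≡ b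
oddCoords-injective {K} {a} {b} e = Usum-injective suc nonzero (≈-trans (≈-sym (toList-oddCoords a)) (≈-trans (≈-reflexive (cong toList e)) (toList-oddCoords b)))
  where
  nonzero : ∀ (a : Vec Bool K) → Usum suc a ≈ [] → a ≡ 𝟎
  nonzero a z with Usum-increasing suc (λ j → ℕₚ.≤-refl) (s≤s z≤n) a
  ... | inj₁ r = r
  ... | inj₂ (_ , _ , D) = ⊥-elim (Deg-≉ D z)

-- c ∷ a stands for a_{n/2} and a₁ … a_{n/2-1}; dividing by φ^{n/2} turns x^i + x^-i into w U_{n/2-i}(w).
evenCoords : ∀ {K} → Vec Bool (suc K) → Vec Bool (suc K)
evenCoords {K} (c ∷ a) = c ∷ trunc K (Usum (K ∸_) a)

toList-evenCoords : ∀ {K} c (a : Vec Bool K) → toList (evenCoords (c ∷ a)) ≈ c ∷ Usum (K ∸_) a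
toList-evenCoords {K} c a = ∷-cong refl (toList-trunc K (Usum (K ∸_) a) (Usum-vanish (K ∸_) a K (λ j _ → ℕₚ.m∸n≤m K j)))

evenCoords-injective : ∀ {K} {a b : Vec Bool (suc K)} → evenCoords a ≡ evenCoords b → a ≡ b
evenCoords-injective {K} {c ∷ a} {d ∷ b} e = cong₂ _∷_ (Vₚ.∷-injectiveˡ e) (Usum-injective (K ∸_) nonzero
    (∷-injʳ (≈-trans (≈-sym (toList-evenCoords c a)) (≈-trans (≈-reflexive (cong toList e)) (toList-evenCoords d b)))))
  where
  nonzero : ∀ (a : Vec Bool K) → Usum (K ∸_) a ≈ [] → a ≡ 𝟎
  nonzero a z with Usum-decreasing (K ∸_) (λ j lt → ℕₚ.∸-monoʳ-< ℕₚ.≤-refl (ℕₚ.<⇒≤ lt)) (λ j lt → ℕₚ.m<n⇒0<n∸m lt) a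
  ... | inj₁ r = r
  ... | inj₂ (_ , _ , D) = ⊥-elim (Deg-≉ D z)

-- Injectivity suffices, as source and target have the same size; a sum over coefficient vectors
-- thereby becomes a sum over all s of bounded degree.
∑-reindex-injective : ∀ {n} (σ : Vec Bool n → Vec Bool n) → (∀ {x y} → σ x ≡ σ y → x ≡ y) → (f : Vec Bool n → ℕ) → ∑ (λ x → f (σ x)) ≡ ∑ f
∑-reindex-injective σ inj f = ∑-reindex σ τ (λ x → inj (στ (σ x))) στ f
  where
  τ = λ y → proj₁ (injective⇒surjective σ inj y)
  στ = λ y → proj₂ (injective⇒surjective σ inj y)

-- Polar maps as polynomials in ω

module Coordinates {n'} (plow : Vec Bool (suc n')) (irr : Irreducible (modulusPoly plow)) where
  open Field plow
  open FiniteField plow irr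
  open Operators plow irr

  Lin-odd : ∀ {K} f (a : Vec Bool K) → (∀ j → j < K → f j ≤ n) → ∀ u → Lin f a u ≡ ω (Aω.act (Usum f a) u)
  Lin-odd f [] le u = sym Aω.T-𝟎
  Lin-odd f (c ∷ a) le u = sym (trans (cong ω (Aω.act-+ (scaleₚ c (U (f 0))) (Usum (f ∘ suc) a) u))
    (trans (ω-additive (Aω.act (scaleₚ c (U (f 0))) u) (Aω.act (Usum (f ∘ suc) a) u))
      (cong₂ _⊕_ (trans (cong ω (Aω.act-scale c (U (f 0)) u)) (trans (ω-·ᵇ c (Aω.act (U (f 0)) u)) (cong (c ·ᵇ_) (act-U (f 0) u (le 0 (s≤s z≤n))))))
        (sym (Lin-odd (f ∘ suc) a (λ j lt → le (suc j) (s≤s lt)) u)))))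

  Lin-even : ∀ {K} f g (a : Vec Bool K) N → N + N ≡ n → (∀ j → j < K → f j + g j ≡ N) → ∀ u → Lin f a u ≡ frob N (ω (Aω.act (Usum g a) u))
  Lin-even f g [] N NN e u = sym (trans (cong (frob N) Aω.T-𝟎) (frob-𝟎 N))
  Lin-even f g (c ∷ a) N NN e u = sym (trans (cong (frob N) (Lin-odd-step c)) (trans (frob-additive N (c ·ᵇ ω (Aω.act (U G) u)) (ω (Aω.act (Usum (g ∘ suc) a) u)))
      (cong₂ _⊕_ (trans (frob-·ᵇ N c (ω (Aω.act (U G) u))) (cong (c ·ᵇ_) main)) (sym (Lin-even (f ∘ suc) (g ∘ suc) a N NN (λ j lt → e (suc j) (s≤s lt)) u)))))
    where
    G = g 0
    i = f 0
    iG : i + G ≡ N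
    iG = e 0 (s≤s z≤n)
    G≤N : G ≤ N
    G≤N = ℕₚ.≤-trans (ℕₚ.m≤n+m G i) (ℕₚ.≤-reflexive iG)
    G≤ : G ≤ n
    G≤ = ℕₚ.≤-trans G≤N (ℕₚ.≤-trans (ℕₚ.m≤m+n N N) (ℕₚ.≤-reflexive NN))
    Lin-odd-step : ∀ c → ω (Aω.act (scaleₚ c (U G) +ₚ Usum (g ∘ suc) a) u) ≡ (c ·ᵇ ω (Aω.act (U G) u)) ⊕ ω (Aω.act (Usum (g ∘ suc) a) u)
    Lin-odd-step c = trans (cong ω (Aω.act-+ (scaleₚ c (U G)) (Usum (g ∘ suc) a) u)) (trans (ω-additive (Aω.act (scaleₚ c (U G)) u) (Aω.act (Usum (g ∘ suc) a) u))
      (cong (_⊕ ω (Aω.act (Usum (g ∘ suc) a) u)) (trans (cong ω (Aω.act-scale c (U G) u)) (ω-·ᵇ c (Aω.act (U G) u)))))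
    e₁ : N + G ≡ n ∸ i
    e₁ = sym (trans (cong (_∸ i) (trans (sym NN) (trans (cong (N +_) (sym iG)) (trans (cong (N +_) (ℕₚ.+-comm i G)) (sym (ℕₚ.+-assoc N G i)))))) (ℕₚ.m+n∸n≡m (N + G) i))
    e₂ : N + (n ∸ G) ≡ i + n
    e₂ = trans (cong (N +_) (trans (cong (_∸ G) (sym NN)) (trans (ℕₚ.+-∸-assoc N G≤N) (cong (N +_) (trans (cong (_∸ G) (sym iG)) (ℕₚ.m+n∸n≡m i G))))))
      (trans (sym (ℕₚ.+-assoc N N i)) (trans (cong (_+ i) NN) (ℕₚ.+-comm n i)))
    main : frob N (ω (Aω.act (U G) u)) ≡ frob i u ⊕ frob (n ∸ i) u
    main = trans (cong (frob N) (act-U G u G≤)) (trans (frob-additive N (frob G u) (frob (n ∸ G) u)) (trans (cong₂ _⊕_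
      (trans (sym (frob-+ N G u)) (cong (λ k → frob k u) e₁))
      (trans (sym (frob-+ N (n ∸ G) u)) (trans (cong (λ k → frob k u) e₂) (trans (frob-+ i n u) (cong (frob i) (frob-n u))))))
      (⊕-comm (frob (n ∸ i) u) (frob i u))))

-- Counting distinct codewords

count : ∀ {A : Set} → (A → Bool) → List A → ℕ
count p xs = length (filterᵇ p xs)

count-∷ : ∀ {A : Set} (p : A → Bool) x xs → count p (x ∷ xs) ≡ [ p x ] + count p xs
count-∷ p x xs with p x
... | true = refl
... | false = refl

count-++ : ∀ {A : Set} (p : A → Bool) xs ys → count p (xs ++ ys) ≡ count p xs + count p ys
count-++ p [] ys = refl
count-++ p (x ∷ xs) ys = trans (count-∷ p x (xs ++ ys)) (trans (cong ([ p x ] +_) (count-++ p xs ys))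
  (trans (sym (ℕₚ.+-assoc [ p x ] _ _)) (cong (_+ count p ys) (sym (count-∷ p x xs)))))

listSum : ∀ {A : Set} → (A → ℕ) → List A → ℕ
listSum f [] = 0
listSum f (x ∷ xs) = f x + listSum f xs

listSum-++ : ∀ {A : Set} (f : A → ℕ) xs ys → listSum f (xs ++ ys) ≡ listSum f xs + listSum f ys
listSum-++ f [] ys = refl
listSum-++ f (x ∷ xs) ys = trans (cong (f x +_) (listSum-++ f xs ys)) (sym (ℕₚ.+-assoc (f x) _ _))

listSum-concatMap : ∀ {A B : Set} (f : B → ℕ) (g : A → List B) xs → listSum f (concatMap g xs) ≡ listSum (λ x → listSum f (g x)) xs
listSum-concatMap f g [] = refl
listSum-concatMap f g (x ∷ xs) = trans (listSum-++ f (g x) (concatMap g xs)) (cong (listSum f (g x) +_) (listSum-concatMap f g xs))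

count-concatMap : ∀ {A B : Set} (p : B → Bool) (g : A → List B) xs → count p (concatMap g xs) ≡ listSum (λ x → count p (g x)) xs
count-concatMap p g [] = refl
count-concatMap p g (x ∷ xs) = trans (count-++ p (g x) (concatMap g xs)) (cong (count p (g x) +_) (count-concatMap p g xs))

listSum-allVecs : ∀ k (f : Vec Bool k → ℕ) → listSum f (allVecs k) ≡ ∑ f
listSum-allVecs zero f = ℕₚ.+-identityʳ (f [])
listSum-allVecs (suc k) f = trans (listSum-concatMap f (λ v → (false ∷ v) ∷ (true ∷ v) ∷ []) (allVecs k))
  (trans (listSum-allVecs k _) (∑-cong {k} (λ v → cong (f (false ∷ v) +_) (ℕₚ.+-identityʳ (f (true ∷ v))))))

count-map : ∀ {A B : Set} (p : B → Bool) (f : A → B) xs → count p (map f xs) ≡ listSum (λ x → [ p (f x) ]) xs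
count-map p f [] = refl
count-map p f (x ∷ xs) = trans (count-∷ p (f x) (map f xs)) (cong ([ p (f x) ] +_) (count-map p f xs))

deduplicate-Unique : ∀ {A : Set} (_≟_ : (x y : A) → Dec (x ≡ y)) {xs} → Unique xs → deduplicate _≟_ xs ≡ xs
deduplicate-Unique _≟_ [] = refl
deduplicate-Unique _≟_ {x ∷ xs} (x∉ ∷ u) = cong (x ∷_) (trans (cong (Data.List.filter _) (deduplicate-Unique _≟_ u)) (Lₚ.filter-all _ x∉))

Unique-concatMap : ∀ {A B : Set} (g : A → List B) → (∀ x → Unique (g x)) → (∀ {x y z} → z ∈ g x → z ∈ g y → x ≡ y) →
  ∀ {xs} → Unique xs → Unique (concatMap g xs)
Unique-concatMap g u disjoint [] = []
Unique-concatMap g u disjoint {x ∷ xs} (x∉ ∷ us) = Uniqueₚ.++⁺ (u x) (Unique-concatMap g u disjoint us)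
  (λ { (p , q) → Allₚ.All¬⇒¬Any x∉ (Any.map (λ q' → disjoint p q') (∈ₚ.∈-concatMap⁻ g q)) })

Unique-allVecs : ∀ k → Unique (allVecs k)
Unique-allVecs zero = [] ∷ []
Unique-allVecs (suc k) = Unique-concatMap (λ v → (false ∷ v) ∷ (true ∷ v) ∷ []) (λ v → ((λ ()) ∷ []) ∷ [] ∷ [])
  (λ p q → trans (sym (tail≡ p)) (tail≡ q)) (Unique-allVecs k)
  where
  tail≡ : ∀ {v z} → z ∈ (false ∷ v) ∷ (true ∷ v) ∷ [] → V.tail z ≡ v
  tail≡ (here refl) = refl
  tail≡ (there (here refl)) = refl

∈-allVecs : ∀ {k} (v : Vec Bool k) → v ∈ allVecs k
∈-allVecs [] = here refl
∈-allVecs (c ∷ v) = ∈ₚ.∈-concatMap⁺ (λ v → (false ∷ v) ∷ (true ∷ v) ∷ []) (lose (∈-allVecs v) (lemma c))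
  where
  lemma : ∀ c → (c ∷ v) ∈ (false ∷ v) ∷ (true ∷ v) ∷ []
  lemma false = here refl
  lemma true = there (here refl)

Unique-allBools : Unique allBools
Unique-allBools = ((λ ()) ∷ []) ∷ [] ∷ []

map-≡⇒ : ∀ {A B : Set} {f g : A → B} xs → map f xs ≡ map g xs → ∀ {x} → x ∈ xs → f x ≡ g x
map-≡⇒ (x ∷ xs) e (here refl) = Lₚ.∷-injectiveˡ e
map-≡⇒ (x ∷ xs) e (there p) = map-≡⇒ xs (Lₚ.∷-injectiveʳ e) p

-- Codewords and their parameters

module CodeCount {n'} (plow : Vec Bool (suc n')) (irr : Irreducible (modulusPoly plow)) where
  open Field plow
  open FiniteField plow irr
  open Codes plow hiding (A)

  L : F → F → Bool
  L b x = tr (b · x)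

  L-⊕ : ∀ b x y → L b (x ⊕ y) ≡ L b x xor L b y
  L-⊕ b x y = trans (cong tr (·-distribˡ b x y)) (tr-⊕ (b · x) (b · y))

  L-sym : ∀ b x → L b x ≡ L x b
  L-sym b x = cong tr (·-comm b x)

  -- The index set stays open because quadratic parts are given by a vector in one code and by a
  -- vector with an extra bit in the other.
  module Words {I : Set} (Q : I → F → F) (A : I → F → F) (Q-bit : ∀ i x → IsBit (Q i x)) (A-additive : ∀ i → Additive (A i))
    (polar : ∀ i x u → Q i (x ⊕ u) ≡ (Q i x ⊕ Q i u) ⊕ Trₙ (A i u · x))
    (A-injective : ∀ {i j} → (∀ u → A i u ≡ A j u) → i ≡ j) where

    q : I → F → Bool
    q i x = toBit (Q i x)

    q-polar : ∀ i x u → q i (x ⊕ u) ≡ (q i x xor q i u) xor L (A i u) x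
    q-polar i x u = trans (cong toBit (polar i x u)) (trans (toBit-⊕ (IsBit-⊕ (Q-bit i x) (Q-bit i u)) (Tr-IsBit (A i u · x)))
      (cong (_xor L (A i u) x) (toBit-⊕ (Q-bit i x) (Q-bit i u))))

    word : I → F → Bool → List Bool
    word i b c = codeword (withAffine (Q i) b c)

    words : I → List (List Bool)
    words i = concatMap (λ b → map (λ c → word i b c) allBools) (allVecs n)

    bit : ∀ i b c x → toBit (withAffine (Q i) b c x) ≡ (q i x xor L b x) xor c
    bit i b c x = trans (toBit-⊕ (IsBit-⊕ (Q-bit i x) (Tr-IsBit (b · x))) (embed-bit c)) (cong₂ _xor_ (toBit-⊕ (Q-bit i x) (Tr-IsBit (b · x))) (toBit-embed c))
      where
      embed-bit : ∀ c → IsBit (embed c)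
      embed-bit true = inj₂ refl
      embed-bit false = inj₁ refl
      toBit-embed : ∀ c → toBit (embed c) ≡ c
      toBit-embed true = refl
      toBit-embed false = toBit-𝟎

    weight-word : ∀ i b c → weight (word i b c) ≡ ∑ (λ x → [ (q i x xor L b x) xor c ])
    weight-word i b c = trans (count-map (λ b → b) (λ x → toBit (withAffine (Q i) b c x)) (allVecs n))
      (trans (listSum-allVecs n _) (∑-cong (λ x → cong [_] (bit i b c x))))

    count-words : ∀ p i → count p (words i) ≡ ∑ (λ b → [ p (word i b false) ] + [ p (word i b true) ])
    count-words p i = trans (count-concatMap p (λ b → map (λ c → word i b c) allBools) (allVecs n))
      (trans (listSum-allVecs n _) (∑-cong (λ b → trans (count-map p (word i b) allBools) (cong ([ p (word i b false) ] +_) (ℕₚ.+-identityʳ _)))))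

    word⇒bits : ∀ i j b b' c c' → word i b c ≡ word j b' c' → ∀ x → (q i x xor L b x) xor c ≡ (q j x xor L b' x) xor c'
    word⇒bits i j b b' c c' e x = trans (sym (bit i b c x)) (trans (map-≡⇒ (allVecs n) e (∈-allVecs x)) (bit j b' c' x))

    -- The second difference of a codeword removes its linear part and leaves the polar form; of the
    -- three copies of `c` one survives.
    affine-polar : ∀ i b c x u → (((q i (x ⊕ u) xor L b (x ⊕ u)) xor c) xor ((q i x xor L b x) xor c)) xor ((q i u xor L b u) xor c) ≡ L (A i u) x xor c
    affine-polar i b c x u = trans (cong₂ (λ s t → (((s xor t) xor c) xor ((q i x xor L b x) xor c)) xor ((q i u xor L b u) xor c)) (q-polar i x u) (L-⊕ b x u))
      (cancel (q i x) (q i u) (L (A i u) x) (L b x) (L b u) c)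
      where
      open xor-∧-Solver using () renaming (solve to solve𝔹; _:+_ to _:⊻_; _:=_ to _:≡_)
      cancel : ∀ p r s y z c → (((((p xor r) xor s) xor (y xor z)) xor c) xor ((p xor y) xor c)) xor ((r xor z) xor c) ≡ s xor c
      cancel = solve𝔹 6 (λ p r s y z c → (((((p :⊻ r) :⊻ s) :⊻ (y :⊻ z)) :⊻ c) :⊻ ((p :⊻ y) :⊻ c)) :⊻ ((r :⊻ z) :⊻ c) :≡ s :⊻ c) refl

    L-nondegenerate : ∀ b → (∀ x → L b x ≡ false) → b ≡ 𝟎
    L-nondegenerate = tr-nondegenerate

    L-injective : ∀ {a b} → (∀ x → L a x ≡ L b x) → a ≡ b
    L-injective {a} {b} e = ⊕≡𝟎⇒≡ (L-nondegenerate (a ⊕ b) (λ x → trans (trans (L-sym (a ⊕ b) x) (L-⊕ x a b))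
      (trans (cong₂ _xor_ (trans (L-sym x a) (e x)) (L-sym x b)) (xor-self (L b x)))))

    L-𝟎 : ∀ b → L b 𝟎 ≡ false
    L-𝟎 b = trans (cong (λ z → toBit (Trₙ z)) (·-zeroʳ b)) (trans (cong toBit (additive-𝟎 (trace-additive n))) toBit-𝟎)

    q-𝟎 : ∀ i → q i 𝟎 ≡ false
    q-𝟎 i = trans (cong (q i) (sym (⊕-self (𝟎 {n})))) (trans (q-polar i 𝟎 𝟎) (cong₂ _xor_ (xor-self (q i 𝟎)) (L-𝟎 (A i 𝟎))))

    -- The constant is the value at 0, second differences recover the polar map and hence the index,
    -- and what then remains is the linear part. Deduplication of the code therefore removes
    -- nothing.
    word-injective : ∀ i j b b' c c' → word i b c ≡ word j b' c' → i ≡ j × b ≡ b' × c ≡ c'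
    word-injective i j b b' c c' e = i≡j , b≡b' i≡j , c≡c'
      where
      bits : ∀ x → (q i x xor L b x) xor c ≡ (q j x xor L b' x) xor c'
      bits = word⇒bits i j b b' c c' e
      c≡c' : c ≡ c'
      c≡c' = trans (sym (cong₂ (λ s t → (s xor t) xor c) (q-𝟎 i) (L-𝟎 b))) (trans (bits 𝟎) (cong₂ (λ s t → (s xor t) xor c') (q-𝟎 j) (L-𝟎 b')))
      xor-cancelʳ : ∀ {s t} c → s xor c ≡ t xor c → s ≡ t
      xor-cancelʳ {s} {t} c p = trans (sym (lemma s c)) (trans (cong (_xor c) p) (lemma t c))
        where
        lemma : ∀ s c → (s xor c) xor c ≡ s
        lemma s c = trans (𝔹ₚ.xor-assoc s c c) (trans (cong (s xor_) (xor-self c)) (𝔹ₚ.xor-identityʳ s))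
      i≡j : i ≡ j
      i≡j = A-injective (λ u → L-injective (λ x → xor-cancelʳ c (trans (sym (affine-polar i b c x u))
        (trans (cong₂ _xor_ (cong₂ _xor_ (bits (x ⊕ u)) (bits x)) (bits u)) (trans (affine-polar j b' c' x u) (cong (L (A j u) x xor_) (sym c≡c')))))))
      b≡b' : i ≡ j → b ≡ b'
      b≡b' refl = L-injective (λ x → xor-cancelˡ (q i x) (xor-cancelʳ c (trans (bits x) (cong ((q i x xor L b' x) xor_) (sym c≡c')))))
        where
        xor-cancelˡ : ∀ s {t t'} → s xor t ≡ s xor t' → t ≡ t'
        xor-cancelˡ s {t} {t'} p = xor-cancelʳ s (trans (𝔹ₚ.xor-comm t s) (trans p (𝔹ₚ.xor-comm s t')))

    ∈-row : ∀ i b {z} → z ∈ map (word i b) allBools → ∃ λ c → z ≡ word i b c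
    ∈-row i b p = proj₁ (∈ₚ.∈-map⁻ (word i b) p) , proj₂ (proj₂ (∈ₚ.∈-map⁻ (word i b) p))

    ∈-words : ∀ i {z} → z ∈ words i → ∃₂ λ b c → z ≡ word i b c
    ∈-words i p = proj₁ r , ∈-row i (proj₁ r) (proj₂ (proj₂ r))
      where
      r = find (∈ₚ.∈-concatMap⁻ (λ b → map (word i b) allBools) {xs = allVecs n} p)

    words-disjoint : ∀ {i j z} → z ∈ words i → z ∈ words j → i ≡ j
    words-disjoint {i} {j} p p' = lemma (∈-words i p) (∈-words j p')
      where
      lemma : ∀ {z} → (∃₂ λ b c → z ≡ word i b c) → (∃₂ λ b c → z ≡ word j b c) → i ≡ j
      lemma (b , c , e) (b' , c' , e') = proj₁ (word-injective i j b b' c c' (trans (sym e) e'))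

    words-Unique : ∀ i → Unique (words i)
    words-Unique i = Unique-concatMap (λ b → map (word i b) allBools)
      (λ b → Uniqueₚ.map⁺ (λ {c} {c'} e → proj₂ (proj₂ (word-injective i i b b c c' e))) Unique-allBools)
      (λ {b} {b'} p p' → lemma b b' (∈-row i b p) (∈-row i b' p'))
      (Unique-allVecs n)
      where
      lemma : ∀ b b' {z} → (∃ λ c → z ≡ word i b c) → (∃ λ c → z ≡ word i b' c) → b ≡ b'
      lemma b b' (c , e) (c' , e') = proj₁ (proj₂ (word-injective i i b b' c c' (trans (sym e) e')))

    module Rank (i : I) (k : ℕ) (rank : ∣ker A i ∣ * 2 ^ k ≡ 2 ^ n) where
      module QF = QuadraticForm {n'} (q i) L (A i) L-⊕ L-sym L-nondegenerate (A-additive i) (q-polar i) k rank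

      count-weight : ∀ k' → count (hasWeightₖ k') (words i) ≡ [ does (k' ℕₚ.≟ k) ] * 2 ^ k
      count-weight k' = trans (count-words (hasWeightₖ k') i) (trans (∑-cong (λ b → cong₂ _+_
        (cong (λ z → [ hasWeight n' k' z ]) (weight-word i b false)) (cong (λ z → [ hasWeight n' k' z ]) (weight-word i b true)))) (QF.count-weight k'))

      count-balanced : count (λ z → weight z ≡ᵇ 2 ^ n') (words i) + 2 * 2 ^ k ≡ 2 ^ (n + 1)
      count-balanced = trans (cong (_+ 2 * 2 ^ k) (trans (count-words (λ z → weight z ≡ᵇ 2 ^ n') i) (∑-cong (λ b → cong₂ _+_
        (cong (λ z → [ z ≡ᵇ 2 ^ n' ]) (weight-word i b false)) (cong (λ z → [ z ≡ᵇ 2 ^ n' ]) (weight-word i b true)))))) QF.count-balanced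

-- Assembly of the two weight enumerators

lifts : ∀ {rs} → All (λ r → PrimeSelfReciprocal r × (2 ∣ deg r)) rs → ∃ (Pointwise Lift rs)
lifts [] = [] , []
lifts {r ∷ rs} (p ∷ ps) = _ , (proj₂ (prime-self-reciprocal⇒Lift r p) ∷ proj₂ (lifts ps))

odd⇒suc-double : ∀ m → ¬ 2 ∣ m → ∃ λ k → m ≡ suc (k + k)
odd⇒suc-double m odd with parity m
  where
  parity : ∀ m → ∃ λ k → m ≡ k + k ⊎ m ≡ suc (k + k)
  parity zero = 0 , inj₁ refl
  parity (suc m) with parity m
  ... | k , inj₁ e = k , inj₂ (cong suc e)
  ... | k , inj₂ e = suc k , inj₁ (cong suc (trans e (sym (ℕₚ.+-suc k k))))
... | k , inj₂ e = k , e
... | k , inj₁ e = ⊥-elim (odd (divides k (trans e (trans (cong (k +_) (sym (ℕₚ.+-identityʳ k))) (ℕₚ.*-comm 2 k)))))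

Deg-xⁿ+1 : ∀ n' → Deg (xⁿ+1 (suc n')) (suc n')
Deg-xⁿ+1 n' = Deg-+-lowˡ {oneₚ} (λ { (suc i) _ → refl }) (Deg-xpow (suc n'))

Deg-prod-rs : ∀ q {rs Rs} (Ls : Pointwise Lift rs Rs) → Deg (prodₚ (map (_^ₚ q) rs)) (total q Ls + total q Ls)
Deg-prod-rs q [] = Deg-1
Deg-prod-rs q {r ∷ rs} (L ∷ Ls) = subst (Deg _) (trans (cong (_+ (total q Ls + total q Ls)) (ℕₚ.*-distribˡ-+ q N N)) (interchange (q * N) (q * N) (total q Ls) (total q Ls)))
  (Deg-* (r ^ₚ q) (Deg-^ q (Deg-cong (Lift.Hr L) (Deg-H N _ (Lift.degR L)))) (Deg-prod-rs q Ls))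
  where N = Lift.N L

-- The end of the argument common to both codes: `σ` turns coefficient vectors bijectively into
-- residues modulo D, so a sum over quadratic parts becomes `S`, hence a value of the functional of
-- `W`.
module Enumerator {n'} (plow : Vec Bool (suc n')) (N : ℕ) (D : Poly) (W : NPoly) (σ : Vec Bool N → Vec Bool N) (σ-injective : ∀ {x y} → σ x ≡ σ y → x ≡ y)
  (N+N≤n : N + N ≤ suc n') (S≡ : ∀ h → S N D (weighted h) ≡ ⟪ W , h ⟫) where
  open Codes plow hiding (A)

  n = suc n'

  rank : Vec Bool N → ℕ
  rank v = (N ∸ γ (toList (σ v)) D) + (N ∸ γ (toList (σ v)) D)

  -- `G p v` stands for the number of words with property p whose quadratic part has coefficients v;
  -- this hides the different nesting of the lists `R₁` and `R₂`.
  module Count (R : List (List Bool)) (G : (List Bool → Bool) → Vec Bool N → ℕ) (R≡ : ∀ p → count p R ≡ ∑ (G p))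
    (G-weight : ∀ k v → G (hasWeightₖ k) v ≡ [ does (k ℕₚ.≟ rank v) ] * 2 ^ rank v)
    (G-balanced : ∀ v → G (λ z → weight z ≡ᵇ 2 ^ n') v + 2 * 2 ^ rank v ≡ 2 ^ (n + 1)) where

    sum-ranks : ∀ h → ∑ (λ v → 2 ^ rank v * h (rank v)) ≡ ⟪ W , h ⟫
    sum-ranks h = trans (∑-reindex-injective σ σ-injective (λ s → weighted h (N ∸ γ (toList s) D))) (S≡ h)

    Aₖ≡ : ∀ k → Aₖ R k ≡ coeff k W
    Aₖ≡ k = trans (R≡ (hasWeightₖ k)) (trans (∑-cong (λ v → trans (G-weight k v) (ℕₚ.*-comm [ does (k ℕₚ.≟ rank v) ] (2 ^ rank v)))) (trans (sum-ranks (indicator k)) (⟪⟫-coeff W k)))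

    coeff≡0 : ∀ k → n < k → coeff k W ≡ 0
    coeff≡0 k lt = trans (sym (⟪⟫-coeff W k)) (trans (sym (sum-ranks (indicator k))) (trans (∑-cong (λ v → trans (cong (2 ^ rank v *_) ([]-no (k ℕₚ.≟ rank v)
      (λ e → ℕₚ.<-irrefl (sym e) (ℕₚ.≤-<-trans (rank≤ v) lt)))) (ℕₚ.*-zeroʳ (2 ^ rank v)))) (∑-ε {N})))
      where
      rank≤ : ∀ v → rank v ≤ n
      rank≤ v = ℕₚ.≤-trans (ℕₚ.+-mono-≤ (ℕₚ.m∸n≤m N (γ (toList (σ v)) D)) (ℕₚ.m∸n≤m N (γ (toList (σ v)) D))) N+N≤n

    A≡ : ℤ.+ Codes.A plow R ≡ ℤ.+ (2 ^ (n + 1) * 2 ^ N) ℤ.- ℤ.+ (2 * ⟪ W , (λ _ → 1) ⟫)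
    A≡ = trans (sym (+-cancel (count balanced R) (2 * ⟪ W , (λ _ → 1) ⟫))) (cong (λ z → ℤ.+ z ℤ.- ℤ.+ (2 * ⟪ W , (λ _ → 1) ⟫)) eq)
      where
      balanced : List Bool → Bool
      balanced z = weight z ≡ᵇ 2 ^ n'
      eq : count balanced R + 2 * ⟪ W , (λ _ → 1) ⟫ ≡ 2 ^ (n + 1) * 2 ^ N
      eq = trans (cong₂ _+_ (R≡ balanced) (trans (cong (2 *_) (trans (sym (sum-ranks (λ _ → 1))) (∑-cong (λ v → ℕₚ.*-identityʳ (2 ^ rank v))))) (sym (∑-*ˡ 2 (λ v → 2 ^ rank v)))))
        (trans (sym (∑-∙ (G balanced) (λ v → 2 * 2 ^ rank v))) (trans (∑-cong G-balanced) (trans (∑-const N (2 ^ (n + 1))) (ℕₚ.*-comm (2 ^ N) (2 ^ (n + 1))))))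

module OddCode {n'} (plow : Vec Bool (suc n')) (irr : Irreducible (modulusPoly plow)) where
  open Field plow
  open FiniteField plow irr
  open Operators plow irr
  open Coordinates plow irr
  open Codes plow hiding (A)

  K : ℕ
  K = ⌊ n' /2⌋

  A : Vec Bool K → F → F
  A a = Lin suc a

  module Counting {D} (KK : K + K ≡ n') (degD : Deg D K) (w∤D : ¬ w ∣ₚ D) (D𝟎 : ∀ v → φ+1 (Aω.act D v) ≡ 𝟎) (W : NPoly) (S≡ : ∀ h → S K D (weighted h) ≡ ⟪ W , h ⟫) where

    A≡ω : ∀ a u → A a u ≡ ω (Aω.act (toList (oddCoords a)) u)
    A≡ω a u = trans (Lin-odd suc a (λ j lt → s≤s (ℕₚ.≤-trans (ℕₚ.<⇒≤ lt) (ℕₚ.≤-trans (ℕₚ.m≤m+n K K) (ℕₚ.≤-reflexive KK)))) u)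
      (cong ω (Aω.act-≈ u (≈-sym (toList-oddCoords a))))

    A-injective : ∀ {a b} → (∀ u → A a u ≡ A b u) → a ≡ b
    -- The polar map is w s at ω, and prefixing `false` multiplies by w. The degree is then at most
    -- K, with 2K = n - 1 < n.
    A-injective {a} {b} e = oddCoords-injective (⊕≡𝟎⇒≡ (toList≈[] (s ⊕ s') (tail-≈[] (ω-injective (false ∷ toList (s ⊕ s')) K bound (s≤s (ℕₚ.≤-reflexive KK)) zeros))))
      where
      s = oddCoords a
      s' = oddCoords b
      bound : Bounded (false ∷ toList (s ⊕ s')) K
      bound = bdd (λ { (suc i) p → coef-toList (s ⊕ s') i (ℕₚ.≤-pred p) })
      zeros : ∀ v → Aω.act (false ∷ toList (s ⊕ s')) v ≡ 𝟎
      zeros v = trans (Aω.act-shift (toList (s ⊕ s')) v) (trans (cong ω (trans (Aω.act-≈ v (toList-⊕ s s')) (Aω.act-+ (toList s) (toList s') v)))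
        (trans (ω-additive (Aω.act (toList s) v) (Aω.act (toList s') v)) (trans (cong₂ _⊕_ (trans (sym (A≡ω a v)) (e v)) (sym (A≡ω b v))) (⊕-self (A b v)))))

    polar : ∀ a x u → Q₁ a (x ⊕ u) ≡ (Q₁ a x ⊕ Q₁ a u) ⊕ Trₙ (A a u · x)
    polar a x u = trans (cong Trₙ (goldSum≡ a (x ⊕ u))) (trans (Trace-golds-polar suc a (λ j lt → s≤s (ℕₚ.≤-trans (ℕₚ.<⇒≤ lt) (ℕₚ.≤-trans (ℕₚ.m≤m+n K K) (ℕₚ.≤-reflexive KK)))) x u)
      (cong₂ (λ s t → (Trₙ s ⊕ Trₙ t) ⊕ Trₙ (A a u · x)) (sym (goldSum≡ a x)) (sym (goldSum≡ a u))))

    open CodeCount.Words plow irr Q₁ A (λ a x → Tr-IsBit (goldSum a x)) (Lin-additive suc) polar A-injective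
    open Enumerator plow K D W oddCoords oddCoords-injective (ℕₚ.≤-trans (ℕₚ.≤-reflexive KK) (ℕₚ.n≤1+n n')) S≡ using (rank; module Count)

    rank-A : ∀ a → ∣ker A a ∣ * 2 ^ rank a ≡ 2 ^ n
    rank-A a = trans (cong (_* 2 ^ rank a) (∣ker∣-cong (A a) (λ v → ω (Aω.act (toList (oddCoords a)) v)) (λ v z → trans (sym (A≡ω a v)) z) (λ v z → trans (A≡ω a v) z)))
      (radical-odd degD (cong suc KK) w∤D D𝟎 (toList (oddCoords a)))

    R₁≡ : R₁ ≡ concatMap words (allVecs K)
    R₁≡ = deduplicate-Unique decEqWord (Unique-concatMap words words-Unique words-disjoint (Unique-allVecs K))

    open Count R₁ (λ p a → count p (words a))
      (λ p → trans (cong (count p) R₁≡) (trans (count-concatMap p words (allVecs K)) (listSum-allVecs K (λ a → count p (words a)))))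
      (λ k a → Rank.count-weight a (rank a) (rank-A a) k)
      (λ a → Rank.count-balanced a (rank a) (rank-A a)) public

module EvenCode {n'} (plow : Vec Bool (suc n')) (irr : Irreducible (modulusPoly plow)) where
  open Field plow
  open FiniteField plow irr
  open Operators plow irr
  open Coordinates plow irr
  open Codes plow hiding (A)

  N K : ℕ
  N = ⌊ n /2⌋
  K = N ∸ 1

  I : Set
  I = Vec Bool K × Bool

  A : I → F → F
  A (a , c) u = Lin suc a u ⊕ (c ·ᵇ frob N u)

  Q : I → F → F
  Q (a , c) = Q₂ a c

  coords : I → Vec Bool (suc K)
  coords (a , c) = evenCoords (c ∷ a)

  module Counting {D} (NN : N + N ≡ n) (sucK : suc K ≡ N) (degD : Deg D (suc K)) (D𝟎 : ∀ v → Aω.act D v ≡ 𝟎) (W : NPoly) (S≡ : ∀ h → S (suc K) D (weighted h) ≡ ⟪ W , h ⟫) where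

    sucK+sucK : suc K + suc K ≡ n
    sucK+sucK = trans (cong (λ z → z + z) sucK) NN

    index≤ : ∀ j → j < K → suc j ≤ n
    index≤ j lt = ℕₚ.≤-trans lt (ℕₚ.≤-trans (ℕₚ.n≤1+n K) (ℕₚ.≤-trans (ℕₚ.m≤m+n (suc K) (suc K)) (ℕₚ.≤-reflexive sucK+sucK)))

    A≡ω : ∀ i u → A i u ≡ frob N (Aω.act (toList (coords i)) u)
    A≡ω (a , c) u = trans (⊕-comm (Lin suc a u) (c ·ᵇ frob N u)) (sym (trans (cong (frob N) (Aω.act-≈ u (toList-evenCoords c a)))
      (trans (frob-additive N (c ·ᵇ u) (ω (Aω.act (Usum (K ∸_) a) u))) (cong₂ _⊕_ (frob-·ᵇ N c u)
        (sym (Lin-even suc (K ∸_) a N NN (λ j lt → trans (cong suc (ℕₚ.m+[n∸m]≡n (ℕₚ.<⇒≤ lt))) sucK) u))))))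

    coords-injective : ∀ {i j} → coords i ≡ coords j → i ≡ j
    coords-injective {a , c} {b , d} e = lemma (evenCoords-injective {a = c ∷ a} {d ∷ b} e)
      where
      lemma : c ∷ a ≡ d ∷ b → (a , c) ≡ (b , d)
      lemma refl = refl

    A-injective : ∀ {i j} → (∀ u → A i u ≡ A j u) → i ≡ j
    -- Here the polar map is φ^N s(ω) without a further factor w; the degree of s is at most K, with
    -- 2K = n - 2.
    A-injective {i} {j} e = coords-injective (⊕≡𝟎⇒≡ (toList≈[] (s ⊕ s') (ω-injective (toList (s ⊕ s')) K bound lt zeros)))
      where
      s = coords i
      s' = coords j
      bound : Bounded (toList (s ⊕ s')) K
      bound = bdd (λ i p → coef-toList (s ⊕ s') i p)
      lt : K + K < n
      lt = ℕₚ.≤-trans (s≤s (ℕₚ.+-monoʳ-≤ K (ℕₚ.n≤1+n K))) (ℕₚ.≤-reflexive sucK+sucK)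
      zeros : ∀ v → Aω.act (toList (s ⊕ s')) v ≡ 𝟎
      zeros v = trans (Aω.act-≈ v (toList-⊕ s s')) (trans (Aω.act-+ (toList s) (toList s') v) (frob≡𝟎 N _ (trans (frob-additive N (Aω.act (toList s) v) (Aω.act (toList s') v))
        (trans (cong₂ _⊕_ (trans (sym (A≡ω i v)) (e v)) (sym (A≡ω j v))) (⊕-self (A j v))))))

    A-additive : ∀ i → Additive (A i)
    A-additive (a , c) = ⊕-additive (Lin-additive suc a) (·ᵇ-additive (frob-additive N) c)

    Q-bit : ∀ i x → IsBit (Q i x)
    Q-bit (a , false) x = IsBit-⊕ (Tr-IsBit (goldSum a x)) (inj₁ refl)
    Q-bit (a , true) x = IsBit-⊕ (Tr-IsBit (goldSum a x)) (trace-IsBit N (gold N x) (gold-half-fixed N NN x))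

    half : Bool → F → F
    half c x = c ·ᵇ Trₙ/₂ (gold N x)

    half-polar : ∀ c x u → half c (x ⊕ u) ≡ (half c x ⊕ half c u) ⊕ Trₙ ((c ·ᵇ frob N u) · x)
    half-polar true x u = half-trace-polar N NN x u
    half-polar false x u = sym (trans (cong₂ _⊕_ (⊕-self (𝟎 {n})) (trans (cong Trₙ (·-zeroˡ x)) (additive-𝟎 (trace-additive n)))) (⊕-self (𝟎 {n})))

    polar : ∀ i x u → Q i (x ⊕ u) ≡ (Q i x ⊕ Q i u) ⊕ Trₙ (A i u · x)
    polar (a , c) x u = begin
        Trₙ (goldSum a (x ⊕ u)) ⊕ half c (x ⊕ u)
          ≡⟨ cong₂ _⊕_ (trans (cong Trₙ (goldSum≡ a (x ⊕ u))) (Trace-golds-polar suc a index≤ x u)) (half-polar c x u) ⟩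
        ((Trₙ (golds suc a x) ⊕ Trₙ (golds suc a u)) ⊕ Trₙ (Lin suc a u · x)) ⊕ ((half c x ⊕ half c u) ⊕ Trₙ ((c ·ᵇ frob N u) · x))
          ≡⟨ ⊕-perm (Trₙ (golds suc a x)) (Trₙ (golds suc a u)) (Trₙ (Lin suc a u · x)) (half c x) (half c u) (Trₙ ((c ·ᵇ frob N u) · x)) ⟩
        ((Trₙ (golds suc a x) ⊕ half c x) ⊕ (Trₙ (golds suc a u) ⊕ half c u)) ⊕ (Trₙ (Lin suc a u · x) ⊕ Trₙ ((c ·ᵇ frob N u) · x))
          ≡⟨ cong₂ _⊕_ (cong₂ (λ s t → (Trₙ s ⊕ half c x) ⊕ (Trₙ t ⊕ half c u)) (sym (goldSum≡ a x)) (sym (goldSum≡ a u)))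
               (sym (trans (cong Trₙ (·-distribʳ x (Lin suc a u) (c ·ᵇ frob N u))) (trace-additive n (Lin suc a u · x) ((c ·ᵇ frob N u) · x)))) ⟩
        (Q (a , c) x ⊕ Q (a , c) u) ⊕ Trₙ (A (a , c) u · x) ∎
      where open ≡-Reasoning

    open CodeCount.Words plow irr Q A Q-bit A-additive polar A-injective
    open Enumerator plow (suc K) D W evenCoords evenCoords-injective (ℕₚ.≤-reflexive sucK+sucK) S≡ using (rank; module Count)

    rank-A : ∀ i → let k = rank (proj₂ i ∷ proj₁ i) in ∣ker A i ∣ * 2 ^ k ≡ 2 ^ n
    rank-A i = radical-even degD sucK+sucK D𝟎 (toList (coords i)) (A i)
      (λ v z → frob≡𝟎 N _ (trans (sym (A≡ω i v)) z)) (λ v z → trans (A≡ω i v) (trans (cong (frob N) z) (frob-𝟎 N)))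

    block : Vec Bool K → List (List Bool)
    block a = concatMap (λ c → words (a , c)) allBools

    block-disjoint : ∀ {a b z} → z ∈ block a → z ∈ block b → a ≡ b
    block-disjoint {a} {b} p p' = lemma (find (∈ₚ.∈-concatMap⁻ (λ c → words (a , c)) {xs = allBools} p)) (find (∈ₚ.∈-concatMap⁻ (λ c → words (b , c)) {xs = allBools} p'))
      where
      lemma : ∀ {z} → (∃ λ c → c ∈ allBools × z ∈ words (a , c)) → (∃ λ c → c ∈ allBools × z ∈ words (b , c)) → a ≡ b
      lemma (c , _ , q) (d , _ , q') = cong proj₁ (words-disjoint {a , c} {b , d} q q')

    R₂≡ : R₂ ≡ concatMap block (allVecs K)
    R₂≡ = deduplicate-Unique decEqWord (Unique-concatMap block
      (λ a → Unique-concatMap (λ c → words (a , c)) (λ c → words-Unique (a , c)) (λ {c} {d} q q' → cong proj₂ (words-disjoint {a , c} {a , d} q q')) Unique-allBools)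
      (λ {a} {b} → block-disjoint {a} {b}) (Unique-allVecs K))

    G : (List Bool → Bool) → Vec Bool (suc K) → ℕ
    G p (c ∷ a) = count p (words (a , c))

    G-weight : ∀ k v → G (hasWeightₖ k) v ≡ [ does (k ℕₚ.≟ rank v) ] * 2 ^ rank v
    G-weight k (c ∷ a) = Rank.count-weight (a , c) (rank (c ∷ a)) (rank-A (a , c)) k

    G-balanced : ∀ v → G (λ z → weight z ≡ᵇ 2 ^ n') v + 2 * 2 ^ rank v ≡ 2 ^ (n + 1)
    G-balanced (c ∷ a) = Rank.count-balanced (a , c) (rank (c ∷ a)) (rank-A (a , c))

    open Count R₂ G
      (λ p → trans (cong (count p) R₂≡) (trans (count-concatMap p block (allVecs K)) (trans (listSum-allVecs K (λ a → count p (block a)))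
        (∑-cong (λ a → trans (count-concatMap p (λ c → words (a , c)) allBools) (cong (count p (words (a , false)) +_) (ℕₚ.+-identityʳ (count p (words (a , true))))))))))
      G-weight G-balanced public

module Odd {n'} (plow : Vec Bool (suc n')) (irr : Irreducible (modulusPoly plow)) {k rs Rs} (Ls : Pointwise Lift rs Rs)
  (sf : xⁿ+1 (suc (k + k)) ≈ x+1 *ₚ prodₚ rs) (fact : xⁿ+1 (suc n') ≈ (x+1 ^ₚ 1) *ₚ prodₚ (map (_^ₚ 1) rs)) where
  open FiniteField plow irr using (n; φ; frob-comm; frob-additive; frob≡𝟎; module Aφ)
  open Operators plow irr
  open OddCode plow irr using (K)

  δ = total 1 Ls
  D = prodₚ (map (_^ₚ 1) Rs)

  δδ : n' ≡ δ + δ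
  δδ = ℕₚ.suc-injective (Deg-unique (Deg-xⁿ+1 n') (Deg-cong (≈-sym fact) (Deg-* (x+1 ^ₚ 1) (Deg-^ {x+1} {1} 1 (Deg-∷ true Deg-1)) (Deg-prod-rs 1 Ls))))

  K≡δ : K ≡ δ
  K≡δ = trans (cong ⌊_/2⌋ δδ) (half-double δ)

  D𝟎 : ∀ v → φ+1 (Aω.act D v) ≡ 𝟎
  -- At φ the product of the rᵢ becomes φ^N D(ω), so φ^n + 1 = 0 reads φ^N (φ + 1) D(ω) = 0, and φ^N
  -- is injective.
  D𝟎 v = frob≡𝟎 N _ (trans (trans (frob-additive N (φ z) z) (cong (_⊕ Field.frob plow N z) (frob-comm N 1 z))) (trans (sym x+1-act) (trans (sym fact-act) (act-xⁿ+1 v))))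
    where
    N = proj₁ (Represents-prod 1 Ls)
    z = Aω.act D v
    y = Field.frob plow N z
    Π = prodₚ (map (_^ₚ 1) rs)
    fact-act : Aφ.act (xⁿ+1 n) v ≡ Aφ.act x+1 y
    fact-act = trans (Aφ.act-≈ v (≈-trans fact (*-cong (*-identityʳ x+1) (≈-refl {Π})))) (trans (Aφ.act-* x+1 Π v) (cong (Aφ.act x+1) (proj₂ (Represents-prod 1 Ls) v)))
    x+1-act : Aφ.act x+1 y ≡ φ+1 y
    x+1-act = trans (cong (λ u → y ⊕ φ u) (Aφ.act-1 y)) (⊕-comm y (φ y))

  result : ((j : ℕ) → j ≤ n → Codes.Aₖ plow (Codes.R₁ plow) j ≡ coeff j (W₁ rs)) × ((j : ℕ) → n < j → coeff j (W₁ rs) ≡ 0) × (ℤ.+ Codes.A plow (Codes.R₁ plow) ≡ A₁formula n rs)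
  result = (λ j _ → C.Aₖ≡ j) , C.coeff≡0 , trans C.A≡ (sym (trans (cong (λ z → A₁formula (suc z) rs) δδ) (trans (A₁formula≡ Ls)
      (cong₂ (λ a b → ℤ.+ (2 ^ (suc a + 1) * 2 ^ b) ℤ.- ℤ.+ (2 * ⟪ W₁ rs , (λ _ → 1) ⟫)) (sym δδ) (sym K≡δ)))))
    where
    module C = OddCode.Counting plow irr {D} (trans (cong (λ z → z + z) K≡δ) (sym δδ)) (subst (Deg D) (sym K≡δ) (Deg-prod 1 Ls)) (Coprimality.w∤prod {k} {1} Ls sf) D𝟎 (W₁ rs)
      (λ h → trans (cong (λ z → S z D (weighted h)) K≡δ) (GeneratingFunction.S-product {k} 1 W₁ᵢ W₁-factor Ls (∣-cong ≈-refl (≈-sym sf) (∣-*ˡ x+1 (∣-refl {prodₚ rs}))) h))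

module Even {n'} (plow : Vec Bool (suc n')) (irr : Irreducible (modulusPoly plow)) {k rs Rs} (Ls : Pointwise Lift rs Rs) (t' : ℕ)
  (sf : xⁿ+1 (suc (k + k)) ≈ x+1 *ₚ prodₚ rs) (fact : xⁿ+1 (suc n') ≈ (x+1 ^ₚ (2 ^ suc t')) *ₚ prodₚ (map (_^ₚ (2 ^ suc t')) rs)) where
  open FiniteField plow irr using (n)
  open Operators plow irr
  open EvenCode plow irr using (N; K)

  t = suc t'
  T = 2 ^ t'
  q = 2 ^ t
  δ = T * 1 + total q Ls
  D = (w ^ₚ T) *ₚ prodₚ (map (_^ₚ q) Rs)

  degD : Deg D δ
  degD = Deg-* (w ^ₚ T) (Deg-^ T Deg-w) (Deg-prod q Ls)

  δδ : n ≡ δ + δ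
  δδ = trans (Deg-unique (Deg-xⁿ+1 n') (Deg-cong (≈-sym fact) (Deg-* (x+1 ^ₚ q) (Deg-^ {x+1} {1} q (Deg-∷ true Deg-1)) (Deg-prod-rs q Ls))))
    (solveℕ 2 (λ T s → (con 2 :*ℕ T) :*ℕ con 1 :+ℕ (s :+ℕ s) :=ℕ (T :*ℕ con 1 :+ℕ s) :+ℕ (T :*ℕ con 1 :+ℕ s)) refl T (total q Ls))
    where open Data.Nat.Solver.+-*-Solver using (con) renaming (solve to solveℕ; _:+_ to _:+ℕ_; _:*_ to _:*ℕ_; _:=_ to _:=ℕ_)

  N≡δ : N ≡ δ
  N≡δ = trans (cong ⌊_/2⌋ δδ) (half-double δ)

  sucK : suc K ≡ N
  sucK = positive N (ℕₚ.≤-trans (ℕₚ.≤-trans (ℕₚ.m^n>0 2 t') (ℕₚ.≤-trans (ℕₚ.≤-reflexive (sym (ℕₚ.*-identityʳ T))) (ℕₚ.m≤m+n (T * 1) (total q Ls)))) (ℕₚ.≤-reflexive (sym N≡δ)))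
    where
    positive : ∀ N → 1 ≤ N → suc (N ∸ 1) ≡ N
    positive (suc N) _ = refl

  represents : Represents (xⁿ+1 n) D
  represents = Represents-cong {s = D} (≈-sym fact) (Represents-* {x+1 ^ₚ q} {prodₚ (map (_^ₚ q) rs)} {w ^ₚ T} {prodₚ (map (_^ₚ q) Rs)}
    (Represents-cong {s = w ^ₚ T} (≈-trans (^-distrib-* T x+1 x+1) (≈-sym (^-double x+1 T))) (Represents-^ {x+1 *ₚ x+1} {w} T Represents-w)) (Represents-prod q Ls))

  result : ((j : ℕ) → j ≤ n → Codes.Aₖ plow (Codes.R₂ plow) j ≡ coeff j (W₂ t rs)) × ((j : ℕ) → n < j → coeff j (W₂ t rs) ≡ 0) × (ℤ.+ Codes.A plow (Codes.R₂ plow) ≡ A₂formula n t rs)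
  result = (λ j _ → C.Aₖ≡ j) , C.coeff≡0 , trans C.A≡ (sym (trans (A₂formula≡ n t Ls) (cong (λ b → ℤ.+ (2 ^ (n + 1) * 2 ^ b) ℤ.- ℤ.+ (2 * ⟪ W₂ t rs , (λ _ → 1) ⟫)) (sym sucK≡δ))))
    where
    sucK≡δ : suc K ≡ δ
    sucK≡δ = trans sucK N≡δ
    module C = EvenCode.Counting plow irr {D} (trans (cong (λ z → z + z) N≡δ) (sym δδ)) sucK (subst (Deg D) (sym sucK≡δ) degD) (annihilates {D} represents) (W₂ t rs)
      (λ h → trans (cong (λ z → S z D (weighted h)) sucK≡δ) (GeneratingFunction.S-W₂ {k} t Ls sf h))

squarefree-part : ∀ {n} t m rs → ¬ 2 ∣ m → n ≡ 2 ^ t * m →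
  xⁿ+1 n ≈ₚ ((x+1 ^ₚ (2 ^ t)) *ₚ prodₚ (map (λ r → r ^ₚ (2 ^ t)) rs)) → ∃ λ k → xⁿ+1 (suc (k + k)) ≈ x+1 *ₚ prodₚ rs
squarefree-part t m rs odd refl fact with odd⇒suc-double m odd
... | k , refl = k , squarefree-factorization t (suc (k + k)) rs (≈ₚ⇒≈ _ _ fact)

open import Data.Integer using (+_)

theorem2 : (n t m : ℕ) → ¬ (2 ∣ m) → n ≡ 2 ^ t * m →
    (rs : List Poly) → All (λ r → PrimeSelfReciprocal r × (2 ∣ deg r)) rs →
    xⁿ+1 n ≈ₚ ((x+1 ^ₚ (2 ^ t)) *ₚ prodₚ (map (λ r → r ^ₚ (2 ^ t)) rs)) →
    (plow : Vec Bool n) → Irreducible (modulusPoly plow) →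
    ((2 ∣ n →
    ((k : ℕ) → k ≤ n → Codes.Aₖ plow (Codes.R₂ plow) k ≡ coeff k (W₂ t rs))
    × ((k : ℕ) → n < k → coeff k (W₂ t rs) ≡ 0)
    × (+ Codes.A plow (Codes.R₂ plow) ≡ A₂formula n t rs))
    × (t ≡ 0 →
    ((k : ℕ) → k ≤ n → Codes.Aₖ plow (Codes.R₁ plow) k ≡ coeff k (W₁ rs))
    × ((k : ℕ) → n < k → coeff k (W₁ rs) ≡ 0)
    × (+ Codes.A plow (Codes.R₁ plow) ≡ A₁formula n rs)))
theorem2 zero t m odd n≡ rs ps fact plow irr = ⊥-elim (odd (subst (2 ∣_) (sym m≡0) (divides 0 refl)))
  where
  m≡0 : m ≡ 0
  m≡0 = ℕₚ.*-cancelˡ-≡ m 0 (2 ^ t) ⦃ ℕₚ.m^n≢0 2 t ⦄ (trans (sym n≡) (sym (ℕₚ.*-zeroʳ (2 ^ t))))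
theorem2 (suc n') zero m odd n≡ rs ps fact plow irr =
  (λ 2∣n → ⊥-elim (odd (subst (2 ∣_) (trans n≡ (ℕₚ.+-identityʳ m)) 2∣n))) ,
  (λ _ → Odd.result plow irr {proj₁ sf} (proj₂ (lifts ps)) (proj₂ sf) (≈ₚ⇒≈ _ _ fact))
  where sf = squarefree-part 0 m rs odd n≡ fact
theorem2 (suc n') (suc t') m odd n≡ rs ps fact plow irr =
  (λ _ → Even.result plow irr {proj₁ sf} (proj₂ (lifts ps)) t' (proj₂ sf) (≈ₚ⇒≈ _ _ fact)) ,
  (λ ())
  where sf = squarefree-part (suc t') m rs odd n≡ fact
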